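{- Let $\ell$ be a prime, let $L_0=\mathbb{Z}^2$, and let $M_0\subset L_0$ be a sublattice of index $\ell$. Let $ax^2+bxy+ay^2$ be a primitive reduced positive definite integral form on $L_0$ (so $\gcd(a,b)=1$) which, with the pair $(L_0,M_0)$, is a doubly well-rounded form, and let $D=b^2-4a^2$ be its discriminant. Restrict the form to $M_0$, write it in coordinates with respect to a $\mathbb{Z}$-basis of $M_0$, and reduce it; the resulting reduced form, not necessarily primitive, is $(u,v,u)$ for some integers $u,v$. Then $\gcd(u,v)=\ell$. Letting $u_1=u/\ell$ and $v_1=v/\ell$, the form $(u_1,v_1,u_1)$ is a primitive and reduced form on $M_0$ of discriminant $D$. The lattice $L_0$ and the sublattice $M_0$ have the same coefficient ring. The temperament $\tau$ of this doubly well-rounded form satisfies $$\tau^2=\ell\,\frac{u_1}{a}.$$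
   Context: Write $(a,b,c)$ for the form $ax^2+bxy+cy^2$; its matrix is $\begin{bmatrix} a&b/2\\ b/2&c\end{bmatrix}$ and its discriminant is $b^2-4ac$. All forms are positive definite. An integral form is primitive if $\gcd(a,b,c)=1$, and reduced if $|b|\leqslant a\leqslant c$, with $b\leqslant 0$ whenever $|b|=a$ or $a=c$. Reducing a form means replacing it by the unique reduced form properly equivalent to it (i.e. via $\mathrm{SL}_2(\mathbb{Z})$). Tempered perfect forms: a positive definite quadratic form $A$ on $L_0=\mathbb{Z}^2$ is a tempered perfect form for a sublattice $M_0$ of prime index $\ell$ if, after multiplying $A$ by a positive scalar, there exist non-empty sets $S\subset L_0-M_0$ and $S'\subset M_0-\{0\}$ such that (i) $vAv^T=1$ for all $v\in S$; (ii) $vAv^T>1$ for all $v\in L_0-M_0$ with $v\notin S$; (iii) $vAv^T$ has a common value, say $U\geqslant1$, for all $v\in S'$; (iv) $vAv^T>U$ for all $v\in M_0-\{0\}$ with $v\notin S'$; (v) if $B$ is any positive definite quadratic form satisfying (i)--(iv) in place of $A$ with the same $S,S'$ and with common value $U'$ on $S'$, then $B=A$ and $U'=U$. The temperament is $\tau=\sqrt{U}$. It is doubly well-rounded if $S$ contains at least two pairs $\pm v$ and $S'$ contains at least two pairs $\pm v$. Coefficient rings: embed $L_0$ in $K=\mathbb{Q}(\sqrt D)\subset\mathbb{C}$ by $(x,y)\mapsto x+y\gamma$, $\gamma=\frac{b+\sqrt D}{2a}$, so that the form becomes a multiple of the squared absolute value. The coefficient ring of a lattice $\Lambda\subset K$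 is $\{\alpha\in K\mid\alpha\Lambda\subseteq\Lambda\}$; the coefficient rings of $L_0$ and $M_0$ are those of their images in $K$. -}

module Defs where

open import Level using (0ℓ)
import Algebra.Bundles
import Algebra.Properties.CommutativeSemigroup as CommutativeSemigroupProperties
open import Data.Nat.Base as ℕ using (ℕ)
import Data.Nat.Properties as ℕ
open import Data.Integer.Base as ℤ using (ℤ; +_)
import Data.Integer.Properties as ℤ
open import Data.Integer.GCD using (gcd)
import Data.Integer.Tactic.RingSolver as ℤ-RingSolver
open import Data.Rational.Base as ℚ using (ℚ; 0ℚ; 1ℚ; ½)
import Data.Rational.Properties as ℚ
open import Data.Rational.Literals using (fromℤ)
open import Data.Fin.Base using (Fin)
open import Data.Product.Base using (Σ-syntax; ∃-syntax; _×_; _,_; proj₁; proj₂)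
open import Data.Sum.Base using (_⊎_)
open import Relation.Nullary.Negation.Core using (¬_)
import Relation.Unary
open Relation.Unary using (Pred; _∈_; _∉_)
open import Relation.Binary.PropositionalEquality

------------------------------------------------------------------------
-- Real numbers: Cauchy sequences of rationals.  The equality of reals is
-- the setoid relation _≈_.

IsCauchy : (ℕ → ℚ) → Set
IsCauchy x = ∀ ε → 0ℚ ℚ.< ε →
  ∃[ N ] (∀ m n → N ℕ.≤ m → N ℕ.≤ n → ℚ.∣ x m ℚ.- x n ∣ ℚ.< ε)

record ℝ : Set where
  constructor mkℝ
  field
    seq    : ℕ → ℚ
    cauchy : IsCauchy seq

open ℝ public

infix 4 _≈_ _<_ _≤_

_≈_ : ℝ → ℝ → Set
x ≈ y = ∀ ε → 0ℚ ℚ.< ε →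
  ∃[ N ] (∀ n → N ℕ.≤ n → ℚ.∣ seq x n ℚ.- seq y n ∣ ℚ.< ε)

_<_ : ℝ → ℝ → Set
x < y = ∃[ ε ] (0ℚ ℚ.< ε × ∃[ N ] (∀ n → N ℕ.≤ n → seq x n ℚ.+ ε ℚ.< seq y n))

_≤_ : ℝ → ℝ → Set
x ≤ y = ¬ (y < x)

private
  open CommutativeSemigroupProperties
    (Algebra.Bundles.CommutativeMonoid.commutativeSemigroup ℚ.+-0-commutativeMonoid)
    using (interchange)

  split : ∀ p q → p ≡ (p ℚ.- q) ℚ.+ q
  split p q = sym (trans (ℚ.+-assoc p (ℚ.- q) q)
    (trans (cong (p ℚ.+_) (ℚ.+-inverseˡ q)) (ℚ.+-identityʳ p)))

  sum-diff : ∀ p q r s → (p ℚ.+ q) ℚ.- (r ℚ.+ s) ≡ (p ℚ.- r) ℚ.+ (q ℚ.- s)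
  sum-diff p q r s = trans (cong ((p ℚ.+ q) ℚ.+_) (ℚ.neg-distrib-+ r s))
    (interchange p q (ℚ.- r) (ℚ.- s))

  *-distribˡ-- : ∀ p q r → p ℚ.* (q ℚ.- r) ≡ p ℚ.* q ℚ.- p ℚ.* r
  *-distribˡ-- p q r = trans (ℚ.*-distribˡ-+ p q (ℚ.- r))
    (cong (p ℚ.* q ℚ.+_) (sym (ℚ.neg-distribʳ-* p r)))

  product-diff : ∀ p q r s →
    p ℚ.* q ℚ.- r ℚ.* s ≡ p ℚ.* (q ℚ.- s) ℚ.+ s ℚ.* (p ℚ.- r)
  product-diff p q r s = let open ≡-Reasoning in begin
    p ℚ.* q ℚ.- r ℚ.* s
      ≡⟨ cong (ℚ._- r ℚ.* s) (split (p ℚ.* q) (p ℚ.* s)) ⟩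
    (p ℚ.* q ℚ.- p ℚ.* s) ℚ.+ p ℚ.* s ℚ.- r ℚ.* s
      ≡⟨ ℚ.+-assoc (p ℚ.* q ℚ.- p ℚ.* s) (p ℚ.* s) (ℚ.- (r ℚ.* s)) ⟩
    (p ℚ.* q ℚ.- p ℚ.* s) ℚ.+ (p ℚ.* s ℚ.- r ℚ.* s)
      ≡⟨ cong₂ (λ x y → (p ℚ.* q ℚ.- p ℚ.* s) ℚ.+ (x ℚ.- y)) (ℚ.*-comm p s) (ℚ.*-comm r s) ⟩
    (p ℚ.* q ℚ.- p ℚ.* s) ℚ.+ (s ℚ.* p ℚ.- s ℚ.* r)
      ≡⟨ cong₂ ℚ._+_ (*-distribˡ-- p q s) (*-distribˡ-- s p r) ⟨
    p ℚ.* (q ℚ.- s) ℚ.+ s ℚ.* (p ℚ.- r) ∎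

  half-pos : ∀ {ε} → 0ℚ ℚ.< ε → 0ℚ ℚ.< ½ ℚ.* ε
  half-pos {ε} 0<ε =
    ℚ.positive⁻¹ (½ ℚ.* ε) {{ℚ.pos*pos⇒pos ½ ε {{ℚ.positive 0<ε}}}}

  halves : ∀ ε → ½ ℚ.* ε ℚ.+ ½ ℚ.* ε ≡ ε
  halves ε = trans (sym (ℚ.*-distribʳ-+ ε ½ ½)) (ℚ.*-identityˡ ε)

  opaque
    +-cauchy : ∀ {x y} → IsCauchy x → IsCauchy y → IsCauchy (λ n → x n ℚ.+ y n)
    +-cauchy {x} {y} cx cy ε 0<ε
      with cx (½ ℚ.* ε) (half-pos 0<ε) | cy (½ ℚ.* ε) (half-pos 0<ε)
    ... | N₁ , h₁ | N₂ , h₂ = N₁ ℕ.⊔ N₂ , λ m n N≤m N≤n →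
      let open ℚ.≤-Reasoning in begin-strict
      ℚ.∣ (x m ℚ.+ y m) ℚ.- (x n ℚ.+ y n) ∣
        ≡⟨ cong ℚ.∣_∣ (sum-diff (x m) (y m) (x n) (y n)) ⟩
      ℚ.∣ (x m ℚ.- x n) ℚ.+ (y m ℚ.- y n) ∣
        ≤⟨ ℚ.∣p+q∣≤∣p∣+∣q∣ (x m ℚ.- x n) (y m ℚ.- y n) ⟩
      ℚ.∣ x m ℚ.- x n ∣ ℚ.+ ℚ.∣ y m ℚ.- y n ∣
        <⟨ ℚ.+-mono-<
             (h₁ m n (ℕ.m⊔n≤o⇒m≤o N₁ N₂ N≤m) (ℕ.m⊔n≤o⇒m≤o N₁ N₂ N≤n))
             (h₂ m n (ℕ.m⊔n≤o⇒n≤o N₁ N₂ N≤m) (ℕ.m⊔n≤o⇒n≤o N₁ N₂ N≤n)) ⟩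
      ½ ℚ.* ε ℚ.+ ½ ℚ.* ε
        ≡⟨ halves ε ⟩
      ε ∎

  0<1 : 0ℚ ℚ.< 1ℚ
  0<1 = ℚ.positive⁻¹ 1ℚ

  bounded : ∀ {x} → IsCauchy x →
    ∃[ K ] (0ℚ ℚ.< K × ∃[ N ] (∀ n → N ℕ.≤ n → ℚ.∣ x n ∣ ℚ.≤ K))
  bounded {x} cx = K , 0<K , N , bound
    where
    N = proj₁ (cx 1ℚ 0<1)
    K = 1ℚ ℚ.+ ℚ.∣ x N ∣
    0<K : 0ℚ ℚ.< K
    0<K = ℚ.+-mono-<-≤ 0<1 (ℚ.0≤∣p∣ (x N))
    bound : ∀ n → N ℕ.≤ n → ℚ.∣ x n ∣ ℚ.≤ K
    bound n N≤n = let open ℚ.≤-Reasoning in begin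
      ℚ.∣ x n ∣
        ≡⟨ cong ℚ.∣_∣ (split (x n) (x N)) ⟩
      ℚ.∣ (x n ℚ.- x N) ℚ.+ x N ∣
        ≤⟨ ℚ.∣p+q∣≤∣p∣+∣q∣ (x n ℚ.- x N) (x N) ⟩
      ℚ.∣ x n ℚ.- x N ∣ ℚ.+ ℚ.∣ x N ∣
        ≤⟨ ℚ.+-monoˡ-≤ ℚ.∣ x N ∣
             (ℚ.<⇒≤ (proj₂ (cx 1ℚ 0<1) n N N≤n ℕ.≤-refl)) ⟩
      K ∎

  scaled-bound : ∀ {K δ} p q → 0ℚ ℚ.< K → ℚ.∣ p ∣ ℚ.≤ K → ℚ.∣ q ∣ ℚ.< δ →
    ℚ.∣ p ℚ.* q ∣ ℚ.< K ℚ.* δ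
  scaled-bound {K} {δ} p q 0<K ∣p∣≤K ∣q∣<δ = let open ℚ.≤-Reasoning in begin-strict
    ℚ.∣ p ℚ.* q ∣
      ≡⟨ ℚ.∣p*q∣≡∣p∣*∣q∣ p q ⟩
    ℚ.∣ p ∣ ℚ.* ℚ.∣ q ∣
      ≤⟨ ℚ.*-monoʳ-≤-nonNeg ℚ.∣ q ∣ {{ℚ.∣-∣-nonNeg q}} ∣p∣≤K ⟩
    K ℚ.* ℚ.∣ q ∣
      <⟨ ℚ.*-monoʳ-<-pos K {{ℚ.positive 0<K}} ∣q∣<δ ⟩
    K ℚ.* δ ∎

  -- For K > 0 and ε > 0 the rational δ = ε / (2K).
  shrink : ∀ {K ε} → 0ℚ ℚ.< K → 0ℚ ℚ.< ε → ∃[ δ ] (0ℚ ℚ.< δ × K ℚ.* δ ≡ ½ ℚ.* ε)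
  shrink {K} {ε} 0<K 0<ε = δ , 0<δ , Kδ
    where
    instance
      K-pos : ℚ.Positive K
      K-pos = ℚ.positive 0<K
      K≢0 : ℚ.NonZero K
      K≢0 = ℚ.pos⇒nonZero K
    δ = ℚ.1/ K ℚ.* (½ ℚ.* ε)
    0<δ : 0ℚ ℚ.< δ
    0<δ = ℚ.positive⁻¹ δ
      {{ℚ.pos*pos⇒pos (ℚ.1/ K) {{ℚ.1/pos⇒pos K}} (½ ℚ.* ε) {{ℚ.positive (half-pos 0<ε)}}}}
    Kδ : K ℚ.* δ ≡ ½ ℚ.* ε
    Kδ = trans (sym (ℚ.*-assoc K (ℚ.1/ K) (½ ℚ.* ε)))
        (trans (cong (ℚ._* (½ ℚ.* ε)) (ℚ.*-inverseʳ K)) (ℚ.*-identityˡ (½ ℚ.* ε)))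

  opaque
    *-cauchy : ∀ {x y} → IsCauchy x → IsCauchy y → IsCauchy (λ n → x n ℚ.* y n)
    *-cauchy {x} {y} cx cy ε 0<ε
      with bounded {x} cx | bounded {y} cy
    ... | K , 0<K , A , ∣x∣≤K | L , 0<L , B , ∣y∣≤L
      with shrink 0<K 0<ε | shrink 0<L 0<ε
    ... | δ , 0<δ , Kδ | η , 0<η , Lη
      with cy δ 0<δ | cx η 0<η
    ... | M , hy | N , hx = (A ℕ.⊔ B) ℕ.⊔ (M ℕ.⊔ N) , λ m n ≤m ≤n →
      let open ℚ.≤-Reasoning in begin-strict
      ℚ.∣ x m ℚ.* y m ℚ.- x n ℚ.* y n ∣
        ≡⟨ cong ℚ.∣_∣ (product-diff (x m) (y m) (x n) (y n)) ⟩
      ℚ.∣ x m ℚ.* (y m ℚ.- y n) ℚ.+ y n ℚ.* (x m ℚ.- x n) ∣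
        ≤⟨ ℚ.∣p+q∣≤∣p∣+∣q∣ (x m ℚ.* (y m ℚ.- y n)) (y n ℚ.* (x m ℚ.- x n)) ⟩
      ℚ.∣ x m ℚ.* (y m ℚ.- y n) ∣ ℚ.+ ℚ.∣ y n ℚ.* (x m ℚ.- x n) ∣
        <⟨ ℚ.+-mono-<
             (scaled-bound (x m) (y m ℚ.- y n) 0<K (∣x∣≤K m (toA ≤m)) (hy m n (toM ≤m) (toM ≤n)))
             (scaled-bound (y n) (x m ℚ.- x n) 0<L (∣y∣≤L n (toB ≤n)) (hx m n (toN ≤m) (toN ≤n))) ⟩
      K ℚ.* δ ℚ.+ L ℚ.* η
        ≡⟨ cong₂ ℚ._+_ Kδ Lη ⟩
      ½ ℚ.* ε ℚ.+ ½ ℚ.* ε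
        ≡⟨ halves ε ⟩
      ε ∎
      where
      toAB : ∀ {k} → (A ℕ.⊔ B) ℕ.⊔ (M ℕ.⊔ N) ℕ.≤ k → A ℕ.⊔ B ℕ.≤ k
      toAB = ℕ.m⊔n≤o⇒m≤o (A ℕ.⊔ B) (M ℕ.⊔ N)
      toMN : ∀ {k} → (A ℕ.⊔ B) ℕ.⊔ (M ℕ.⊔ N) ℕ.≤ k → M ℕ.⊔ N ℕ.≤ k
      toMN = ℕ.m⊔n≤o⇒n≤o (A ℕ.⊔ B) (M ℕ.⊔ N)
      toA : ∀ {k} → (A ℕ.⊔ B) ℕ.⊔ (M ℕ.⊔ N) ℕ.≤ k → A ℕ.≤ k
      toA h = ℕ.m⊔n≤o⇒m≤o A B (toAB h)
      toB : ∀ {k} → (A ℕ.⊔ B) ℕ.⊔ (M ℕ.⊔ N) ℕ.≤ k → B ℕ.≤ k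
      toB h = ℕ.m⊔n≤o⇒n≤o A B (toAB h)
      toM : ∀ {k} → (A ℕ.⊔ B) ℕ.⊔ (M ℕ.⊔ N) ℕ.≤ k → M ℕ.≤ k
      toM h = ℕ.m⊔n≤o⇒m≤o M N (toMN h)
      toN : ∀ {k} → (A ℕ.⊔ B) ℕ.⊔ (M ℕ.⊔ N) ℕ.≤ k → N ℕ.≤ k
      toN h = ℕ.m⊔n≤o⇒n≤o M N (toMN h)

infixl 6 _+_
infixl 7 _*_

_+_ : ℝ → ℝ → ℝ
seq    (x + y) n = seq x n ℚ.+ seq y n
cauchy (x + y)   = +-cauchy {seq x} {seq y} (cauchy x) (cauchy y)

_*_ : ℝ → ℝ → ℝ
seq    (x * y) n = seq x n ℚ.* seq y n
cauchy (x * y)   = *-cauchy {seq x} {seq y} (cauchy x) (cauchy y)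

ℚ⇒ℝ : ℚ → ℝ
ℚ⇒ℝ p = mkℝ (λ _ → p) λ ε 0<ε →
  0 , λ _ _ _ _ → subst (λ q → ℚ.∣ q ∣ ℚ.< ε) (sym (ℚ.+-inverseʳ p)) 0<ε

ℤ⇒ℝ : ℤ → ℝ
ℤ⇒ℝ i = ℚ⇒ℝ (fromℤ i)

0ℝ 1ℝ : ℝ
0ℝ = ℚ⇒ℝ 0ℚ
1ℝ = ℚ⇒ℝ 1ℚ

-- Apartness; for classical reals this is x ≠ y.
_#_ : ℝ → ℝ → Set
x # y = x < y ⊎ y < x

-- IsSqrt r x says r = √x.
IsSqrt : ℝ → ℝ → Set
IsSqrt r x = 0ℝ ≤ r × r * r ≈ x

------------------------------------------------------------------------
-- The lattice ℤ² and its sublattices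

ℤ² : Set
ℤ² = ℤ × ℤ

0² : ℤ²
0² = + 0 , + 0

infixl 6 _+²_ _-²_
infixl 7 _·²_

_+²_ _-²_ : ℤ² → ℤ² → ℤ²
(x , y) +² (x′ , y′) = x ℤ.+ x′ , y ℤ.+ y′
(x , y) -² (x′ , y′) = x ℤ.- x′ , y ℤ.- y′

-²_ : ℤ² → ℤ²
-² (x , y) = ℤ.- x , ℤ.- y

_·²_ : ℤ → ℤ² → ℤ²
k ·² (x , y) = k ℤ.* x , k ℤ.* y

L₀ : Pred ℤ² 0ℓ
L₀ = Relation.Unary.U

record IsSublattice (M : Pred ℤ² 0ℓ) : Set where
  field
    0∈ : 0² ∈ M
    +∈ : ∀ {v w} → v ∈ M → w ∈ M → v +² w ∈ M
    -∈ : ∀ {v} → v ∈ M → -² v ∈ M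

-- The index of M in ℤ² is n: there is a system of n coset representatives.
record HasIndex (M : Pred ℤ² 0ℓ) (n : ℕ) : Set where
  field
    rep      : Fin n → ℤ²
    covers   : ∀ v → ∃[ i ] (v -² rep i ∈ M)
    distinct : ∀ i j → rep i -² rep j ∈ M → i ≡ j

record IsBasis (M : Pred ℤ² 0ℓ) (w₁ w₂ : ℤ²) : Set where
  field
    w₁∈         : w₁ ∈ M
    w₂∈         : w₂ ∈ M
    spanning    : ∀ {v} → v ∈ M → ∃[ x ] ∃[ y ] (v ≡ x ·² w₁ +² y ·² w₂)
    independent : ∀ x y → x ·² w₁ +² y ·² w₂ ≡ 0² → x ≡ + 0 × y ≡ + 0

-- The set contains at least two pairs ±v.
TwoPairs : Pred ℤ² 0ℓ → Set
TwoPairs S = ∃[ v ] ∃[ w ]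
  (v ∈ S × -² v ∈ S × w ∈ S × -² w ∈ S × w ≢ v × w ≢ -² v)

------------------------------------------------------------------------
-- Integral forms (a,b,c) = ax² + bxy + cy²

record Form : Set where
  constructor form
  field
    a b c : ℤ

eval : Form → ℤ² → ℤ
eval (form a b c) (x , y) = a ℤ.* (x ℤ.* x) ℤ.+ b ℤ.* (x ℤ.* y) ℤ.+ c ℤ.* (y ℤ.* y)

disc : Form → ℤ
disc (form a b c) = b ℤ.* b ℤ.- + 4 ℤ.* a ℤ.* c

PositiveDefinite : Form → Set
PositiveDefinite f = ∀ v → v ≢ 0² → + 0 ℤ.< eval f v

Primitive : Form → Set
Primitive (form a b c) = gcd (gcd a b) c ≡ + 1

record Reduced (f : Form) : Set where
  open Form f
  field
    ∣b∣≤a : + ℤ.∣ b ∣ ℤ.≤ a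
    a≤c   : a ℤ.≤ c
    sign  : + ℤ.∣ b ∣ ≡ a ⊎ a ≡ c → b ℤ.≤ + 0

-- The form (x,y) ↦ f(xv + yw); see eval-pullback.
pullback : Form → ℤ² → ℤ² → Form
pullback (form a b c) (p , r) (q , s) = form
  (eval (form a b c) (p , r))
  (+ 2 ℤ.* a ℤ.* p ℤ.* q ℤ.+ b ℤ.* (p ℤ.* s ℤ.+ q ℤ.* r) ℤ.+ + 2 ℤ.* c ℤ.* r ℤ.* s)
  (eval (form a b c) (q , s))

eval-pullback : ∀ f v w x y →
  eval (pullback f v w) (x , y) ≡ eval f (x ·² v +² y ·² w)
eval-pullback (form a b c) (p , r) (q , s) x y = identity a b c p q r s x y
  where
  identity : ∀ a b c p q r s x y →
    (a ℤ.* (p ℤ.* p) ℤ.+ b ℤ.* (p ℤ.* r) ℤ.+ c ℤ.* (r ℤ.* r)) ℤ.* (x ℤ.* x)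
    ℤ.+ (+ 2 ℤ.* a ℤ.* p ℤ.* q ℤ.+ b ℤ.* (p ℤ.* s ℤ.+ q ℤ.* r) ℤ.+ + 2 ℤ.* c ℤ.* r ℤ.* s) ℤ.* (x ℤ.* y)
    ℤ.+ (a ℤ.* (q ℤ.* q) ℤ.+ b ℤ.* (q ℤ.* s) ℤ.+ c ℤ.* (s ℤ.* s)) ℤ.* (y ℤ.* y)
    ≡ a ℤ.* ((x ℤ.* p ℤ.+ y ℤ.* q) ℤ.* (x ℤ.* p ℤ.+ y ℤ.* q))
      ℤ.+ b ℤ.* ((x ℤ.* p ℤ.+ y ℤ.* q) ℤ.* (x ℤ.* r ℤ.+ y ℤ.* s))
      ℤ.+ c ℤ.* ((x ℤ.* r ℤ.+ y ℤ.* s) ℤ.* (x ℤ.* r ℤ.+ y ℤ.* s))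
  identity = ℤ-RingSolver.solve-∀

infix 4 _~_

-- Proper equivalence, i.e. by a substitution in SL₂(ℤ).
_~_ : Form → Form → Set
f ~ g = ∃[ p ] ∃[ q ] ∃[ r ] ∃[ s ]
  (p ℤ.* s ℤ.- q ℤ.* r ≡ + 1 × g ≡ pullback f (p , r) (q , s))

-- Reducing f gives g: g is the unique reduced form properly equivalent to f.
record ReducesTo (f g : Form) : Set where
  field
    equivalent : f ~ g
    reduced    : Reduced g
    unique     : ∀ {h} → f ~ h → Reduced h → h ≡ g

posDef⇒a≢0 : ∀ f → PositiveDefinite f → ℤ.NonZero (Form.a f)
posDef⇒a≢0 f@(form a b c) pd = ℤ.>-nonZero (subst (+ 0 ℤ.<_) eval-e₁ (pd (+ 1 , + 0) λ ()))
  where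
  eval-e₁ : eval f (+ 1 , + 0) ≡ a
  eval-e₁ rewrite ℤ.*-identityʳ a | ℤ.*-zeroʳ b | ℤ.*-zeroʳ c
    | ℤ.+-identityʳ a | ℤ.+-identityʳ a = refl

quotient : (i j : ℤ) .{{_ : ℤ.NonZero j}} → ℚ
quotient i j {{j≢0}} = (fromℤ i ℚ.÷ fromℤ j) {{j≢0}}

------------------------------------------------------------------------
-- Coefficient rings

-- ⟨ p , q ⟩ is p + q√D.  For D not a square (in particular D < 0) this
-- represents ℚ(√D).
record ℚ√ (D : ℤ) : Set where
  constructor ⟨_,_⟩
  field
    rat irr : ℚ

infixl 7 _⊗_

_⊗_ : ∀ {D} → ℚ√ D → ℚ√ D → ℚ√ D
_⊗_ {D} ⟨ p , q ⟩ ⟨ r , s ⟩ =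
  ⟨ p ℚ.* r ℚ.+ fromℤ D ℚ.* (q ℚ.* s) , p ℚ.* s ℚ.+ q ℚ.* r ⟩

-- (x,y) ↦ x + yγ, where γ = (b + √D) / 2a.
embed : (f : Form) → PositiveDefinite f → ℤ² → ℚ√ (disc f)
embed f pd (x , y) =
  ⟨ fromℤ x ℚ.+ fromℤ y ℚ.* quotient b (+ 2 ℤ.* a) , fromℤ y ℚ.* quotient (+ 1) (+ 2 ℤ.* a) ⟩
  where
  open Form f
  instance
    2a≢0 : ℤ.NonZero (+ 2 ℤ.* a)
    2a≢0 = ℤ.i*j≢0 (+ 2) a {{_}} {{posDef⇒a≢0 f pd}}

image : (f : Form) → PositiveDefinite f → Pred ℤ² 0ℓ → Pred (ℚ√ (disc f)) 0ℓ
image f pd M z = ∃[ v ] (v ∈ M × embed f pd v ≡ z)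

coefficientRing : ∀ {D} → Pred (ℚ√ D) 0ℓ → Pred (ℚ√ D) 0ℓ
coefficientRing Λ α = ∀ {z} → z ∈ Λ → α ⊗ z ∈ Λ

------------------------------------------------------------------------
-- Real forms and tempered perfect forms

record Formℝ : Set where
  constructor formℝ
  field
    a b c : ℝ

evalℝ : Formℝ → ℝ → ℝ → ℝ
evalℝ (formℝ a b c) x y = a * (x * x) + b * (x * y) + c * (y * y)

infix 8 _⟦_⟧

_⟦_⟧ : Formℝ → ℤ² → ℝ
A ⟦ x , y ⟧ = evalℝ A (ℤ⇒ℝ x) (ℤ⇒ℝ y)

PositiveDefiniteℝ : Formℝ → Set
PositiveDefiniteℝ A = ∀ x y → x # 0ℝ ⊎ y # 0ℝ → 0ℝ < evalℝ A x y

scale : ℝ → Formℝ → Formℝ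
scale s (formℝ a b c) = formℝ (s * a) (s * b) (s * c)

infix 4 _≈ᶠ_

_≈ᶠ_ : Formℝ → Formℝ → Set
formℝ a b c ≈ᶠ formℝ a′ b′ c′ = a ≈ a′ × b ≈ b′ × c ≈ c′

toℝ : Form → Formℝ
toℝ (form a b c) = formℝ (ℤ⇒ℝ a) (ℤ⇒ℝ b) (ℤ⇒ℝ c)

-- Conditions (i)–(iv) for a form A, the sets S, S′ and the common value U.
record Tempered (M S S′ : Pred ℤ² 0ℓ) (A : Formℝ) (U : ℝ) : Set where
  field
    S-value  : ∀ v → v ∈ S → A ⟦ v ⟧ ≈ 1ℝ
    S-min    : ∀ v → v ∉ M → v ∉ S → 1ℝ < A ⟦ v ⟧
    S′-value : ∀ v → v ∈ S′ → A ⟦ v ⟧ ≈ U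
    1≤U      : 1ℝ ≤ U
    S′-min   : ∀ v → v ∈ M → v ≢ 0² → v ∉ S′ → U < A ⟦ v ⟧

record TemperedPerfect (A : Formℝ) (M : Pred ℤ² 0ℓ) : Set₁ where
  field
    posDef      : PositiveDefiniteℝ A
    scalar      : ℝ
    0<scalar    : 0ℝ < scalar
    S S′        : Pred ℤ² 0ℓ
    U           : ℝ
    S-nonEmpty  : ∃[ v ] (v ∈ S)
    S′-nonEmpty : ∃[ v ] (v ∈ S′)
    S⊂L₀-M      : ∀ {v} → v ∈ S → v ∉ M
    S′⊂M-0      : ∀ {v} → v ∈ S′ → v ∈ M × v ≢ 0²
    tempered    : Tempered M S S′ (scale scalar A) U
    perfect     : ∀ B U′ → PositiveDefiniteℝ B → Tempered M S S′ B U′ →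
                  B ≈ᶠ scale scalar A × U′ ≈ U

  IsTemperament : ℝ → Set
  IsTemperament τ = IsSqrt τ U

  DoublyWellRounded : Set
  DoublyWellRounded = TwoPairs S × TwoPairs S′

{-# OPTIONS --safe #-}

-- Two independent vectors of least norm in M₀ provide a basis of M₀ in which the form is
-- (u,v,u) with |v| ≤ u; it has discriminant ℓ²D.  Suppose that ℓ does not divide u.  As ℓ
-- divides (2u - v)(2u + v), the form on M₀ is modulo ℓ a multiple of the square of x + y or
-- of x - y, and comparison with ℓ²f on L₀ shows that the basis vectors of M₀ are congruent
-- modulo ℓL₀ up to sign.  Dividing their difference or sum by ℓ gives a vector z of L₀, and
-- f(z) ≥ a together with the discriminant leaves only ℓ = 2 with f a multiple of x² + y² and
-- ℓ = 3 with f a multiple of x² - xy + y².  There ℓ divides u after all.  Hence ℓ divides u and v.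
--
-- The gcd of u/ℓ and v/ℓ divides ℓ because f is primitive, and it is not ℓ by the same
-- argument applied to L₀ as a sublattice of ℓ⁻¹M₀.  The discriminants also give u > a, so
-- that the minimal vectors of L₀ are not in M₀; they are the ones scaled to norm 1, whence
-- τ² = u/a.  Finally, both coefficient rings are ℤ + ℤω with ω = (b + √D)/2.

module Submission where

open import Level using (0ℓ)
open import Function.Base using (_∘_; id)
open import Data.Nat.Base as ℕ using (ℕ)
import Data.Nat.Properties as ℕ
import Data.Nat.GCD as ℕ
import Data.Nat.Divisibility as ℕ
open import Data.Nat.Primality using (Prime; euclidsLemma; prime⇒irreducible; prime⇒nonZero; prime⇒nonTrivial; ¬prime[0]; ¬prime[1]; prime[2])
open import Data.Integer.Base as ℤ using (ℤ; +_; _+_; _-_; -_; _≤_; _<_) renaming (_*_ to infixl 7 _·_)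
import Data.Integer.Properties as ℤ
open import Data.Integer.Divisibility.Signed using (_∣_; divides)
import Data.Integer.Divisibility.Signed as ∣
import Data.Integer.DivMod as ℤ
open import Data.Integer.GCD using (gcd; gcd[i,j]∣i; gcd[i,j]∣j)
import Data.Integer.Tactic.RingSolver as ℤ-RingSolver
open import Data.Rational.Base as ℚ using (ℚ; 0ℚ; 1ℚ)
import Data.Rational.Properties as ℚ
import Data.Rational.Unnormalised.Base as ℚᵘ
import Data.Rational.Unnormalised.Properties as ℚᵘ
open import Data.Rational.Literals using (fromℤ)
open import Data.Fin.Base as Fin using (Fin)
import Data.Fin.Properties as Fin
open import Data.Product.Base using (∃-syntax; _×_; _,_; proj₁; proj₂)
open import Data.Sum.Base using (_⊎_; inj₂; [_,_]′)
import Data.Sum.Base as Sum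
open import Relation.Unary using (Pred; _∈_; _∉_; _≐_)
open import Relation.Nullary using (¬_; yes; no; contradiction)
open import Relation.Nullary.Decidable using (decidable-stable; dec⇒maybe)
open import Relation.Binary.PropositionalEquality using (_≡_; _≢_; refl; sym; trans; cong; cong₂; subst; subst₂; module ≡-Reasoning)
import Tactic.RingSolver.NonReflective
open import Tactic.RingSolver.Core.AlmostCommutativeRing using (fromCommutativeRing)
open import Defs as R hiding (_+_; _<_; _≤_; _⊗_)

-- None of `M₀`, `S` and `S′` comes with a decision procedure, so the proof never branches on
-- membership: it refutes the failure of an integral inequality or divisibility, which is decidable.
-- Equal outer coefficients drive the divisibility: 4u² - v² factors over ℤ, and once ℓ divides a
-- factor the form on M₀ is, modulo ℓ, u times the square of a linear form, which must vanish on
-- ℓL₀. In coordinates the inclusion of ℓL₀ in M₀ is the adjugate of the basis matrix of M₀, up to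
-- sign. The same adjugate presents L₀ inside ℓ⁻¹M₀, so one lemma serves twice; the second time it
-- would make ℓ divide both a and b. The index is given by coset representatives and must first be
-- identified with the absolute value of a determinant, which is done by counting. Most inequalities
-- between forms are certified by a polynomial identity that exhibits a difference as a sum of
-- visibly nonnegative terms.

module Polynomial = Tactic.RingSolver.NonReflective ℤ-RingSolver.ring

open Polynomial using (Expr; Κ; solve)
  renaming (_⊕_ to infixl 6 _:+_; _⊗_ to infixl 7 _:*_; ⊝_ to infix 8 :-_)

infix  4 _:=_
infixl 6 _:-_

_:=_ : ∀ {A : Set} {n} → Expr A n → Expr A n → Expr A n × Expr A n
_:=_ = _,_

_:-_ : ∀ {A : Set} {n} → Expr A n → Expr A n → Expr A n
x :- y = x :+ :- y

-- Expression-level mirrors of the operations on vectors and forms. They let solver goals be written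
-- with `eval`, `pullback`, `disc` and `det` instead of their expansions in coordinates.
Vecᵉ Formᵉ : ℕ → Set
Vecᵉ n  = Expr ℤ n × Expr ℤ n
Formᵉ n = Expr ℤ n × Expr ℤ n × Expr ℤ n

evalᵉ : ∀ {n} → Formᵉ n → Vecᵉ n → Expr ℤ n
evalᵉ (a , b , c) (x , y) = a :* (x :* x) :+ b :* (x :* y) :+ c :* (y :* y)

polarᵉ : ∀ {n} → Formᵉ n → Vecᵉ n → Vecᵉ n → Expr ℤ n
polarᵉ (a , b , c) (p , r) (q , s) =
  Κ (+ 2) :* a :* p :* q :+ b :* (p :* s :+ q :* r) :+ Κ (+ 2) :* c :* r :* s

pullbackᵉ : ∀ {n} → Formᵉ n → Vecᵉ n → Vecᵉ n → Formᵉ n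
pullbackᵉ f v w = evalᵉ f v , polarᵉ f v w , evalᵉ f w

discᵉ : ∀ {n} → Formᵉ n → Expr ℤ n
discᵉ (a , b , c) = b :* b :- Κ (+ 4) :* a :* c

detᵉ : ∀ {n} → Vecᵉ n → Vecᵉ n → Expr ℤ n
detᵉ (p , r) (q , s) = p :* s :- q :* r

combᵉ : ∀ {n} → Vecᵉ n → Vecᵉ n → Vecᵉ n → Vecᵉ n
combᵉ (x , y) (p , r) (q , s) = x :* p :+ y :* q , x :* r :+ y :* s

-- Inequalities of integers

≤-by-difference : ∀ {i j} e → j - i ≡ e → + 0 ≤ e → i ≤ j
≤-by-difference e eq 0≤e = ℤ.0≤i-j⇒j≤i (subst (+ 0 ≤_) (sym eq) 0≤e)

+-nonNeg : ∀ {i j} → + 0 ≤ i → + 0 ≤ j → + 0 ≤ i + j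
+-nonNeg = ℤ.+-mono-≤

·-nonNeg : ∀ {i j} → + 0 ≤ i → + 0 ≤ j → + 0 ≤ i · j
·-nonNeg {+ m} {+ n} _ _ = subst (+ 0 ≤_) (ℤ.pos-* m n) (ℤ.+≤+ ℕ.z≤n)

·-pos : ∀ {i j} → + 0 < i → + 0 < j → + 0 < i · j
·-pos {+ 0} (ℤ.+<+ ())
·-pos {ℤ.+[1+ m ]} {+ 0} _ (ℤ.+<+ ())
·-pos {ℤ.+[1+ m ]} {ℤ.+[1+ n ]} _ _ = ℤ.+<+ (ℕ.s≤s ℕ.z≤n)

square-nonNeg : ∀ i → + 0 ≤ i · i
square-nonNeg (+ n)      = ·-nonNeg {+ n} {+ n} (ℤ.+≤+ ℕ.z≤n) (ℤ.+≤+ ℕ.z≤n)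
square-nonNeg ℤ.-[1+ n ] = ℤ.+≤+ ℕ.z≤n

square-pos : ∀ {i} → i ≢ + 0 → + 0 < i · i
square-pos {+ 0}        i≢0 = contradiction refl i≢0
square-pos {ℤ.+[1+ n ]} _   = ℤ.+<+ (ℕ.s≤s ℕ.z≤n)
square-pos {ℤ.-[1+ n ]} _   = ℤ.+<+ (ℕ.s≤s ℕ.z≤n)

0≤difference : ∀ {i j} → i ≤ j → + 0 ≤ j - i
0≤difference = ℤ.i≤j⇒0≤j-i

0<⇒0≤pred : ∀ {i} → + 0 < i → + 0 ≤ i - + 1
0<⇒0≤pred 0<i = 0≤difference (ℤ.i<j⇒suc[i]≤j 0<i)

cancel-nonNeg : ∀ k {i} → + 0 < k → + 0 ≤ k · i → + 0 ≤ i
cancel-nonNeg k {i} 0<k 0≤ki =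
  ℤ.*-cancelˡ-≤-pos (+ 0) i k {{ℤ.positive 0<k}} (subst (_≤ k · i) (sym (ℤ.*-zeroʳ k)) 0≤ki)

cancel-pos : ∀ k {i} → + 0 ≤ k → + 0 < k · i → + 0 < i
cancel-pos k {i} 0≤k 0<ki =
  ℤ.*-cancelˡ-<-nonNeg k {{ℤ.nonNegative 0≤k}} (subst (_< k · i) (sym (ℤ.*-zeroʳ k)) 0<ki)

0≤2 : + 0 ≤ + 2
0≤2 = ℤ.+≤+ ℕ.z≤n

0≤4 : + 0 ≤ + 4
0≤4 = ℤ.+≤+ ℕ.z≤n

-- Substitutions in binary forms

det : ℤ² → ℤ² → ℤ
det (p , r) (q , s) = p · s - q · r

form-≡ : ∀ {a b c a′ b′ c′} → a ≡ a′ → b ≡ b′ → c ≡ c′ → form a b c ≡ form a′ b′ c′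
form-≡ refl refl refl = refl

form-injective : ∀ {a b c a′ b′ c′} → form a b c ≡ form a′ b′ c′ → a ≡ a′ × b ≡ b′ × c ≡ c′
form-injective refl = refl , refl , refl

disc-pullback : ∀ f v w → disc (pullback f v w) ≡ det v w · det v w · disc f
disc-pullback (form a b c) (p , r) (q , s) = identity a b c p r q s
  where
  identity : ∀ a b c p r q s → let f = form a b c in
    disc (pullback f (p , r) (q , s))
      ≡ det (p , r) (q , s) · det (p , r) (q , s) · disc f
  identity = solve 7 (λ a b c p r q s → let f = a , b , c ; v = p , r ; w = q , s in
    discᵉ (pullbackᵉ f v w) := detᵉ v w :* detᵉ v w :* discᵉ f) refl

pullback-pullback : ∀ f v w x y z t →
  pullback (pullback f v w) (x , y) (z , t)
    ≡ pullback f (x ·² v +² y ·² w) (z ·² v +² t ·² w)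
pullback-pullback f@(form a b c) v@(p , r) w@(q , s) x y z t =
  form-≡ (eval-pullback f v w x y) (identity a b c p r q s x y z t) (eval-pullback f v w z t)
  where
  identity : ∀ a b c p r q s x y z t → let f = form a b c ; v = p , r ; w = q , s in
    Form.b (pullback (pullback f v w) (x , y) (z , t))
      ≡ Form.b (pullback f (x ·² v +² y ·² w) (z ·² v +² t ·² w))
  identity = solve 11 (λ a b c p r q s x y z t →
    let f = a , b , c ; v = p , r ; w = q , s in
    polarᵉ (pullbackᵉ f v w) (x , y) (z , t)
      := polarᵉ f (combᵉ (x , y) v w) (combᵉ (z , t) v w)) refl

det-combination : ∀ v w x y z t →
  det (x ·² v +² y ·² w) (z ·² v +² t ·² w) ≡ det (x , y) (z , t) · det v w
det-combination (p , r) (q , s) x y z t = identity p r q s x y z t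
  where
  identity : ∀ p r q s x y z t → let v = p , r ; w = q , s in
    det (x ·² v +² y ·² w) (z ·² v +² t ·² w) ≡ det (x , y) (z , t) · det v w
  identity = solve 8 (λ p r q s x y z t → let v = p , r ; w = q , s in
    detᵉ (combᵉ (x , y) v w) (combᵉ (z , t) v w) := detᵉ (x , y) (z , t) :* detᵉ v w) refl

-- A matrix times its adjugate is the scalar matrix d, and a form is homogeneous of degree 2.
pullback-adjugate : ∀ a b c p r q s → let d = det (p , r) (q , s) in
  pullback (pullback (form a b c) (p , r) (q , s)) (s , - r) (- q , p) ≡ form (d · d · a) (d · d · b) (d · d · c)
pullback-adjugate a b c p r q s = form-≡ (first a b c p r q s) (second a b c p r q s) (third a b c p r q s)
  where
  first : ∀ a b c p r q s →
    eval (pullback (form a b c) (p , r) (q , s)) (s , - r) ≡ det (p , r) (q , s) · det (p , r) (q , s) · a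
  first = solve 7 (λ a b c p r q s → let v = p , r ; w = q , s in
    evalᵉ (pullbackᵉ (a , b , c) v w) (s , :- r) := detᵉ v w :* detᵉ v w :* a) refl
  second : ∀ a b c p r q s →
    Form.b (pullback (pullback (form a b c) (p , r) (q , s)) (s , - r) (- q , p))
      ≡ det (p , r) (q , s) · det (p , r) (q , s) · b
  second = solve 7 (λ a b c p r q s → let v = p , r ; w = q , s in
    polarᵉ (pullbackᵉ (a , b , c) v w) (s , :- r) (:- q , p) := detᵉ v w :* detᵉ v w :* b) refl
  third : ∀ a b c p r q s →
    eval (pullback (form a b c) (p , r) (q , s)) (- q , p) ≡ det (p , r) (q , s) · det (p , r) (q , s) · c
  third = solve 7 (λ a b c p r q s → let v = p , r ; w = q , s in
    evalᵉ (pullbackᵉ (a , b , c) v w) (:- q , p) := detᵉ v w :* detᵉ v w :* c) refl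

det-adjugate : ∀ p r q s → det (s , - r) (- q , p) ≡ det (p , r) (q , s)
det-adjugate = solve 4 (λ p r q s → detᵉ (s , :- r) (:- q , p) := detᵉ (p , r) (q , s)) refl

-- If (p , r) , (q , s) has determinant ±1, its adjugate is its inverse up to a sign,
-- which forms do not see.
pullback-adjugate-unimodular : ∀ f p r q s → det (p , r) (q , s) · det (p , r) (q , s) ≡ + 1 →
  pullback (pullback f (p , r) (q , s)) (s , - r) (- q , p) ≡ f
pullback-adjugate-unimodular (form a b c) p r q s d²≡1 =
  trans (pullback-adjugate a b c p r q s) (form-≡ (unit a) (unit b) (unit c))
  where
  unit : ∀ i → det (p , r) (q , s) · det (p , r) (q , s) · i ≡ i
  unit i = trans (cong (_· i) d²≡1) (ℤ.*-identityˡ i)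

~-sym : ∀ {f g} → f ~ g → g ~ f
~-sym {f} (p , q , r , s , ps-qr≡1 , refl) =
  s , - q , - r , p , trans (det-adjugate p r q s) ps-qr≡1 ,
  sym (pullback-adjugate-unimodular f p r q s (cong₂ _·_ ps-qr≡1 ps-qr≡1))

~-trans : ∀ {f g h} → f ~ g → g ~ h → f ~ h
~-trans {f} (p , q , r , s , ps-qr≡1 , refl) (x , z , y , t , xt-zy≡1 , refl) =
  _ , _ , _ , _ ,
  trans (det-combination (p , r) (q , s) x y z t) (cong₂ _·_ xt-zy≡1 ps-qr≡1) ,
  pullback-pullback f (p , r) (q , s) x y z t

-- Weakly reduced forms and their successive minima

-- Reducedness without the sign condition, which is what equivalence under GL₂(ℤ) sees.
record WeaklyReduced (f : Form) : Set where
  open Form f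
  field
    0<a  : + 0 < a
    b≤a  : b ≤ a
    -b≤a : - b ≤ a
    a≤c  : a ≤ c

square-sum-pos : ∀ x y → y ≢ + 0 → + 0 < x · x + x · y + y · y
square-sum-pos x y y≢0 = cancel-pos (+ 4) 0≤4
  (subst (+ 0 <_) (sym (identity x y))
    (ℤ.+-mono-≤-< (square-nonNeg (+ 2 · x + y)) (·-pos {+ 3} (ℤ.+<+ (ℕ.s≤s ℕ.z≤n)) (square-pos y≢0))))
  where
  identity : ∀ x y → + 4 · (x · x + x · y + y · y)
    ≡ (+ 2 · x + y) · (+ 2 · x + y) + + 3 · (y · y)
  identity = ℤ-RingSolver.solve-∀

-- Twice the form is (a + b)(x² + xy + y²) + (a - b)(x² - xy + y²) + 2(c - a)y². For y ≠ 0 the three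
-- integral forms are at least 1, and their nonnegative coefficients add up to 2c.
second-minimum≤ : ∀ {f} → WeaklyReduced f → ∀ x y → y ≢ + 0 → Form.c f ≤ eval f (x , y)
second-minimum≤ {form a b c} wr x y y≢0 =
  ℤ.0≤i-j⇒j≤i (cancel-nonNeg (+ 2) (ℤ.+<+ (ℕ.s≤s ℕ.z≤n)) (subst (+ 0 ≤_) (sym (identity a b c x y))
    (+-nonNeg (+-nonNeg
      (·-nonNeg (0≤difference -b≤a) (0<⇒0≤pred (square-sum-pos x y y≢0)))
      (·-nonNeg (0≤difference b≤a) (0<⇒0≤pred (square-sum-pos (- x) y y≢0))))
      (·-nonNeg (·-nonNeg 0≤2 (0≤difference a≤c)) (0<⇒0≤pred (square-pos y≢0))))))
  where
  open WeaklyReduced wr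
  identity : ∀ a b c x y → + 2 · (a · (x · x) + b · (x · y) + c · (y · y) - c)
    ≡ (a - - b) · (x · x + x · y + y · y - + 1)
      + (a - b) · (- x · - x + - x · y + y · y - + 1)
      + + 2 · (c - a) · (y · y - + 1)
  identity = ℤ-RingSolver.solve-∀

minimum≤ : ∀ {f} → WeaklyReduced f → ∀ {v} → v ≢ 0² → Form.a f ≤ eval f v
minimum≤ {form a b c} wr {x , y} v≢0 with y ℤ.≟ + 0
... | no y≢0 = ℤ.≤-trans a≤c (second-minimum≤ wr x y y≢0)
  where open WeaklyReduced wr
... | yes refl = ≤-by-difference _ (identity a b c x)
  (·-nonNeg (ℤ.<⇒≤ 0<a) (0<⇒0≤pred {x · x} (square-pos {x} λ { refl → v≢0 refl })))
  where
  open WeaklyReduced wr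
  identity : ∀ a b c x → a · (x · x) + b · (x · + 0) + c · (+ 0 · + 0) - a ≡ a · (x · x - + 1)
  identity = ℤ-RingSolver.solve-∀

reduced⇒weaklyReduced : ∀ {f} → + 0 < Form.a f → Reduced f → WeaklyReduced f
reduced⇒weaklyReduced {form a b c} 0<a red = record
  { 0<a  = 0<a
  ; b≤a  = ℤ.≤-trans (i≤∣i∣ b) ∣b∣≤a
  ; -b≤a = ℤ.≤-trans (subst (λ n → - b ≤ + n) (ℤ.∣-i∣≡∣i∣ b) (i≤∣i∣ (- b))) ∣b∣≤a
  ; a≤c  = a≤c
  }
  where
  open Reduced red
  i≤∣i∣ : ∀ i → i ≤ + ℤ.∣ i ∣
  i≤∣i∣ (+ n)      = ℤ.≤-refl
  i≤∣i∣ ℤ.-[1+ n ] = ℤ.-≤+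

weaklyReduced⇒reduced : ∀ {a b c} → WeaklyReduced (form a b c) → b ≤ + 0 → Reduced (form a b c)
weaklyReduced⇒reduced {a} {b} wr b≤0 = record
  { ∣b∣≤a = subst (_≤ a) (sym ∣b∣≡-b) -b≤a
  ; a≤c   = a≤c
  ; sign  = λ _ → b≤0
  }
  where
  open WeaklyReduced wr
  ∣b∣≡-b : + ℤ.∣ b ∣ ≡ - b
  ∣b∣≡-b = trans (cong +_ (sym (ℤ.∣-i∣≡∣i∣ b))) (ℤ.0≤i⇒+∣i∣≡i (ℤ.neg-mono-≤ b≤0))

-- In the basis v , w the two standard vectors are, up to sign, the columns (s , -r) and (-q , p) of
-- the adjugate. As the determinant is not 0, one of them has a nonzero second coordinate, so its
-- norm, which is a or c, is at least the second minimum.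
second-minimum-mono : ∀ f v w → WeaklyReduced (pullback f v w) → det v w · det v w ≡ + 1 →
  Form.a f ≤ Form.c f → Form.c (pullback f v w) ≤ Form.c f
second-minimum-mono f (p , r) (q , s) wr d²≡1 a≤c with r ℤ.≟ + 0 | p ℤ.≟ + 0
... | no r≢0   | _        = ℤ.≤-trans
  (subst (Form.c g ≤_) (cong Form.a f≡) (second-minimum≤ wr s (- r) (r≢0 ∘ ℤ.neg-injective))) a≤c
  where
  g  = pullback f (p , r) (q , s)
  f≡ = pullback-adjugate-unimodular f p r q s d²≡1
... | yes _    | no p≢0   =
  subst (Form.c g ≤_) (cong Form.c f≡) (second-minimum≤ wr (- q) p p≢0)
  where
  g  = pullback f (p , r) (q , s)
  f≡ = pullback-adjugate-unimodular f p r q s d²≡1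
... | yes refl | yes refl = contradiction (trans (sym (identity q s)) d²≡1) λ ()
  where
  identity : ∀ q s → (+ 0 · s - q · + 0) · (+ 0 · s - q · + 0) ≡ + 0
  identity = ℤ-RingSolver.solve-∀

unimodular⇒nonZero : ∀ p r q s → det (p , r) (q , s) · det (p , r) (q , s) ≡ + 1 → (p , r) ≢ 0²
unimodular⇒nonZero .(+ 0) .(+ 0) q s d²≡1 refl = contradiction (trans (sym (identity q s)) d²≡1) λ ()
  where
  identity : ∀ q s → (+ 0 · s - q · + 0) · (+ 0 · s - q · + 0) ≡ + 0
  identity = ℤ-RingSolver.solve-∀

-- Both outer coefficients of h are squeezed to u by the two successive minima. The discriminant
-- then fixes the middle one up to sign, and equality of the outer ones triggers the sign
-- convention: B and v are both nonpositive, so B = -v forces both to be 0.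
reduced-unique : ∀ {u v h} → WeaklyReduced (form u v u) → v ≤ + 0 →
  form u v u ~ h → Reduced h → h ≡ form u v u
reduced-unique {u} {v} {h@(form A B C)} wr v≤0 (p , q , r , s , d≡1 , h≡) red =
  form-≡ A≡u B≡v C≡u
  where
  d²≡1 : det (p , r) (q , s) · det (p , r) (q , s) ≡ + 1
  d²≡1 = cong₂ _·_ d≡1 d≡1
  open Reduced red renaming (a≤c to A≤C)
  u≤A : u ≤ A
  u≤A = subst (u ≤_) (sym (cong Form.a h≡)) (minimum≤ wr (unimodular⇒nonZero p r q s d²≡1))
  wrh : WeaklyReduced h
  wrh = reduced⇒weaklyReduced (ℤ.<-≤-trans (WeaklyReduced.0<a wr) u≤A) red
  C≤u : C ≤ u
  C≤u = subst (λ k → Form.c k ≤ u) (sym h≡)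
    (second-minimum-mono (form u v u) (p , r) (q , s) (subst WeaklyReduced h≡ wrh) d²≡1 ℤ.≤-refl)
  A≡u : A ≡ u
  A≡u = ℤ.≤-antisym (ℤ.≤-trans A≤C C≤u) u≤A
  C≡u : C ≡ u
  C≡u = ℤ.≤-antisym C≤u (ℤ.≤-trans u≤A A≤C)
  B≤0 : B ≤ + 0
  B≤0 = sign (inj₂ (trans A≡u (sym C≡u)))
  disc≡ : disc h ≡ disc (form u v u)
  disc≡ = trans (cong disc h≡) (trans (disc-pullback (form u v u) (p , r) (q , s))
    (trans (cong (_· disc (form u v u)) d²≡1) (ℤ.*-identityˡ (disc (form u v u)))))
  B²≡v² : (B - v) · (B + v) ≡ + 0
  B²≡v² = trans (identity u v B) (ℤ.i≡j⇒i-j≡0 (trans (cong disc (form-≡ (sym A≡u) (refl {x = B}) (sym C≡u))) disc≡))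
    where
    identity : ∀ u v B → (B - v) · (B + v) ≡ (B · B - + 4 · u · u) - (v · v - + 4 · u · u)
    identity = ℤ-RingSolver.solve-∀
  B≡v : B ≡ v
  B≡v = [ ℤ.i-j≡0⇒i≡j B v , B+v≡0⇒B≡v ]′ (ℤ.i*j≡0⇒i≡0∨j≡0 (B - v) {B + v} B²≡v²)
    where
    B+v≡0⇒B≡v : B + v ≡ + 0 → B ≡ v
    B+v≡0⇒B≡v B+v≡0 = trans B≡0 (sym v≡0)
      where
      B≡-v : B ≡ - v
      B≡-v = ℤ.i-j≡0⇒i≡j B (- v) (trans (cong (λ k → B + k) (ℤ.neg-involutive v)) B+v≡0)
      B≡0 : B ≡ + 0
      B≡0 = ℤ.≤-antisym B≤0 (subst (+ 0 ≤_) (sym B≡-v) (ℤ.neg-mono-≤ v≤0))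
      v≡0 : v ≡ + 0
      v≡0 = ℤ.neg-injective (trans (sym B≡-v) B≡0)

-- Equal successive minima on a sublattice of prime index

prime∣product : ∀ {ℓ} → Prime ℓ → ∀ i j → + ℓ ∣ i · j → + ℓ ∣ i ⊎ + ℓ ∣ j
prime∣product {ℓ} ℓ-prime i j ℓ∣ij =
  Sum.map ∣.∣ᵤ⇒∣ ∣.∣ᵤ⇒∣ (euclidsLemma ℤ.∣ i ∣ ℤ.∣ j ∣ ℓ-prime (subst (ℓ ℕ.∣_) (ℤ.abs-* i j) (∣.∣⇒∣ᵤ ℓ∣ij)))

negate-second : ∀ {u v} → WeaklyReduced (form u v u) → WeaklyReduced (form u (- v) u)
negate-second {u} {v} wr = record
  { 0<a  = 0<a
  ; b≤a  = -b≤a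
  ; -b≤a = subst (_≤ u) (sym (ℤ.neg-involutive v)) b≤a
  ; a≤c  = a≤c
  }
  where open WeaklyReduced wr

-- Modulo ℓ such a form is u (x + y)².
prime∣sum : ∀ {ℓ} → Prime ℓ → ∀ u v s t → ¬ + ℓ ∣ u → + ℓ ∣ + 2 · u - v →
  + ℓ ∣ eval (form u v u) (s , t) → + ℓ ∣ s + t
prime∣sum {ℓ} ℓ-prime u v s t ℓ∤u ℓ∣2u-v ℓ∣eval =
  [ (λ ℓ∣u → contradiction ℓ∣u ℓ∤u)
  , (λ ℓ∣sq → [ id , id ]′ (prime∣product ℓ-prime (s + t) (s + t) ℓ∣sq))
  ]′ (prime∣product ℓ-prime u ((s + t) · (s + t))
       (subst (+ ℓ ∣_) (sym (identity u v s t)) (∣.∣m∣n⇒∣m+n ℓ∣eval (∣.∣m⇒∣m*n (s · t) ℓ∣2u-v))))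
  where
  identity : ∀ u v s t → u · ((s + t) · (s + t))
    ≡ u · (s · s) + v · (s · t) + u · (t · t) + (+ 2 · u - v) · (s · t)
  identity = ℤ-RingSolver.solve-∀

-- The product pn is at most a², while neither factor is below a.
factor≡a : ∀ a b p n → + 0 < a → a ≤ p → a ≤ n → + 4 · p · n ≡ + 4 · a · a - b · b → p ≡ a
factor≡a a b p n 0<a a≤p a≤n 4pn≡ = ℤ.≤-antisym
  (ℤ.0≤i-j⇒j≤i (cancel-nonNeg (+ 4 · n) (·-pos {+ 4} (ℤ.+<+ (ℕ.s≤s ℕ.z≤n)) (ℤ.<-≤-trans 0<a a≤n))
    (subst (+ 0 ≤_) (sym (ℤ.i-j≡0⇒i≡j _ _ (trans (identity a b p n) (ℤ.i≡j⇒i-j≡0 (sym 4pn≡)))))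
      (+-nonNeg (·-nonNeg (·-nonNeg 0≤4 (ℤ.<⇒≤ 0<a)) (0≤difference a≤n)) (square-nonNeg b)))))
  a≤p
  where
  identity : ∀ a b p n → + 4 · n · (a - p) - (+ 4 · a · (n - a) + b · b)
    ≡ + 4 · a · a - b · b - + 4 · p · n
  identity = ℤ-RingSolver.solve-∀

-- The vectors w and w + Lz have the same norm u, the least one of the lattice they generate.
-- In the basis z , w the form is (p , -Lp , u), where p is the norm of z, and |v| ≤ u bounds
-- L²p by 3u; comparing discriminants gives L ≤ 3, and for L = 2 , 3 the form is determined
-- up to scaling.
module CongruentMinima
  (L a b x y zx zy v : ℤ)
  (0<L : + 0 < L)
  (f-reduced : WeaklyReduced (form a b a))
  (g-reduced : WeaklyReduced (form (eval (form a b a) (x , y)) v (eval (form a b a) (x , y))))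
  (pullback≡ : pullback (form a b a) (x + L · zx , y + L · zy) (x , y)
    ≡ form (eval (form a b a) (x , y)) v (eval (form a b a) (x , y)))
  (det²≡ : det (x + L · zx , y + L · zy) (x , y) · det (x + L · zx , y + L · zy) (x , y) ≡ L · L)
  where

  private
    f : Form
    f = form a b a

    w z : ℤ²
    w = x , y
    z = zx , zy

    u p : ℤ
    u = eval f w
    p = eval f z

    instance
      L-positive : ℤ.Positive L
      L-positive = ℤ.positive 0<L

      L-nonZero : ℤ.NonZero L
      L-nonZero = ℤ.>-nonZero 0<L

      L²-nonZero : ℤ.NonZero (L · L)
      L²-nonZero = ℤ.i*j≢0 L L

  β : ℤ
  β = Form.b (pullback f z w)

  -- Expanding f (w + Lz) = f (w) leaves Lβ + L²p = 0.
  β≡-Lp : β ≡ - (L · p)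
  β≡-Lp = ℤ.*-cancelˡ-≡ L β (- (L · p)) (ℤ.i-j≡0⇒i≡j (L · β) (L · - (L · p))
    (trans (sym (identity L a b x y zx zy))
      (ℤ.i≡j⇒i-j≡0 (proj₁ (form-injective pullback≡)))))
    where
    identity : ∀ L a b x y zx zy → let f = form a b a ; w = x , y ; z = zx , zy in
      eval f (x + L · zx , y + L · zy) - eval f w ≡ L · Form.b (pullback f z w) - L · - (L · eval f z)
    identity = solve 7 (λ L a b x y zx zy → let f = a , b , a ; w = x , y ; z = zx , zy in
      evalᵉ f (x :+ L :* zx , y :+ L :* zy) :- evalᵉ f w
        := L :* polarᵉ f z w :- L :* :- (L :* evalᵉ f z)) refl

  v≡ : v ≡ + 2 · u - L · (L · p)
  v≡ = trans (sym (proj₁ (proj₂ (form-injective pullback≡)))) (trans (identity L a b x y zx zy)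
    (trans (cong (λ k → + 2 · u + L · k) β≡-Lp) (cong (λ k → + 2 · u + k) (sym (ℤ.neg-distribʳ-* L (L · p))))))
    where
    identity : ∀ L a b x y zx zy → let f = form a b a ; w = x , y ; z = zx , zy in
      Form.b (pullback f (x + L · zx , y + L · zy) w) ≡ + 2 · eval f w + L · Form.b (pullback f z w)
    identity = solve 7 (λ L a b x y zx zy → let f = a , b , a ; w = x , y ; z = zx , zy in
      polarᵉ f (x :+ L :* zx , y :+ L :* zy) w
        := Κ (+ 2) :* evalᵉ f w :+ L :* polarᵉ f z w) refl

  det²≡1 : det z w · det z w ≡ + 1
  det²≡1 = ℤ.*-cancelˡ-≡ (L · L) (det z w · det z w) (+ 1)
    (trans (sym (identity L x y zx zy)) (trans det²≡ (sym (ℤ.*-identityʳ (L · L)))))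
    where
    identity : ∀ L x y zx zy → let w = x , y ; z = zx , zy in
      det (x + L · zx , y + L · zy) w · det (x + L · zx , y + L · zy) w
        ≡ L · L · (det z w · det z w)
    identity = solve 5 (λ L x y zx zy → let w = x , y ; z = zx , zy ; d = detᵉ (x :+ L :* zx , y :+ L :* zy) w in
      d :* d := L :* L :* (detᵉ z w :* detᵉ z w)) refl

  a≤p : a ≤ p
  a≤p = minimum≤ f-reduced (unimodular⇒nonZero zx zy x y det²≡1)

  0<p : + 0 < p
  0<p = ℤ.<-≤-trans (WeaklyReduced.0<a f-reduced) a≤p

  0≤3u-L²p : + 0 ≤ + 3 · u - L · (L · p)
  0≤3u-L²p = subst (+ 0 ≤_) (trans (cong (λ k → u - - k) v≡) (identity u (L · (L · p))))
    (0≤difference (WeaklyReduced.-b≤a g-reduced))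
    where
    identity : ∀ u k → u - - (+ 2 · u - k) ≡ + 3 · u - k
    identity = ℤ-RingSolver.solve-∀

  disc≡ : L · p · (L · p) - + 4 · p · u ≡ b · b - + 4 · a · a
  disc≡ = trans (sym (trans (cong (λ k → disc (form p k u)) β≡-Lp) (identity (L · p) p u)))
    (trans (disc-pullback f z w)
      (trans (cong (_· disc f) det²≡1) (ℤ.*-identityˡ (disc f))))
    where
    identity : ∀ k p u → - k · - k - + 4 · p · u ≡ k · k - + 4 · p · u
    identity = ℤ-RingSolver.solve-∀

  -- Replacing w by w + z diagonalises the form when L = 2 and gives the middle coefficient -p when
  -- L = 3.
  sheared : pullback f z (x + zx , y + zy) ≡ form p ((+ 2 - L) · p) (u - L · p + p)
  sheared = form-≡ refl
    (trans (middle a b x y zx zy) (trans (cong (λ k → k + + 2 · p) β≡-Lp) (identity L p)))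
    (trans (last a b x y zx zy) (cong (λ k → u + k + p) β≡-Lp))
    where
    middle : ∀ a b x y zx zy → let f = form a b a ; w = x , y ; z = zx , zy in
      Form.b (pullback f z (x + zx , y + zy)) ≡ Form.b (pullback f z w) + + 2 · eval f z
    middle = solve 6 (λ a b x y zx zy → let f = a , b , a ; w = x , y ; z = zx , zy in
      polarᵉ f z (x :+ zx , y :+ zy) := polarᵉ f z w :+ Κ (+ 2) :* evalᵉ f z) refl
    last : ∀ a b x y zx zy → let f = form a b a ; w = x , y ; z = zx , zy in
      eval f (x + zx , y + zy) ≡ eval f w + Form.b (pullback f z w) + eval f z
    last = solve 6 (λ a b x y zx zy → let f = a , b , a ; w = x , y ; z = zx , zy in
      evalᵉ f (x :+ zx , y :+ zy) := evalᵉ f w :+ polarᵉ f z w :+ evalᵉ f z) refl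
    identity : ∀ L p → - (L · p) + + 2 · p ≡ (+ 2 - L) · p
    identity = ℤ-RingSolver.solve-∀

  det²-sheared : det z (x + zx , y + zy) · det z (x + zx , y + zy) ≡ + 1
  det²-sheared = trans (identity x y zx zy) det²≡1
    where
    identity : ∀ x y zx zy → let w = x , y ; z = zx , zy in
      det z (x + zx , y + zy) · det z (x + zx , y + zy) ≡ det z w · det z w
    identity = solve 4 (λ x y zx zy → let w = x , y ; z = zx , zy ; d = detᵉ z (x :+ zx , y :+ zy) in
      d :* d := detᵉ z w :* detᵉ z w) refl

  -- Multiplying L²p ≤ 3u by 4p and eliminating pu through the discriminant gives L²p² + 3b² ≤ 12a²
  -- ≤ 12p², hence L² ≤ 12. For L = 4 + m the excess of L² over 12 is 4 + 8m + m².
  L≱4 : ∀ m → + 0 ≤ m → L ≢ + 4 + m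
  L≱4 m 0≤m refl = ℤ.<-irrefl (sym (trans (identity m a b p u) 3·disc≡0)) (ℤ.+-mono-≤-<
    (+-nonNeg (+-nonNeg (+-nonNeg
      (·-nonNeg (·-nonNeg 0≤4 (ℤ.<⇒≤ 0<p)) 0≤3u-L²p)
      (·-nonNeg (·-nonNeg {+ 12} (ℤ.+≤+ ℕ.z≤n) (0≤difference a≤p))
        (+-nonNeg (ℤ.<⇒≤ 0<p) (ℤ.<⇒≤ (WeaklyReduced.0<a f-reduced)))))
      (·-nonNeg {+ 3} (ℤ.+≤+ ℕ.z≤n) (square-nonNeg b)))
      (·-nonNeg (+-nonNeg (·-nonNeg {+ 8} (ℤ.+≤+ ℕ.z≤n) 0≤m) (square-nonNeg m)) (square-nonNeg p)))
    (·-pos {+ 4} (ℤ.+<+ (ℕ.s≤s ℕ.z≤n)) (·-pos 0<p 0<p)))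
    where
    identity : ∀ m a b p u → let L = + 4 + m in
      + 4 · p · (+ 3 · u - L · (L · p)) + + 12 · (p - a) · (p + a) + + 3 · (b · b)
        + (+ 8 · m + m · m) · (p · p) + + 4 · (p · p)
      ≡ + 3 · (b · b - + 4 · a · a - (L · p · (L · p) - + 4 · p · u))
    identity = ℤ-RingSolver.solve-∀
    3·disc≡0 : + 3 · (b · b - + 4 · a · a - (L · p · (L · p) - + 4 · p · u)) ≡ + 0
    3·disc≡0 = cong (+ 3 ·_) (ℤ.i≡j⇒i-j≡0 (sym disc≡))

  -- The sheared form is (p , 0 , n) with n = u - p, so 4pn = 4a² - b². Both p and n are norms of
  -- nonzero vectors, hence equal to a, and u = p + n = 2a.
  2∣u : L ≡ + 2 → L ∣ u
  2∣u refl = divides a (trans (sym (identity₀ p u)) (trans (cong₂ _+_ p≡a n≡a) (identity₁ a)))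
    where
    n : ℤ
    n = u - + 2 · p + p
    z′≢0 : (x + zx , y + zy) ≢ 0²
    z′≢0 z′≡0 = contradiction
      (trans (sym det²-sheared) (trans (cong (λ k → det z k · det z k) z′≡0) (identity zx zy))) λ ()
      where
      identity : ∀ zx zy → (zx · + 0 - + 0 · zy) · (zx · + 0 - + 0 · zy) ≡ + 0
      identity = ℤ-RingSolver.solve-∀
    a≤n : a ≤ n
    a≤n = subst (a ≤_) (cong Form.c sheared) (minimum≤ f-reduced z′≢0)
    4pn≡ : + 4 · p · n ≡ + 4 · a · a - b · b
    4pn≡ = ℤ.i-j≡0⇒i≡j (+ 4 · p · n) (+ 4 · a · a - b · b)
      (trans (identity a b p u) (ℤ.i≡j⇒i-j≡0 (sym disc≡)))
      where
      identity : ∀ a b p u → + 4 · p · (u - + 2 · p + p) - (+ 4 · a · a - b · b)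
        ≡ b · b - + 4 · a · a - (+ 2 · p · (+ 2 · p) - + 4 · p · u)
      identity = ℤ-RingSolver.solve-∀
    p≡a : p ≡ a
    p≡a = factor≡a a b p n (WeaklyReduced.0<a f-reduced) a≤p a≤n 4pn≡
    n≡a : n ≡ a
    n≡a = factor≡a a b n p (WeaklyReduced.0<a f-reduced) a≤n a≤p
      (trans (identity n p) 4pn≡)
      where
      identity : ∀ n p → + 4 · n · p ≡ + 4 · p · n
      identity = ℤ-RingSolver.solve-∀
    identity₀ : ∀ p u → p + (u - + 2 · p + p) ≡ u
    identity₀ = ℤ-RingSolver.solve-∀
    identity₁ : ∀ a → a + a ≡ a · + 2
    identity₁ = ℤ-RingSolver.solve-∀

  -- The sheared form is (p , -p , n) with n = u - 2p. The bound 9p ≤ 3u says p ≤ n, so this form is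
  -- weakly reduced and its second minimum n is at most a. Hence p = n = a and u = n + 2p = 3a.
  3∣u : L ≡ + 3 → L ∣ u
  3∣u refl = divides a (trans (sym (identity₀ p u)) (trans (cong₂ (λ i j → i + + 2 · j) n≡a p≡a) (identity₁ a)))
    where
    n : ℤ
    n = u - + 3 · p + p
    p≤n : p ≤ n
    p≤n = ℤ.0≤i-j⇒j≤i (cancel-nonNeg (+ 3) (ℤ.+<+ (ℕ.s≤s ℕ.z≤n))
      (subst (+ 0 ≤_) (identity p u) 0≤3u-L²p))
      where
      identity : ∀ p u → + 3 · u - + 3 · (+ 3 · p) ≡ + 3 · (u - + 3 · p + p - p)
      identity = ℤ-RingSolver.solve-∀
    sheared-reduced : WeaklyReduced (form p ((+ 2 - + 3) · p) n)
    sheared-reduced = record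
      { 0<a  = 0<p
      ; b≤a  = ≤-by-difference (p + p) (identity p) (+-nonNeg (ℤ.<⇒≤ 0<p) (ℤ.<⇒≤ 0<p))
      ; -b≤a = ℤ.≤-reflexive (identity′ p)
      ; a≤c  = p≤n
      }
      where
      identity : ∀ p → p - (+ 2 - + 3) · p ≡ p + p
      identity = ℤ-RingSolver.solve-∀
      identity′ : ∀ p → - ((+ 2 - + 3) · p) ≡ p
      identity′ = ℤ-RingSolver.solve-∀
    n≤a : n ≤ a
    n≤a = subst (_≤ a) (cong Form.c sheared)
      (second-minimum-mono f z (x + zx , y + zy)
        (subst WeaklyReduced (sym sheared) sheared-reduced) det²-sheared ℤ.≤-refl)
    p≡a : p ≡ a
    p≡a = ℤ.≤-antisym (ℤ.≤-trans p≤n n≤a) a≤p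
    n≡a : n ≡ a
    n≡a = ℤ.≤-antisym n≤a (ℤ.≤-trans a≤p p≤n)
    identity₀ : ∀ p u → u - + 3 · p + p + + 2 · p ≡ u
    identity₀ = ℤ-RingSolver.solve-∀
    identity₁ : ∀ a → a + + 2 · a ≡ a · + 3
    identity₁ = ℤ-RingSolver.solve-∀

-- The adjugate columns are the coordinates of d times the standard vectors in the basis of M₀, with
-- d² = ℓ², so their norms are divisible by ℓ. If ℓ does not divide u, the linear form x + y
-- vanishes on them modulo ℓ, which says that the two basis vectors agree modulo ℓ.
prime∣congruent-minimum : ∀ {ℓ} → Prime ℓ → ∀ a b u v x₁ y₁ x₂ y₂ →
  WeaklyReduced (form a b a) → WeaklyReduced (form u v u) →
  pullback (form a b a) (x₁ , y₁) (x₂ , y₂) ≡ form u v u →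
  det (x₁ , y₁) (x₂ , y₂) · det (x₁ , y₁) (x₂ , y₂) ≡ + ℓ · + ℓ →
  + ℓ ∣ + 2 · u - v → + ℓ ∣ u
prime∣congruent-minimum {ℓ} ℓ-prime a b u v x₁ y₁ x₂ y₂ f-reduced g-reduced pullback≡ det²≡ ℓ∣2u-v =
  -- The assumption ℓ ∤ u is what cancels u from u(x + y)². The conclusion ℓ ∣ u then contradicts
  -- it, which suffices because divisibility is decidable.
  decidable-stable (+ ℓ ∣.∣? u) λ ℓ∤u → ℓ∤u (congruent
    (prime∣sum ℓ-prime u v (- x₂) x₁ ℓ∤u ℓ∣2u-v (∣-eval (- x₂) x₁ (cong Form.c adjugate≡)))
    (prime∣sum ℓ-prime u v y₂ (- y₁) ℓ∤u ℓ∣2u-v (∣-eval y₂ (- y₁) (cong Form.a adjugate≡))))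
  where
  d = det (x₁ , y₁) (x₂ , y₂)
  adjugate≡ : pullback (form u v u) (y₂ , - y₁) (- x₂ , x₁) ≡ form (d · d · a) (d · d · b) (d · d · a)
  adjugate≡ = trans (cong (λ g → pullback g (y₂ , - y₁) (- x₂ , x₁)) (sym pullback≡))
    (pullback-adjugate a b a x₁ y₁ x₂ y₂)
  ∣-eval : ∀ s t → eval (form u v u) (s , t) ≡ d · d · a → + ℓ ∣ eval (form u v u) (s , t)
  ∣-eval s t eq = subst (+ ℓ ∣_) (sym (trans eq (cong (_· a) det²≡)))
    (∣.∣m⇒∣m*n a (∣.∣m⇒∣m*n (+ ℓ) ∣.∣-refl))
  bounded-prime : ∀ zx zy → x₁ ≡ x₂ + + ℓ · zx → y₁ ≡ y₂ + + ℓ · zy →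
    eval (form a b a) (x₂ , y₂) ≡ u → + ℓ ∣ u
  bounded-prime zx zy refl refl refl = by-cases ℓ refl ℓ-prime
    where
    0<ℓ : + 0 < + ℓ
    0<ℓ = ℤ.+<+ (ℕ.>-nonZero⁻¹ ℓ {{prime⇒nonZero ℓ-prime}})
    open CongruentMinima (+ ℓ) a b x₂ y₂ zx zy v 0<ℓ f-reduced g-reduced pullback≡ det²≡
    by-cases : ∀ n → ℓ ≡ n → Prime n → + ℓ ∣ eval (form a b a) (x₂ , y₂)
    by-cases 0 _ 0-prime = contradiction 0-prime ¬prime[0]
    by-cases 1 _ 1-prime = contradiction 1-prime ¬prime[1]
    by-cases 2 ℓ≡ _ = 2∣u (cong +_ ℓ≡)
    by-cases 3 ℓ≡ _ = 3∣u (cong +_ ℓ≡)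
    by-cases (ℕ.suc (ℕ.suc (ℕ.suc (ℕ.suc n)))) ℓ≡ _ =
      contradiction (cong +_ ℓ≡) (L≱4 (+ n) (ℤ.+≤+ ℕ.z≤n))
  congruent : + ℓ ∣ - x₂ + x₁ → + ℓ ∣ y₂ + - y₁ → + ℓ ∣ u
  congruent (divides zx x-eq) (divides zy y-eq) = bounded-prime zx (- zy)
    (trans (identity₁ x₁ x₂) (trans (cong (λ k → x₂ + k) x-eq) (cong (λ k → x₂ + k) (ℤ.*-comm zx (+ ℓ)))))
    (trans (identity₂ y₁ y₂) (trans (cong (λ k → y₂ - k) y-eq) (identity₃ y₂ zy (+ ℓ))))
    (cong Form.c pullback≡)
    where
    identity₁ : ∀ x₁ x₂ → x₁ ≡ x₂ + (- x₂ + x₁)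
    identity₁ = ℤ-RingSolver.solve-∀
    identity₂ : ∀ y₁ y₂ → y₁ ≡ y₂ - (y₂ + - y₁)
    identity₂ = ℤ-RingSolver.solve-∀
    identity₃ : ∀ y₂ zy L → y₂ - zy · L ≡ y₂ + L · - zy
    identity₃ = ℤ-RingSolver.solve-∀

-- By discriminants, ℓ divides (2u - v)(2u + v); the sign of v is that of a basis vector.
prime∣equal-minima : ∀ {ℓ} → Prime ℓ → ∀ {a b u v} x₁ y₁ x₂ y₂ →
  WeaklyReduced (form a b a) → WeaklyReduced (form u v u) →
  pullback (form a b a) (x₁ , y₁) (x₂ , y₂) ≡ form u v u →
  det (x₁ , y₁) (x₂ , y₂) · det (x₁ , y₁) (x₂ , y₂) ≡ + ℓ · + ℓ →
  + ℓ ∣ u × + ℓ ∣ v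
prime∣equal-minima {ℓ} ℓ-prime {a} {b} {u} {v} x₁ y₁ x₂ y₂ f-reduced g-reduced pullback≡ det²≡ =
  [ minus , plus ]′ (prime∣product ℓ-prime (+ 2 · u - v) (+ 2 · u - - v) ∣product)
  where
  product≡ : (+ 2 · u - v) · (+ 2 · u - - v) ≡ + ℓ · (+ ℓ · - (b · b - + 4 · a · a))
  product≡ = trans (identity₁ u v) (trans
    (cong -_ (trans (cong disc (sym pullback≡))
      (trans (disc-pullback (form a b a) (x₁ , y₁) (x₂ , y₂)) (cong (_· disc (form a b a)) det²≡))))
    (identity₂ (+ ℓ) (disc (form a b a))))
    where
    identity₁ : ∀ u v → (+ 2 · u - v) · (+ 2 · u - - v) ≡ - (v · v - + 4 · u · u)
    identity₁ = ℤ-RingSolver.solve-∀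
    identity₂ : ∀ L D → - (L · L · D) ≡ L · (L · - D)
    identity₂ = ℤ-RingSolver.solve-∀
  ∣product : + ℓ ∣ (+ 2 · u - v) · (+ 2 · u - - v)
  ∣product = subst (+ ℓ ∣_) (sym product≡) (∣.∣m⇒∣m*n (+ ℓ · - (b · b - + 4 · a · a)) ∣.∣-refl)
  ∣v : ∀ w → + ℓ ∣ + 2 · u - w → + ℓ ∣ u → + ℓ ∣ w
  ∣v w ℓ∣2u-w ℓ∣u = subst (+ ℓ ∣_) (identity u w) (∣.∣m∣n⇒∣m-n (∣.∣n⇒∣m*n (+ 2) ℓ∣u) ℓ∣2u-w)
    where
    identity : ∀ u w → + 2 · u - (+ 2 · u - w) ≡ w
    identity = ℤ-RingSolver.solve-∀
  minus : + ℓ ∣ + 2 · u - v → + ℓ ∣ u × + ℓ ∣ v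
  minus ℓ∣2u-v = ℓ∣u , ∣v v ℓ∣2u-v ℓ∣u
    where
    ℓ∣u : + ℓ ∣ u
    ℓ∣u = prime∣congruent-minimum ℓ-prime a b u v x₁ y₁ x₂ y₂ f-reduced g-reduced pullback≡ det²≡ ℓ∣2u-v
  plus : + ℓ ∣ + 2 · u - - v → + ℓ ∣ u × + ℓ ∣ v
  plus ℓ∣2u+v = ℓ∣u , subst (+ ℓ ∣_) (ℤ.neg-involutive v) (∣.∣m⇒∣-m (∣v (- v) ℓ∣2u+v ℓ∣u))
    where
    pullback-negated : pullback (form a b a) (x₁ , y₁) (- x₂ , - y₂) ≡ form u (- v) u
    pullback-negated = form-≡ (cong Form.a pullback≡)
      (trans (identity₁ a b x₁ y₁ x₂ y₂) (cong (-_ ∘ Form.b) pullback≡))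
      (trans (identity₂ a b x₂ y₂) (cong Form.c pullback≡))
      where
      identity₁ : ∀ a b x₁ y₁ x₂ y₂ → let f = form a b a in
        Form.b (pullback f (x₁ , y₁) (- x₂ , - y₂)) ≡ - Form.b (pullback f (x₁ , y₁) (x₂ , y₂))
      identity₁ = solve 6 (λ a b x₁ y₁ x₂ y₂ → let f = a , b , a in
        polarᵉ f (x₁ , y₁) (:- x₂ , :- y₂) := :- polarᵉ f (x₁ , y₁) (x₂ , y₂)) refl
      identity₂ : ∀ a b x₂ y₂ → let f = form a b a in eval f (- x₂ , - y₂) ≡ eval f (x₂ , y₂)
      identity₂ = solve 4 (λ a b x₂ y₂ → let f = a , b , a in
        evalᵉ f (:- x₂ , :- y₂) := evalᵉ f (x₂ , y₂)) refl
    det²-negated : det (x₁ , y₁) (- x₂ , - y₂) · det (x₁ , y₁) (- x₂ , - y₂) ≡ + ℓ · + ℓ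
    det²-negated = trans (identity x₁ y₁ x₂ y₂) det²≡
      where
      identity : ∀ x₁ y₁ x₂ y₂ →
        det (x₁ , y₁) (- x₂ , - y₂) · det (x₁ , y₁) (- x₂ , - y₂)
          ≡ det (x₁ , y₁) (x₂ , y₂) · det (x₁ , y₁) (x₂ , y₂)
      identity = solve 4 (λ x₁ y₁ x₂ y₂ → let d′ = detᵉ (x₁ , y₁) (:- x₂ , :- y₂) ; d = detᵉ (x₁ , y₁) (x₂ , y₂) in
        d′ :* d′ := d :* d) refl
    ℓ∣u : + ℓ ∣ u
    ℓ∣u = prime∣congruent-minimum ℓ-prime a b u (- v) x₁ y₁ (- x₂) (- y₂)
      f-reduced (negate-second g-reduced) pullback-negated det²-negated ℓ∣2u+v

-- Bézout's identity

bézout : ∀ i j → ∃[ x ] ∃[ y ] (x · i + y · j ≡ gcd i j)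
bézout i j = unsign (ℕ.Bézout.identity (ℕ.gcd-GCD ℤ.∣ i ∣ ℤ.∣ j ∣))
  where
  g : ℕ
  g = ℕ.gcd ℤ.∣ i ∣ ℤ.∣ j ∣
  unit : ∀ k → ∃[ e ] (e · k ≡ + ℤ.∣ k ∣)
  unit (+ n)      = + 1 , ℤ.*-identityˡ (+ n)
  unit ℤ.-[1+ n ] = ℤ.-1ℤ , ℤ.-1*i≡-i ℤ.-[1+ n ]
  rescale : ∀ x y → x · + ℤ.∣ i ∣ + y · + ℤ.∣ j ∣ ≡ gcd i j → ∃[ x ] ∃[ y ] (x · i + y · j ≡ gcd i j)
  rescale x y eq with unit i | unit j
  ... | e , ei≡ | e′ , e′j≡ = x · e , y · e′ ,
    trans (cong₂ _+_ (ℤ.*-assoc x e i) (ℤ.*-assoc y e′ j))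
      (trans (cong₂ (λ k l → x · k + y · l) ei≡ e′j≡) eq)
  transfer : ∀ x y m n → g ℕ.+ y ℕ.* n ≡ x ℕ.* m → + x · + m + - (+ y) · + n ≡ + g
  transfer x y m n eq = trans
    (cong (λ k → k + - (+ y) · + n) (trans (sym (ℤ.pos-* x m)) (trans (cong +_ (sym eq))
      (trans (ℤ.pos-+ g (y ℕ.* n)) (cong (λ k → + g + k) (ℤ.pos-* y n))))))
    (identity (+ g) (+ y) (+ n))
    where
    identity : ∀ g y n → g + y · n + - y · n ≡ g
    identity = ℤ-RingSolver.solve-∀
  unsign : ℕ.Bézout.Identity g ℤ.∣ i ∣ ℤ.∣ j ∣ → ∃[ x ] ∃[ y ] (x · i + y · j ≡ gcd i j)
  unsign (ℕ.Bézout.+- x y eq) = rescale (+ x) (- (+ y)) (transfer x y ℤ.∣ i ∣ ℤ.∣ j ∣ eq)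
  unsign (ℕ.Bézout.-+ x y eq) = rescale (- (+ x)) (+ y)
    (trans (ℤ.+-comm (- (+ x) · + ℤ.∣ i ∣) (+ y · + ℤ.∣ j ∣)) (transfer y x ℤ.∣ j ∣ ℤ.∣ i ∣ eq))

gcd∣ˡ : ∀ i j → gcd i j ∣ i
gcd∣ˡ i j = ∣.∣ᵤ⇒∣ (gcd[i,j]∣i i j)

gcd∣ʳ : ∀ i j → gcd i j ∣ j
gcd∣ʳ i j = ∣.∣ᵤ⇒∣ (gcd[i,j]∣j i j)

-- A basis of equal minimal norm

eval-· : ∀ f k x y → eval f (k · x , k · y) ≡ k · k · eval f (x , y)
eval-· (form a b c) k x y = identity a b c k x y
  where
  identity : ∀ a b c k x y → let f = form a b c in eval f (k · x , k · y) ≡ k · k · eval f (x , y)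
  identity = solve 6 (λ a b c k x y → let f = a , b , c in
    evalᵉ f (k :* x , k :* y) := k :* k :* evalᵉ f (x , y)) refl

eval-0² : ∀ f → eval f 0² ≡ + 0
eval-0² (form a b c) = identity a b c
  where
  identity : ∀ a b c → a · + 0 + b · + 0 + c · + 0 ≡ + 0
  identity = ℤ-RingSolver.solve-∀

square≡1 : ∀ i → i · i ≡ + 1 → i ≡ + 1 ⊎ i ≡ - + 1
square≡1 i i²≡1 = Sum.map (ℤ.i-j≡0⇒i≡j i (+ 1)) (ℤ.i-j≡0⇒i≡j i (- + 1))
  (ℤ.i*j≡0⇒i≡0∨j≡0 (i - + 1) {i - - + 1} (trans (identity i) (ℤ.i≡j⇒i-j≡0 i²≡1)))
  where
  identity : ∀ i → (i - + 1) · (i - - + 1) ≡ i · i - + 1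
  identity = ℤ-RingSolver.solve-∀

-- A minimal vector m is primitive and extends to a basis m , n, in which a shear of n makes the
-- form weakly reduced. A second minimal vector other than m and -m has a nonzero coordinate along
-- n, so its norm u is at least the second minimum C. Thus C = u.
module EqualMinima (g : Form) (p r p₂ r₂ : ℤ)
  (0<u : + 0 < eval g (p , r)) (u-minimal : ∀ v → v ≢ 0² → eval g (p , r) ≤ eval g v)
  (u≡ : eval g (p₂ , r₂) ≡ eval g (p , r)) (≢m : (p₂ , r₂) ≢ (p , r)) (≢-m : (p₂ , r₂) ≢ -² (p , r))
  where

  private
    m : ℤ²
    m = p , r

    u : ℤ
    u = eval g m

    instance
      2u-nonZero : ℤ.NonZero (+ 2 · u)
      2u-nonZero = ℤ.>-nonZero (·-pos {+ 2} (ℤ.+<+ (ℕ.s≤s ℕ.z≤n)) 0<u)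

  -- Dividing m by a common factor k ≥ 2 would give a nonzero vector of norm u/k², below the
  -- minimum.
  m-primitive : gcd p r ≡ + 1
  m-primitive = by-cases (ℕ.gcd ℤ.∣ p ∣ ℤ.∣ r ∣) refl (gcd∣ˡ p r) (gcd∣ʳ p r)
    where
    by-cases : ∀ k → gcd p r ≡ + k → gcd p r ∣ p → gcd p r ∣ r → gcd p r ≡ + 1
    by-cases 0 k≡ k∣p k∣r = contradiction 0<u (ℤ.<-irrefl (sym u≡0))
      where
      u≡0 : u ≡ + 0
      u≡0 = trans (cong₂ (λ x y → eval g (x , y)) (∣.0∣⇒≡0 (subst (_∣ p) k≡ k∣p)) (∣.0∣⇒≡0 (subst (_∣ r) k≡ k∣r)))
        (eval-0² g)
    by-cases 1 k≡ _ _ = k≡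
    by-cases (ℕ.suc (ℕ.suc n)) k≡ k∣p k∣r with subst (_∣ p) k≡ k∣p | subst (_∣ r) k≡ k∣r
    ... | divides p′ p≡ | divides r′ r≡ = contradiction u<u (ℤ.<-irrefl refl)
      where
      k : ℤ
      k = + ℕ.suc (ℕ.suc n)
      e : ℤ
      e = eval g (p′ , r′)
      u≡k²e : u ≡ k · k · e
      u≡k²e = trans (cong₂ (λ x y → eval g (x , y)) (trans p≡ (ℤ.*-comm p′ k)) (trans r≡ (ℤ.*-comm r′ k)))
        (eval-· g k p′ r′)
      0<e : + 0 < e
      0<e = cancel-pos (k · k) (ℤ.+≤+ ℕ.z≤n) (subst (+ 0 <_) u≡k²e 0<u)
      u≤e : u ≤ e
      u≤e = u-minimal (p′ , r′) λ z≡0 → ℤ.<-irrefl (sym (trans (cong (eval g) z≡0) (eval-0² g))) 0<e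
      u<u : u < u
      u<u = ℤ.≤-<-trans u≤e (subst (e <_) (sym u≡k²e)
        (subst (_< k · k · e) (ℤ.*-identityˡ e)
          (ℤ.*-monoʳ-<-pos e {{ℤ.positive 0<e}} {+ 1} {k · k} (ℤ.+<+ (ℕ.s≤s (ℕ.s≤s ℕ.z≤n))))))

  bézout-m : ∃[ x ] ∃[ y ] (x · p + y · r ≡ + 1)
  bézout-m = subst (λ k → ∃[ x ] ∃[ y ] (x · p + y · r ≡ k)) m-primitive (bézout p r)

  x₀ y₀ b₀ t : ℤ
  x₀ = proj₁ bézout-m
  y₀ = proj₁ (proj₂ bézout-m)
  b₀ = Form.b (pullback g m (- y₀ , x₀))
  -- This is b₀/2u rounded to a nearest integer. Adding u before the division moves the remainder b₀
  -- - 2tu into the interval from -u to u.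
  t  = (b₀ + u) ℤ./ (+ 2 · u)

  n : ℤ²
  n = - y₀ - t · p , x₀ - t · r

  det≡1 : det m n ≡ + 1
  det≡1 = trans (identity p r x₀ y₀ t) (proj₂ (proj₂ bézout-m))
    where
    identity : ∀ p r x y t → p · (x - t · r) - (- y - t · p) · r ≡ x · p + y · r
    identity = ℤ-RingSolver.solve-∀

  B C : ℤ
  B = Form.b (pullback g m n)
  C = eval g n

  B≡ : B ≡ + ((b₀ + u) ℤ.% (+ 2 · u)) - u
  B≡ = trans (shear g p r x₀ y₀ t) (trans (identity b₀ u t) (cong (λ k → k - u)
    (trans (cong (λ k → k - t · (+ 2 · u)) (ℤ.a≡a%n+[a/n]*n (b₀ + u) (+ 2 · u)))
      (identity₂ (+ ((b₀ + u) ℤ.% (+ 2 · u))) (t · (+ 2 · u))))))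
    where
    shear : ∀ g p r x y t → let m = p , r in
      Form.b (pullback g m (- y - t · p , x - t · r)) ≡ Form.b (pullback g m (- y , x)) - + 2 · t · eval g m
    shear (form a b c) = identity₃ a b c
      where
      identity₃ : ∀ a b c p r x y t → let g = form a b c ; m = p , r in
        Form.b (pullback g m (- y - t · p , x - t · r)) ≡ Form.b (pullback g m (- y , x)) - + 2 · t · eval g m
      identity₃ = solve 8 (λ a b c p r x y t → let g = a , b , c ; m = p , r in
        polarᵉ g m (:- y :- t :* p , x :- t :* r) := polarᵉ g m (:- y , x) :- Κ (+ 2) :* t :* evalᵉ g m) refl
    identity : ∀ b u t → b - + 2 · t · u ≡ b + u - t · (+ 2 · u) - u
    identity = ℤ-RingSolver.solve-∀
    identity₂ : ∀ k l → k + l - l ≡ k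
    identity₂ = ℤ-RingSolver.solve-∀

  u≤C : u ≤ C
  u≤C = u-minimal n λ n≡0 → contradiction (trans (sym det≡1) (trans (cong (det m) n≡0) (identity p r))) λ ()
    where
    identity : ∀ p r → p · + 0 - + 0 · r ≡ + 0
    identity = ℤ-RingSolver.solve-∀

  B≤u : B ≤ u
  B≤u = ≤-by-difference _ (trans (cong (λ k → u - k) B≡) (identity u (+ ((b₀ + u) ℤ.% (+ 2 · u)))))
    (0≤difference (ℤ.<⇒≤ (subst (+ ((b₀ + u) ℤ.% (+ 2 · u)) <_)
      (ℤ.0≤i⇒+∣i∣≡i (·-nonNeg 0≤2 (ℤ.<⇒≤ 0<u))) (ℤ.+<+ (ℤ.n%d<d (b₀ + u) (+ 2 · u))))))
    where
    identity : ∀ u k → u - (k - u) ≡ + 2 · u - k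
    identity = ℤ-RingSolver.solve-∀

  -B≤u : - B ≤ u
  -B≤u = ≤-by-difference _ (trans (cong (λ k → u - - k) B≡) (identity u (+ ((b₀ + u) ℤ.% (+ 2 · u)))))
    (ℤ.+≤+ ℕ.z≤n)
    where
    identity : ∀ u k → u - - (k - u) ≡ k
    identity = ℤ-RingSolver.solve-∀

  weaklyReduced : WeaklyReduced (pullback g m n)
  weaklyReduced = record { 0<a = 0<u ; b≤a = B≤u ; -b≤a = -B≤u ; a≤c = u≤C }

  -- Cramer's rule for m₂ in the basis m , n of determinant 1.
  i j : ℤ
  i = det (p₂ , r₂) n
  j = det m (p₂ , r₂)

  m₂≡ : (p₂ , r₂) ≡ i ·² m +² j ·² n
  m₂≡ = cong₂ _,_
    (sym (trans (identity₁ p r p₂ r₂ (proj₁ n) (proj₂ n)) (trans (cong (p₂ ·_) det≡1) (ℤ.*-identityʳ p₂))))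
    (sym (trans (identity₂ p r p₂ r₂ (proj₁ n) (proj₂ n)) (trans (cong (r₂ ·_) det≡1) (ℤ.*-identityʳ r₂))))
    where
    identity₁ : ∀ p r p₂ r₂ q s → (p₂ · s - q · r₂) · p + (p · r₂ - p₂ · r) · q ≡ p₂ · (p · s - q · r)
    identity₁ = ℤ-RingSolver.solve-∀
    identity₂ : ∀ p r p₂ r₂ q s → (p₂ · s - q · r₂) · r + (p · r₂ - p₂ · r) · s ≡ r₂ · (p · s - q · r)
    identity₂ = ℤ-RingSolver.solve-∀

  m₂-value : eval (pullback g m n) (i , j) ≡ u
  m₂-value = trans (eval-pullback g m n i j) (trans (cong (eval g) (sym m₂≡)) u≡)

  j≢0 : j ≢ + 0
  j≢0 j≡0 = [ i≢1 , i≢-1 ]′ (square≡1 i i²≡1)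
    where
    i²≡1 : i · i ≡ + 1
    i²≡1 = ℤ.*-cancelʳ-≡ (i · i) (+ 1) u {{ℤ.>-nonZero 0<u}}
      (trans (sym (identity u B C i)) (trans (cong (λ k → eval (pullback g m n) (i , k)) (sym j≡0))
        (trans m₂-value (sym (ℤ.*-identityˡ u)))))
      where
      identity : ∀ u B C i → u · (i · i) + B · (i · + 0) + C · (+ 0 · + 0) ≡ i · i · u
      identity = ℤ-RingSolver.solve-∀
    m₂≡im : ∀ k → i ≡ k → (p₂ , r₂) ≡ k ·² m +² + 0 ·² n
    m₂≡im k i≡k = trans m₂≡ (cong₂ (λ x y → x ·² m +² y ·² n) i≡k j≡0)
    i≢1 : i ≢ + 1
    i≢1 i≡1 = ≢m (trans (m₂≡im (+ 1) i≡1) (cong₂ _,_ (identity p (proj₁ n)) (identity r (proj₂ n))))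
      where
      identity : ∀ x y → + 1 · x + + 0 · y ≡ x
      identity = ℤ-RingSolver.solve-∀
    i≢-1 : i ≢ - + 1
    i≢-1 i≡-1 = ≢-m (trans (m₂≡im (- + 1) i≡-1) (cong₂ _,_ (identity p (proj₁ n)) (identity r (proj₂ n))))
      where
      identity : ∀ x y → - + 1 · x + + 0 · y ≡ - x
      identity = ℤ-RingSolver.solve-∀

  C≡u : C ≡ u
  C≡u = ℤ.≤-antisym (subst (C ≤_) m₂-value (second-minimum≤ weaklyReduced i j j≢0)) u≤C

  pullback≡ : pullback g m n ≡ form u B u
  pullback≡ = form-≡ refl refl C≡u

  reduction : ∃[ v ] (g ~ form u v u × WeaklyReduced (form u v u) × v ≤ + 0)
  reduction = [ negative , positive ]′ (ℤ.≤-total B (+ 0))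
    where
    wr : WeaklyReduced (form u B u)
    wr = subst WeaklyReduced pullback≡ weaklyReduced
    negative : B ≤ + 0 → ∃[ v ] (g ~ form u v u × WeaklyReduced (form u v u) × v ≤ + 0)
    negative B≤0 = B , (p , proj₁ n , r , proj₂ n , det≡1 , sym pullback≡) , wr , B≤0
    -- The basis n , -m also has determinant 1. It exchanges the outer coefficients, which are
    -- equal, and negates the middle one.
    positive : + 0 ≤ B → ∃[ v ] (g ~ form u v u × WeaklyReduced (form u v u) × v ≤ + 0)
    positive 0≤B = - B ,
      (proj₁ n , - p , proj₂ n , - r , trans (identity p r (proj₁ n) (proj₂ n)) det≡1 ,
        sym (trans (swap g p r (proj₁ n) (proj₂ n)) (form-≡ C≡u refl refl))) ,
      negate-second wr , ℤ.neg-mono-≤ 0≤B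
      where
      identity : ∀ p r q s → q · - r - - p · s ≡ p · s - q · r
      identity = ℤ-RingSolver.solve-∀
      swap : ∀ g p r q s → pullback g (q , s) (- p , - r)
        ≡ form (eval g (q , s)) (- Form.b (pullback g (p , r) (q , s))) (eval g (p , r))
      swap (form a b c) p r q s = form-≡ refl (middle a b c p r q s) (last a b c p r)
        where
        middle : ∀ a b c p r q s → let g = form a b c in
          Form.b (pullback g (q , s) (- p , - r)) ≡ - Form.b (pullback g (p , r) (q , s))
        middle = solve 7 (λ a b c p r q s → let g = a , b , c in
          polarᵉ g (q , s) (:- p , :- r) := :- polarᵉ g (p , r) (q , s)) refl
        last : ∀ a b c p r → eval (form a b c) (- p , - r) ≡ eval (form a b c) (p , r)
        last = solve 5 (λ a b c p r → let g = a , b , c in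
          evalᵉ g (:- p , :- r) := evalᵉ g (p , r)) refl

-- Sublattices of ℤ² and their index

vec-≡ : ∀ {x y x′ y′ : ℤ} → x ≡ x′ → y ≡ y′ → (x , y) ≡ (x′ , y′)
vec-≡ = cong₂ _,_

module Sublattice {M : Pred ℤ² 0ℓ} (M-sublattice : IsSublattice M) where

  open IsSublattice M-sublattice

  positive-multiple∈ : ∀ n {v} → v ∈ M → + n ·² v ∈ M
  positive-multiple∈ ℕ.zero    v∈M = 0∈
  positive-multiple∈ (ℕ.suc n) {x , y} v∈M = subst (_∈ M)
    (vec-≡ (sym (ℤ.suc-* (+ n) x)) (sym (ℤ.suc-* (+ n) y))) (+∈ v∈M (positive-multiple∈ n v∈M))

  multiple∈ : ∀ k {v} → v ∈ M → k ·² v ∈ M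
  multiple∈ (+ n) v∈M = positive-multiple∈ n v∈M
  multiple∈ ℤ.-[1+ n ] {x , y} v∈M = subst (_∈ M)
    (vec-≡ (ℤ.neg-distribˡ-* ℤ.+[1+ n ] x) (ℤ.neg-distribˡ-* ℤ.+[1+ n ] y))
    (-∈ (positive-multiple∈ (ℕ.suc n) v∈M))

  combination∈ : ∀ x y {v w} → v ∈ M → w ∈ M → x ·² v +² y ·² w ∈ M
  combination∈ x y v∈M w∈M = +∈ (multiple∈ x v∈M) (multiple∈ y w∈M)

  difference∈ : ∀ {v w} → v ∈ M → w ∈ M → v -² w ∈ M
  difference∈ v∈M w∈M = +∈ v∈M (-∈ w∈M)

residue-unique : ∀ {m n d : ℕ} → m ℕ.< d → n ℕ.< d → + d ∣ + m - + n → m ≡ n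
residue-unique {m} {n} {d} m<d n<d d∣m-n = ℤ.+-injective (ℤ.i-j≡0⇒i≡j (+ m) (+ n) (ℤ.∣i∣≡0⇒i≡0
  (small ℤ.∣ + m - + n ∣ refl)))
  where
  ∣m-n∣<d : ℤ.∣ + m - + n ∣ ℕ.< d
  ∣m-n∣<d = ℕ.≤-<-trans (subst (λ k → ℤ.∣ k ∣ ℕ.≤ m ℕ.⊔ n) (sym (ℤ.m-n≡m⊖n m n)) (ℤ.∣m⊝n∣≤m⊔n m n))
    (ℕ.⊔-lub m<d n<d)
  small : ∀ k → ℤ.∣ + m - + n ∣ ≡ k → ℤ.∣ + m - + n ∣ ≡ 0
  small 0           ≡k = ≡k
  small (ℕ.suc k) ≡k = contradiction (∣.∣⇒∣ᵤ d∣m-n)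
    (ℕ.>⇒∤ {{ℕ.≢-nonZero λ ≡0 → contradiction (trans (sym ≡k) ≡0) λ ()}} ∣m-n∣<d)

-- M is generated by (A , 0) and (B , γ); then (i , j) with 0 ≤ i < |A| and 0 ≤ j < γ
-- represent the cosets of M.
module TriangularIndex {M : Pred ℤ² 0ℓ} (M-sublattice : IsSublattice M)
  {n : ℕ} (M-index : HasIndex M n)
  (A B : ℤ) (γ : ℕ) .{{_ : ℕ.NonZero ℤ.∣ A ∣}} .{{_ : ℕ.NonZero γ}}
  (∈M⇒ : ∀ x y → (x , y) ∈ M → ∃[ t ] (y ≡ t · + γ × A ∣ x - t · B))
  (⇒∈M : ∀ x y t → y ≡ t · + γ → A ∣ x - t · B → (x , y) ∈ M)
  where

  open HasIndex M-index
  open Sublattice M-sublattice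

  private
    α : ℕ
    α = ℤ.∣ A ∣

  coset : ℤ² → Fin n
  coset v = proj₁ (covers v)

  coset-≡⇒∈ : ∀ v w → coset v ≡ coset w → v -² w ∈ M
  coset-≡⇒∈ v@(x , y) w@(x′ , y′) eq = subst (_∈ M) (vec-≡ (identity x x′ _) (identity y y′ _))
    (difference∈ (subst (λ i → v -² rep i ∈ M) eq (proj₂ (covers v))) (proj₂ (covers w)))
    where
    identity : ∀ i j k → i - k - (j - k) ≡ i - j
    identity = ℤ-RingSolver.solve-∀

  column : Fin (α ℕ.* γ) → Fin α
  column k = proj₁ (Fin.remQuot {α} γ k)

  row : Fin (α ℕ.* γ) → Fin γ
  row k = proj₂ (Fin.remQuot {α} γ k)

  point : Fin (α ℕ.* γ) → ℤ²
  point k = + Fin.toℕ (column k) , + Fin.toℕ (row k)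

  coset∘point-injective : ∀ k l → coset (point k) ≡ coset (point l) → k ≡ l
  coset∘point-injective k l eq with ∈M⇒ _ _ (coset-≡⇒∈ (point k) (point l) eq)
  ... | t , y≡ , A∣x-tB = trans (sym (Fin.combine-remQuot {α} γ k))
    (trans (cong₂ Fin.combine column≡ row≡) (Fin.combine-remQuot {α} γ l))
    where
    row≡ : row k ≡ row l
    row≡ = Fin.toℕ-injective (residue-unique (Fin.toℕ<n (row k)) (Fin.toℕ<n (row l)) (divides t y≡))
    t≡0 : t ≡ + 0
    t≡0 = ℤ.*-cancelʳ-≡ t (+ 0) (+ γ) (trans (sym y≡) (ℤ.i≡j⇒i-j≡0 (cong (λ i → + Fin.toℕ i) row≡)))
    x : ℤ
    x = + Fin.toℕ (column k) - + Fin.toℕ (column l)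
    A∣x : A ∣ x
    A∣x = subst (A ∣_) (trans (cong (λ t → x - t · B) t≡0) (identity x B)) A∣x-tB
      where
      identity : ∀ x B → x - + 0 · B ≡ x
      identity = ℤ-RingSolver.solve-∀
    column≡ : column k ≡ column l
    column≡ = Fin.toℕ-injective (residue-unique (Fin.toℕ<n (column k)) (Fin.toℕ<n (column l))
      (∣.∣-trans (∣.∣m∣∣m {A}) A∣x))

  -- A representative is brought into the box in two stages: subtracting `quotientʸ` times (B , γ)
  -- brings the height below γ, and the first coordinate that remains is then reduced modulo A.
  height remainder quotientʸ : Fin n → ℤ
  height k    = proj₂ (rep k)
  quotientʸ k = height k ℤ./ℕ γ
  remainder k = proj₁ (rep k) - quotientʸ k · B

  boxˣ : Fin n → Fin α
  boxˣ k = Fin.fromℕ< (ℤ.n%ℕd<d (remainder k) α)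

  boxʸ : Fin n → Fin γ
  boxʸ k = Fin.fromℕ< (ℤ.n%ℕd<d (height k) γ)

  box : Fin n → Fin (α ℕ.* γ)
  box k = Fin.combine (boxˣ k) (boxʸ k)

  box-injective : ∀ k l → box k ≡ box l → k ≡ l
  box-injective k l eq = distinct k l (⇒∈M _ _ (quotientʸ k - quotientʸ l) height≡
    (∣.∣-trans (∣.m∣∣m∣ {A}) (divides (remainder k ℤ./ℕ α - remainder l ℤ./ℕ α) remainder≡)))
    where
    residues≡ : boxˣ k ≡ boxˣ l × boxʸ k ≡ boxʸ l
    residues≡ = Fin.combine-injective (boxˣ k) (boxʸ k) (boxˣ l) (boxʸ l) eq
    height≡ : height k - height l ≡ (quotientʸ k - quotientʸ l) · + γ
    height≡ = trans (cong₂ _-_ (ℤ.a≡a%ℕn+[a/ℕn]*n (height k) γ) (ℤ.a≡a%ℕn+[a/ℕn]*n (height l) γ))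
      (trans (cong (λ r → + r + quotientʸ k · + γ - (+ (height l ℤ.%ℕ γ) + quotientʸ l · + γ))
          (Fin.fromℕ<-injective _ _ _ _ (proj₂ residues≡)))
        (identity (+ (height l ℤ.%ℕ γ)) (quotientʸ k) (quotientʸ l) (+ γ)))
      where
      identity : ∀ r s t c → r + s · c - (r + t · c) ≡ (s - t) · c
      identity = ℤ-RingSolver.solve-∀
    remainder≡ : proj₁ (rep k) - proj₁ (rep l) - (quotientʸ k - quotientʸ l) · B
      ≡ (remainder k ℤ./ℕ α - remainder l ℤ./ℕ α) · + α
    remainder≡ = trans (regroup (proj₁ (rep k)) (proj₁ (rep l)) (quotientʸ k) (quotientʸ l) B)
      (trans (cong₂ _-_ (ℤ.a≡a%ℕn+[a/ℕn]*n (remainder k) α) (ℤ.a≡a%ℕn+[a/ℕn]*n (remainder l) α))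
      (trans (cong (λ r → + r + (remainder k ℤ./ℕ α) · + α - (+ (remainder l ℤ.%ℕ α) + (remainder l ℤ./ℕ α) · + α))
          (Fin.fromℕ<-injective _ _ _ _ (proj₁ residues≡)))
        (identity (+ (remainder l ℤ.%ℕ α)) (remainder k ℤ./ℕ α) (remainder l ℤ./ℕ α) (+ α))))
      where
      regroup : ∀ x x′ s t B → x - x′ - (s - t) · B ≡ x - s · B - (x′ - t · B)
      regroup = ℤ-RingSolver.solve-∀
      identity : ∀ r s t c → r + s · c - (r + t · c) ≡ (s - t) · c
      identity = ℤ-RingSolver.solve-∀

  -- Two injections give the two inequalities: distinct representatives reduce to distinct points of
  -- the box, and distinct points of the box lie in distinct cosets.
  index≡ : n ≡ α ℕ.* γ
  index≡ = ℕ.≤-antisym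
    (Fin.injective⇒≤ {f = box} (box-injective _ _))
    (Fin.injective⇒≤ {f = coset ∘ point} (coset∘point-injective _ _))

abs-square : ∀ i → i · i ≡ + ℤ.∣ i ∣ · + ℤ.∣ i ∣
abs-square (+ n)      = refl
abs-square ℤ.-[1+ n ] = refl

module Basis {M : Pred ℤ² 0ℓ} (M-sublattice : IsSublattice M)
  (p r q s : ℤ) (M-basis : IsBasis M (p , r) (q , s)) where

  private
    w₁ w₂ : ℤ²
    w₁ = p , r
    w₂ = q , s

    d : ℤ
    d = det w₁ w₂

  open Sublattice M-sublattice
  open IsBasis M-basis

  -- If d = 0, then (s , -r) and (-q , p) are relations between the generators. Independence makes p
  -- and r vanish, so w₁ = 0, which is itself a forbidden relation.
  det≢0 : d ≢ + 0
  det≢0 d≡0 = contradiction (proj₁ (independent (+ 1) (+ 0) w₁-zero)) λ ()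
    where
    first : s ≡ + 0 × - r ≡ + 0
    first = independent s (- r) (vec-≡ (trans (identity₁ p r q s) d≡0) (identity₂ r s))
      where
      identity₁ : ∀ p r q s → s · p + - r · q ≡ p · s - q · r
      identity₁ = ℤ-RingSolver.solve-∀
      identity₂ : ∀ r s → s · r + - r · s ≡ + 0
      identity₂ = ℤ-RingSolver.solve-∀
    second : - q ≡ + 0 × p ≡ + 0
    second = independent (- q) p (vec-≡ (identity₁ p q) (trans (identity₂ p r q s) d≡0))
      where
      identity₁ : ∀ p q → - q · p + p · q ≡ + 0
      identity₁ = ℤ-RingSolver.solve-∀
      identity₂ : ∀ p r q s → - q · r + p · s ≡ p · s - q · r
      identity₂ = ℤ-RingSolver.solve-∀
    w₁-zero : + 1 ·² w₁ +² + 0 ·² w₂ ≡ 0²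
    w₁-zero = vec-≡ (trans (identity p q) (proj₂ second))
      (trans (identity r s) (ℤ.neg-injective (proj₂ first)))
      where
      identity : ∀ x y → + 1 · x + + 0 · y ≡ x
      identity = ℤ-RingSolver.solve-∀

  γ : ℕ
  γ = ℕ.gcd ℤ.∣ r ∣ ℤ.∣ s ∣

  -- In terms of r = r′γ , s = s′γ and ir + js = γ, the generators are s′w₁ - r′w₂ and iw₁ + jw₂.
  ∣det∣≡index : ∀ {n} → HasIndex M n → ℤ.∣ d ∣ ≡ n
  ∣det∣≡index M-index with gcd∣ˡ r s | gcd∣ʳ r s | bézout r s
  ... | divides r′ r≡ | divides s′ s≡ | i , j , ir+js≡γ =
    trans ∣d∣≡ (sym index≡)
    where
    A B : ℤ
    A = s′ · p - r′ · q
    B = i · p + j · q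
    d≡Aγ : d ≡ A · + γ
    d≡Aγ = trans (cong₂ (λ x y → p · x - q · y) s≡ r≡) (identity p q r′ s′ (+ γ))
      where
      identity : ∀ p q r′ s′ c → p · (s′ · c) - q · (r′ · c) ≡ (s′ · p - r′ · q) · c
      identity = ℤ-RingSolver.solve-∀
    ∣d∣≡ : ℤ.∣ d ∣ ≡ ℤ.∣ A ∣ ℕ.* γ
    ∣d∣≡ = trans (cong ℤ.∣_∣ d≡Aγ) (ℤ.abs-* A (+ γ))
    instance
      d-nonZero : ℕ.NonZero ℤ.∣ d ∣
      d-nonZero = ℕ.≢-nonZero (det≢0 ∘ ℤ.∣i∣≡0⇒i≡0)
      Aγ-nonZero : ℕ.NonZero (ℤ.∣ A ∣ ℕ.* γ)
      Aγ-nonZero = subst ℕ.NonZero ∣d∣≡ d-nonZero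
      A-nonZero : ℕ.NonZero ℤ.∣ A ∣
      A-nonZero = ℕ.m*n≢0⇒m≢0 ℤ.∣ A ∣ {γ}
      γ-nonZero : ℕ.NonZero γ
      γ-nonZero = ℕ.m*n≢0⇒n≢0 ℤ.∣ A ∣ {γ}
    ir′+js′≡1 : i · r′ + j · s′ ≡ + 1
    ir′+js′≡1 = ℤ.*-cancelʳ-≡ (i · r′ + j · s′) (+ 1) (+ γ) (trans (identity i j r′ s′ (+ γ))
      (trans (cong₂ (λ x y → i · x + j · y) (sym r≡) (sym s≡)) (trans ir+js≡γ (sym (ℤ.*-identityˡ (+ γ))))))
      where
      identity : ∀ i j r′ s′ c → (i · r′ + j · s′) · c ≡ i · (r′ · c) + j · (s′ · c)
      identity = ℤ-RingSolver.solve-∀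
    ∈M⇒ : ∀ x y → (x , y) ∈ M → ∃[ t ] (y ≡ t · + γ × A ∣ x - t · B)
    ∈M⇒ x y v∈M with spanning v∈M
    ... | k , l , v≡ = k · r′ + l · s′ ,
      trans (cong proj₂ v≡) (trans (cong₂ (λ x y → k · x + l · y) r≡ s≡) (identity₁ k l r′ s′ (+ γ))) ,
      divides (k · j - l · i) (ℤ.i-j≡0⇒i≡j (x - (k · r′ + l · s′) · B) ((k · j - l · i) · A)
        (trans (cong (λ x → x - (k · r′ + l · s′) · B - (k · j - l · i) · A) (cong proj₁ v≡))
          (trans (identity₂ k l p q i j r′ s′)
            (trans (cong (λ e → (k · p + l · q) · (+ 1 - e)) ir′+js′≡1) (ℤ.*-zeroʳ (k · p + l · q))))))
      where
      identity₁ : ∀ k l r′ s′ c → k · (r′ · c) + l · (s′ · c) ≡ (k · r′ + l · s′) · c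
      identity₁ = ℤ-RingSolver.solve-∀
      identity₂ : ∀ k l p q i j r′ s′ →
        k · p + l · q - (k · r′ + l · s′) · (i · p + j · q) - (k · j - l · i) · (s′ · p - r′ · q)
          ≡ (k · p + l · q) · (+ 1 - (i · r′ + j · s′))
      identity₂ = ℤ-RingSolver.solve-∀
    ⇒∈M : ∀ x y t → y ≡ t · + γ → A ∣ x - t · B → (x , y) ∈ M
    ⇒∈M x y t y≡ (divides k x-tB≡) = subst (_∈ M)
      (vec-≡
        (trans (identity₁ k t s′ r′ p q i j) (trans (cong (λ e → e + t · B) (sym x-tB≡)) (cancel x (t · B))))
        (trans (cong₂ (λ r s → (k · s′ + t · i) · r + (t · j - k · r′) · s) r≡ s≡)
          (trans (identity₂ k t s′ r′ (+ γ) i j)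
            (trans (cong (λ e → t · e · + γ) ir′+js′≡1) (trans (cong (_· + γ) (ℤ.*-identityʳ t)) (sym y≡))))))
      (combination∈ (k · s′ + t · i) (t · j - k · r′) w₁∈ w₂∈)
      where
      identity₁ : ∀ k t s′ r′ p q i j →
        (k · s′ + t · i) · p + (t · j - k · r′) · q ≡ k · (s′ · p - r′ · q) + t · (i · p + j · q)
      identity₁ = ℤ-RingSolver.solve-∀
      identity₂ : ∀ k t s′ r′ c i j →
        (k · s′ + t · i) · (r′ · c) + (t · j - k · r′) · (s′ · c) ≡ t · (i · r′ + j · s′) · c
      identity₂ = ℤ-RingSolver.solve-∀
      cancel : ∀ x y → x - y + y ≡ x
      cancel = ℤ-RingSolver.solve-∀
    open TriangularIndex M-sublattice M-index A B γ ∈M⇒ ⇒∈M using (index≡)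

  det∣det : ∀ {v w} → v ∈ M → w ∈ M → d ∣ det v w
  det∣det v∈M w∈M with spanning v∈M | spanning w∈M
  ... | x , y , refl | z , t , refl = divides (det (x , y) (z , t)) (det-combination w₁ w₂ x y z t)

-- Real values of integral forms

module ℚ-Polynomial = Tactic.RingSolver.NonReflective
  (fromCommutativeRing ℚ.+-*-commutativeRing (λ p → dec⇒maybe (0ℚ ℚ.≟ p)))

fromℤ-+ : ∀ i j → fromℤ (i + j) ≡ fromℤ i ℚ.+ fromℤ j
fromℤ-+ i j = ℚ.toℚᵘ-injective (ℚᵘ.≃-trans (ℚᵘ.*≡* (identity i j)) (ℚᵘ.≃-sym (ℚ.toℚᵘ-homo-+ (fromℤ i) (fromℤ j))))
  where
  identity : ∀ i j → (i + j) · + 1 ≡ (i · + 1 + j · + 1) · + 1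
  identity = ℤ-RingSolver.solve-∀

fromℤ-· : ∀ i j → fromℤ (i · j) ≡ fromℤ i ℚ.* fromℤ j
fromℤ-· i j = ℚ.toℚᵘ-injective (ℚᵘ.≃-trans (ℚᵘ.*≡* refl) (ℚᵘ.≃-sym (ℚ.toℚᵘ-homo-* (fromℤ i) (fromℤ j))))

fromℤ-neg : ∀ j → fromℤ (- j) ≡ ℚ.- fromℤ j
fromℤ-neg j = ℚ.toℚᵘ-injective (ℚᵘ.≃-trans (ℚᵘ.*≡* refl) (ℚᵘ.≃-sym (ℚ.toℚᵘ-homo‿- (fromℤ j))))

fromℤ-- : ∀ i j → fromℤ (i - j) ≡ fromℤ i ℚ.- fromℤ j
fromℤ-- i j = trans (fromℤ-+ i (- j)) (cong (fromℤ i ℚ.+_) (fromℤ-neg j))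

fromℤ-mono-≤ : ∀ {i j} → i ≤ j → fromℤ i ℚ.≤ fromℤ j
fromℤ-mono-≤ {i} {j} i≤j = ℚ.*≤* (subst₂ _≤_ (sym (ℤ.*-identityʳ i)) (sym (ℤ.*-identityʳ j)) i≤j)

half-pos : ∀ {ε} → 0ℚ ℚ.< ε → 0ℚ ℚ.< ℚ.½ ℚ.* ε
half-pos {ε} 0<ε = ℚ.positive⁻¹ (ℚ.½ ℚ.* ε) {{ℚ.pos*pos⇒pos ℚ.½ ε {{ℚ.positive 0<ε}}}}

halves : ∀ ε → ℚ.½ ℚ.* ε ℚ.+ ℚ.½ ℚ.* ε ≡ ε
halves ε = trans (sym (ℚ.*-distribʳ-+ ε ℚ.½ ℚ.½)) (ℚ.*-identityˡ ε)

∣-∣-swap : ∀ p q → ℚ.∣ p ℚ.- q ∣ ≡ ℚ.∣ q ℚ.- p ∣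
∣-∣-swap p q = trans (cong ℚ.∣_∣ (identity p q)) (ℚ.∣-p∣≡∣p∣ (q ℚ.- p))
  where
  identity : ∀ p q → p ℚ.- q ≡ ℚ.- (q ℚ.- p)
  identity = ℚ-Polynomial.solve 2 (λ p q → p :- q := :- (q :- p)) refl

p≤∣p∣ : ∀ p → p ℚ.≤ ℚ.∣ p ∣
p≤∣p∣ p = [ (λ 0≤p → ℚ.≤-reflexive (sym (ℚ.0≤p⇒∣p∣≡p 0≤p)))
          , (λ p≤0 → ℚ.≤-trans p≤0 (ℚ.0≤∣p∣ p)) ]′ (ℚ.≤-total 0ℚ p)

∣-∣<⇒< : ∀ p q {ε} → ℚ.∣ p ℚ.- q ∣ ℚ.< ε → p ℚ.< q ℚ.+ ε
∣-∣<⇒< p q {ε} ∣p-q∣<ε = subst (ℚ._< q ℚ.+ ε) (identity p q)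
  (ℚ.+-monoʳ-< q (ℚ.≤-<-trans (p≤∣p∣ (p ℚ.- q)) ∣p-q∣<ε))
  where
  identity : ∀ p q → q ℚ.+ (p ℚ.- q) ≡ p
  identity = ℚ-Polynomial.solve 2 (λ p q → q :+ (p :- q) := p) refl

≈-sym : ∀ {x y} → x ≈ y → y ≈ x
≈-sym {x} {y} x≈y ε 0<ε with x≈y ε 0<ε
... | N , close = N , λ n N≤n → subst (ℚ._< ε) (∣-∣-swap (seq x n) (seq y n)) (close n N≤n)

≈-trans : ∀ {x y z} → x ≈ y → y ≈ z → x ≈ z
≈-trans {x} {y} {z} x≈y y≈z ε 0<ε
  with x≈y (ℚ.½ ℚ.* ε) (half-pos 0<ε) | y≈z (ℚ.½ ℚ.* ε) (half-pos 0<ε)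
... | N₁ , close₁ | N₂ , close₂ = N₁ ℕ.⊔ N₂ , λ n N≤n →
  ℚ.≤-<-trans
    (subst (λ p → ℚ.∣ p ∣ ℚ.≤ ℚ.∣ seq x n ℚ.- seq y n ∣ ℚ.+ ℚ.∣ seq y n ℚ.- seq z n ∣)
      (identity (seq x n) (seq y n) (seq z n))
      (ℚ.∣p+q∣≤∣p∣+∣q∣ (seq x n ℚ.- seq y n) (seq y n ℚ.- seq z n)))
    (subst (ℚ.∣ seq x n ℚ.- seq y n ∣ ℚ.+ ℚ.∣ seq y n ℚ.- seq z n ∣ ℚ.<_) (halves ε)
      (ℚ.+-mono-< (close₁ n (ℕ.m⊔n≤o⇒m≤o N₁ N₂ N≤n)) (close₂ n (ℕ.m⊔n≤o⇒n≤o N₁ N₂ N≤n))))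
  where
  identity : ∀ p q r → (p ℚ.- q) ℚ.+ (q ℚ.- r) ≡ p ℚ.- r
  identity = ℚ-Polynomial.solve 3 (λ p q r → (p :- q) :+ (q :- r) := p :- r) refl

<-respʳ-≈ : ∀ {x y z} → y ≈ z → x R.< y → x R.< z
<-respʳ-≈ {x} {y} {z} y≈z (ε , 0<ε , N₁ , gap)
  with y≈z (ℚ.½ ℚ.* ε) (half-pos 0<ε)
... | N₂ , close = ℚ.½ ℚ.* ε , half-pos 0<ε , N₁ ℕ.⊔ N₂ , λ n N≤n →
  ℚ.≰⇒> λ z≤x+½ε → ℚ.<-irrefl refl (ℚ.<-trans
    (subst (ℚ._< seq y n) (sym (trans (ℚ.+-assoc (seq x n) (ℚ.½ ℚ.* ε) (ℚ.½ ℚ.* ε)) (cong (seq x n ℚ.+_) (halves ε))))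
      (gap n (ℕ.m⊔n≤o⇒m≤o N₁ N₂ N≤n)))
    (ℚ.<-≤-trans (∣-∣<⇒< (seq y n) (seq z n) (close n (ℕ.m⊔n≤o⇒n≤o N₁ N₂ N≤n)))
      (ℚ.+-monoˡ-≤ (ℚ.½ ℚ.* ε) z≤x+½ε)))

<-irrefl : ∀ {x y} → x ≈ y → ¬ (x R.< y)
<-irrefl {x} {y} x≈y (ε , 0<ε , N₁ , gap) with x≈y ε 0<ε
... | N₂ , close = ℚ.<-asym (gap N (ℕ.m≤m⊔n N₁ N₂)) (∣-∣<⇒< (seq y N) (seq x N)
  (subst (ℚ._< ε) (∣-∣-swap (seq x N) (seq y N)) (close N (ℕ.m≤n⊔m N₁ N₂))))
  where
  N : ℕ
  N = N₁ ℕ.⊔ N₂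

<-asym : ∀ {x y} → x R.< y → ¬ (y R.< x)
<-asym {x} {y} (ε , 0<ε , N₁ , gap) (ε′ , 0<ε′ , N₂ , gap′) =
  ℚ.<-asym (below 0<ε (gap N (ℕ.m≤m⊔n N₁ N₂))) (below 0<ε′ (gap′ N (ℕ.m≤n⊔m N₁ N₂)))
  where
  N : ℕ
  N = N₁ ℕ.⊔ N₂
  below : ∀ {p q ε} → 0ℚ ℚ.< ε → p ℚ.+ ε ℚ.< q → p ℚ.< q
  below {p} {q} {ε} 0<ε p+ε<q = ℚ.<-trans (subst (ℚ._< p ℚ.+ ε) (ℚ.+-identityʳ p) (ℚ.+-monoʳ-< p 0<ε)) p+ε<q

-- The values of one scaled form at two vectors are integral multiples of the same sequence, so
-- their ratio is exact term by term and no division of reals is involved.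
≈1⇒multiple≈ : ∀ {x y} q → x ≈ 1ℝ → (∀ n → seq y n ≡ seq x n ℚ.* q) → y ≈ ℚ⇒ℝ q
≈1⇒multiple≈ {x} {y} q x≈1 y≡xq ε 0<ε = proj₁ near , λ n N≤n →
  subst (ℚ._< ε) (sym (distance n)) (ℚ.≤-<-trans
    (ℚ.*-monoˡ-≤-nonNeg ℚ.∣ seq x n ℚ.- 1ℚ ∣ {{ℚ.∣-∣-nonNeg (seq x n ℚ.- 1ℚ)}} ∣q∣≤K)
    (subst (ℚ.∣ seq x n ℚ.- 1ℚ ∣ ℚ.* K ℚ.<_) δK≡ε (ℚ.*-monoˡ-<-pos K (proj₂ near n N≤n))))
  where
  K : ℚ
  -- The summand 1 keeps ε/K defined when q = 0.
  K = ℚ.∣ q ∣ ℚ.+ 1ℚ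
  ∣q∣<K : ℚ.∣ q ∣ ℚ.< K
  ∣q∣<K = subst (ℚ._< K) (ℚ.+-identityʳ ℚ.∣ q ∣) (ℚ.+-monoʳ-< ℚ.∣ q ∣ (ℚ.positive⁻¹ 1ℚ))
  ∣q∣≤K : ℚ.∣ q ∣ ℚ.≤ K
  ∣q∣≤K = ℚ.<⇒≤ ∣q∣<K
  instance
    K-positive : ℚ.Positive K
    K-positive = ℚ.positive (ℚ.≤-<-trans (ℚ.0≤∣p∣ q) ∣q∣<K)
    K-nonZero : ℚ.NonZero K
    K-nonZero = ℚ.pos⇒nonZero K
    ε-positive : ℚ.Positive ε
    ε-positive = ℚ.positive 0<ε
  δ : ℚ
  δ = ε ℚ.* ℚ.1/ K
  δK≡ε : δ ℚ.* K ≡ ε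
  δK≡ε = trans (ℚ.*-assoc ε (ℚ.1/ K) K) (trans (cong (ε ℚ.*_) (ℚ.*-inverseˡ K)) (ℚ.*-identityʳ ε))
  near : ∃[ N ] (∀ n → N ℕ.≤ n → ℚ.∣ seq x n ℚ.- 1ℚ ∣ ℚ.< δ)
  near = x≈1 δ (ℚ.positive⁻¹ δ {{ℚ.pos*pos⇒pos ε (ℚ.1/ K) {{ℚ.1/pos⇒pos K}}}})
  distance : ∀ n → ℚ.∣ seq y n ℚ.- q ∣ ≡ ℚ.∣ seq x n ℚ.- 1ℚ ∣ ℚ.* ℚ.∣ q ∣
  distance n = trans (cong ℚ.∣_∣ (trans (cong (ℚ._- q) (y≡xq n)) (identity (seq x n) q)))
    (ℚ.∣p*q∣≡∣p∣*∣q∣ (seq x n ℚ.- 1ℚ) q)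
    where
    identity : ∀ x q → x ℚ.* q ℚ.- q ≡ (x ℚ.- 1ℚ) ℚ.* q
    identity = ℚ-Polynomial.solve 2 (λ x q → x :* q :- q := (x :- Κ 1ℚ) :* q) refl

scaled-value : ∀ s f v n → seq (scale s (toℝ f) ⟦ v ⟧) n ≡ seq s n ℚ.* fromℤ (eval f v)
scaled-value s (form a b c) (x , y) n = trans
  (identity (seq s n) (fromℤ a) (fromℤ b) (fromℤ c) (fromℤ x) (fromℤ y))
  (cong (seq s n ℚ.*_) (sym (trans (fromℤ-+ (a · (x · x) + b · (x · y)) (c · (y · y)))
    (cong₂ ℚ._+_ (trans (fromℤ-+ (a · (x · x)) (b · (x · y)))
      (cong₂ ℚ._+_ (monomial a x x) (monomial b x y))) (monomial c y y)))))
  where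
  monomial : ∀ a x y → fromℤ (a · (x · y)) ≡ fromℤ a ℚ.* (fromℤ x ℚ.* fromℤ y)
  monomial a x y = trans (fromℤ-· a (x · y)) (cong (fromℤ a ℚ.*_) (fromℤ-· x y))
  identity : ∀ s a b c x y →
    s ℚ.* a ℚ.* (x ℚ.* x) ℚ.+ s ℚ.* b ℚ.* (x ℚ.* y) ℚ.+ s ℚ.* c ℚ.* (y ℚ.* y)
      ≡ s ℚ.* (a ℚ.* (x ℚ.* x) ℚ.+ b ℚ.* (x ℚ.* y) ℚ.+ c ℚ.* (y ℚ.* y))
  identity = ℚ-Polynomial.solve 6 (λ s a b c x y →
    s :* a :* (x :* x) :+ s :* b :* (x :* y) :+ s :* c :* (y :* y)
      := s :* (a :* (x :* x) :+ b :* (x :* y) :+ c :* (y :* y))) refl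

-- Integers in strict order differ by at least 1, so the two values differ by at least s. The ε and
-- N witnessing 0 < s therefore serve again.
scaled-mono-< : ∀ s f v w → 0ℝ R.< s → eval f v < eval f w →
  scale s (toℝ f) ⟦ v ⟧ R.< scale s (toℝ f) ⟦ w ⟧
scaled-mono-< s f v w (ε , 0<ε , N , gap) fv<fw = ε , 0<ε , N , λ n N≤n →
  subst₂ (λ p q → p ℚ.+ ε ℚ.< q) (sym (scaled-value s f v n)) (sym (scaled-value s f w n)) (spread n N≤n)
  where
  spread : ∀ n → N ℕ.≤ n → seq s n ℚ.* fromℤ (eval f v) ℚ.+ ε ℚ.< seq s n ℚ.* fromℤ (eval f w)
  spread n N≤n = ℚ.<-≤-trans (ℚ.+-monoʳ-< (seq s n ℚ.* fromℤ (eval f v)) ε<s)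
    (subst (ℚ._≤ seq s n ℚ.* fromℤ (eval f w)) step
      (ℚ.*-monoˡ-≤-nonNeg (seq s n) {{ℚ.nonNegative (ℚ.<⇒≤ (ℚ.<-trans 0<ε ε<s))}}
        (fromℤ-mono-≤ (ℤ.i<j⇒suc[i]≤j fv<fw))))
    where
    ε<s : ε ℚ.< seq s n
    ε<s = subst (ℚ._< seq s n) (ℚ.+-identityˡ ε) (gap n N≤n)
    step : seq s n ℚ.* fromℤ (+ 1 + eval f v) ≡ seq s n ℚ.* fromℤ (eval f v) ℚ.+ seq s n
    step = trans (cong (seq s n ℚ.*_) (fromℤ-+ (+ 1) (eval f v)))
      (trans (ℚ.*-distribˡ-+ (seq s n) 1ℚ (fromℤ (eval f v)))
        (trans (cong (ℚ._+ seq s n ℚ.* fromℤ (eval f v)) (ℚ.*-identityʳ (seq s n)))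
          (ℚ.+-comm (seq s n) (seq s n ℚ.* fromℤ (eval f v)))))

-- Coefficient rings

-- Here q = q(iu + jv). This turns primitivity of a form into integrality of the coefficient of ω in
-- a multiplier.
unit-multiple : ∀ i j u v {q m n} → i · u + j · v ≡ + 1 →
  q ℚ.* fromℤ u ≡ fromℤ m → q ℚ.* fromℤ v ≡ fromℤ n → q ≡ fromℤ (i · m + j · n)
unit-multiple i j u v {q} {m} {n} bézout-uv qu≡m qv≡n = begin
  q                                                        ≡⟨ ℚ.*-identityʳ q ⟨
  q ℚ.* fromℤ (+ 1)                                        ≡⟨ cong (λ k → q ℚ.* fromℤ k) bézout-uv ⟨
  q ℚ.* fromℤ (i · u + j · v)                              ≡⟨ cong (q ℚ.*_) (combination u v) ⟩
  q ℚ.* (fromℤ i ℚ.* fromℤ u ℚ.+ fromℤ j ℚ.* fromℤ v)      ≡⟨ identity q (fromℤ i) (fromℤ j) (fromℤ u) (fromℤ v) ⟩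
  fromℤ i ℚ.* (q ℚ.* fromℤ u) ℚ.+ fromℤ j ℚ.* (q ℚ.* fromℤ v)
    ≡⟨ cong₂ (λ k l → fromℤ i ℚ.* k ℚ.+ fromℤ j ℚ.* l) qu≡m qv≡n ⟩
  fromℤ i ℚ.* fromℤ m ℚ.+ fromℤ j ℚ.* fromℤ n              ≡⟨ combination m n ⟨
  fromℤ (i · m + j · n)                                    ∎
  where
  open ≡-Reasoning
  combination : ∀ m n → fromℤ (i · m + j · n) ≡ fromℤ i ℚ.* fromℤ m ℚ.+ fromℤ j ℚ.* fromℤ n
  combination m n = trans (fromℤ-+ (i · m) (j · n)) (cong₂ ℚ._+_ (fromℤ-· i m) (fromℤ-· j n))
  identity : ∀ q i j u v → q ℚ.* (i ℚ.* u ℚ.+ j ℚ.* v) ≡ i ℚ.* (q ℚ.* u) ℚ.+ j ℚ.* (q ℚ.* v)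
  identity = ℚ-Polynomial.solve 5 (λ q i j u v → q :* (i :* u :+ j :* v) := i :* (q :* u) :+ j :* (q :* v)) refl

-- With ω = aγ = (b + √D)/2 one has ω · 1 = aγ and ω · γ = bγ - c.  Hence p + qω, that is
-- (p + qb/2) + (q/2)√D, acts on x + yγ by the following matrix.
record Acts (f : Form) (p q : ℚ) (v v′ : ℤ²) : Set where
  constructor acts
  open Form f
  private
    x = proj₁ v
    y = proj₂ v
  field
    first  : fromℤ (proj₁ v′) ≡ p ℚ.* fromℤ x ℚ.- fromℤ c ℚ.* q ℚ.* fromℤ y
    second : fromℤ (proj₂ v′) ≡ fromℤ a ℚ.* q ℚ.* fromℤ x ℚ.+ (p ℚ.+ fromℤ b ℚ.* q) ℚ.* fromℤ y

module Action (a b c : ℤ) (pd : PositiveDefinite (form a b c)) (P Q : ℚ) where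

  private
    f : Form
    f = form a b c

  -- Since √D = 2ω - b, the number P + Q√D is (P - bQ) + 2Qω.
  ω-rat ω-irr : ℚ
  ω-rat = P ℚ.- fromℤ b ℚ.* Q
  ω-irr = fromℤ (+ 2) ℚ.* Q

  private
    instance
      a-nonZero : ℤ.NonZero a
      a-nonZero = posDef⇒a≢0 f pd
      2a-nonZero : ℤ.NonZero (+ 2 · a)
      2a-nonZero = ℤ.i*j≢0 (+ 2) a
      2a-nonZero′ : ℚ.NonZero (fromℤ (+ 2 · a))
      2a-nonZero′ = 2a-nonZero

    h : ℚ
    h = ℚ.1/ fromℤ (+ 2 · a)

    2ah≡1 : fromℤ (+ 2) ℚ.* fromℤ a ℚ.* h ≡ 1ℚ
    2ah≡1 = trans (cong (ℚ._* h) (sym (fromℤ-· (+ 2) a))) (ℚ.*-inverseʳ (fromℤ (+ 2 · a)))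

    D≡ : fromℤ (disc f) ≡ fromℤ b ℚ.* fromℤ b ℚ.- fromℤ (+ 4) ℚ.* fromℤ a ℚ.* fromℤ c
    D≡ = trans (fromℤ-- (b · b) (+ 4 · a · c)) (cong₂ ℚ._-_ (fromℤ-· b b)
      (trans (fromℤ-· (+ 4 · a) c) (cong (ℚ._* fromℤ c) (fromℤ-· (+ 4) a))))

    image₁ image₂ : ℤ² → ℚ
    image₁ (x , y) = ω-rat ℚ.* fromℤ x ℚ.- fromℤ c ℚ.* ω-irr ℚ.* fromℤ y
    image₂ (x , y) = fromℤ a ℚ.* ω-irr ℚ.* fromℤ x ℚ.+ (ω-rat ℚ.+ fromℤ b ℚ.* ω-irr) ℚ.* fromℤ y

    coordinates : ℚ → ℚ → ℚ√ (disc f)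
    coordinates X Y = ⟨ X ℚ.+ Y ℚ.* (fromℤ b ℚ.* h) , Y ℚ.* (1ℚ ℚ.* h) ⟩

    -- The ring solver does not know that h inverts 2a. Its identities therefore carry a correction
    -- term, a multiple of 2ah - 1, which is removed here.
    drop-zero : ∀ e k {l} → l ≡ 1ℚ → e ℚ.+ k ℚ.* (l ℚ.- 1ℚ) ≡ e
    drop-zero e k refl = trans (cong (e ℚ.+_) (ℚ.*-zeroʳ k)) (ℚ.+-identityʳ e)

    product : ∀ v → R._⊗_ {disc f} ⟨ P , Q ⟩ (embed f pd v) ≡ coordinates (image₁ v) (image₂ v)
    product (x , y) = cong₂ ⟨_,_⟩
      (trans (cong (λ D → P ℚ.* (X ℚ.+ Y ℚ.* (β ℚ.* h)) ℚ.+ D ℚ.* (Q ℚ.* (Y ℚ.* (1ℚ ℚ.* h)))) D≡)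
        (sym (trans (identity₁ P Q (fromℤ a) β (fromℤ c) X Y h) (drop-zero _ (β ℚ.* Q ℚ.* X ℚ.+ fromℤ (+ 2) ℚ.* fromℤ c ℚ.* Q ℚ.* Y) 2ah≡1))))
      (sym (trans (identity₂ P Q (fromℤ a) β X Y h) (drop-zero _ (Q ℚ.* X) 2ah≡1)))
      where
      X Y β : ℚ
      X = fromℤ x
      Y = fromℤ y
      β = fromℤ b
      2ℚ 4ℚ : ∀ {n} → Expr ℚ n
      2ℚ = Κ (fromℤ (+ 2))
      4ℚ = Κ (fromℤ (+ 4))
      identity₁ : ∀ P Q a b c X Y h →
        ((P ℚ.- b ℚ.* Q) ℚ.* X ℚ.- c ℚ.* (fromℤ (+ 2) ℚ.* Q) ℚ.* Y)
          ℚ.+ (a ℚ.* (fromℤ (+ 2) ℚ.* Q) ℚ.* X ℚ.+ (P ℚ.- b ℚ.* Q ℚ.+ b ℚ.* (fromℤ (+ 2) ℚ.* Q)) ℚ.* Y) ℚ.* (b ℚ.* h)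
        ≡ P ℚ.* (X ℚ.+ Y ℚ.* (b ℚ.* h)) ℚ.+ (b ℚ.* b ℚ.- fromℤ (+ 4) ℚ.* a ℚ.* c) ℚ.* (Q ℚ.* (Y ℚ.* (1ℚ ℚ.* h)))
          ℚ.+ (b ℚ.* Q ℚ.* X ℚ.+ fromℤ (+ 2) ℚ.* c ℚ.* Q ℚ.* Y) ℚ.* (fromℤ (+ 2) ℚ.* a ℚ.* h ℚ.- 1ℚ)
      identity₁ = ℚ-Polynomial.solve 8 (λ P Q a b c X Y h →
        ((P :- b :* Q) :* X :- c :* (2ℚ :* Q) :* Y)
          :+ (a :* (2ℚ :* Q) :* X :+ (P :- b :* Q :+ b :* (2ℚ :* Q)) :* Y) :* (b :* h)
        := P :* (X :+ Y :* (b :* h)) :+ (b :* b :- 4ℚ :* a :* c) :* (Q :* (Y :* (Κ 1ℚ :* h)))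
          :+ (b :* Q :* X :+ 2ℚ :* c :* Q :* Y) :* (2ℚ :* a :* h :- Κ 1ℚ)) refl
      identity₂ : ∀ P Q a b X Y h →
        (a ℚ.* (fromℤ (+ 2) ℚ.* Q) ℚ.* X ℚ.+ (P ℚ.- b ℚ.* Q ℚ.+ b ℚ.* (fromℤ (+ 2) ℚ.* Q)) ℚ.* Y) ℚ.* (1ℚ ℚ.* h)
        ≡ P ℚ.* (Y ℚ.* (1ℚ ℚ.* h)) ℚ.+ Q ℚ.* (X ℚ.+ Y ℚ.* (b ℚ.* h))
          ℚ.+ Q ℚ.* X ℚ.* (fromℤ (+ 2) ℚ.* a ℚ.* h ℚ.- 1ℚ)
      identity₂ = ℚ-Polynomial.solve 7 (λ P Q a b X Y h →
        (a :* (2ℚ :* Q) :* X :+ (P :- b :* Q :+ b :* (2ℚ :* Q)) :* Y) :* (Κ 1ℚ :* h)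
        := P :* (Y :* (Κ 1ℚ :* h)) :+ Q :* (X :+ Y :* (b :* h))
          :+ Q :* X :* (2ℚ :* a :* h :- Κ 1ℚ)) refl

    coordinates-injective : ∀ {X Y X′ Y′} → coordinates X Y ≡ coordinates X′ Y′ → X ≡ X′ × Y ≡ Y′
    coordinates-injective {X} {Y} {X′} {Y′} eq = X≡X′ , Y≡Y′
      where
      recover : ∀ Y → Y ℚ.* (1ℚ ℚ.* h) ℚ.* (fromℤ (+ 2) ℚ.* fromℤ a) ≡ Y
      recover Y = trans (identity Y h (fromℤ (+ 2) ℚ.* fromℤ a)) (trans (cong (Y ℚ.*_) 2ah≡1) (ℚ.*-identityʳ Y))
        where
        identity : ∀ Y h k → Y ℚ.* (1ℚ ℚ.* h) ℚ.* k ≡ Y ℚ.* (k ℚ.* h)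
        identity = ℚ-Polynomial.solve 3 (λ Y h k → Y :* (Κ 1ℚ :* h) :* k := Y :* (k :* h)) refl
      Y≡Y′ : Y ≡ Y′
      Y≡Y′ = trans (sym (recover Y)) (trans (cong (λ z → ℚ√.irr z ℚ.* (fromℤ (+ 2) ℚ.* fromℤ a)) eq) (recover Y′))
      X≡X′ : X ≡ X′
      X≡X′ = trans (sym (identity X (Y ℚ.* (fromℤ b ℚ.* h))))
        (trans (cong₂ ℚ._-_ (cong ℚ√.rat eq) (cong (ℚ._* (fromℤ b ℚ.* h)) Y≡Y′))
          (identity X′ (Y′ ℚ.* (fromℤ b ℚ.* h))))
        where
        identity : ∀ X k → X ℚ.+ k ℚ.- k ≡ X
        identity = ℚ-Polynomial.solve 2 (λ X k → X :+ k :- k := X) refl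

  acts⇒product : ∀ v v′ → Acts f ω-rat ω-irr v v′ → embed f pd v′ ≡ R._⊗_ ⟨ P , Q ⟩ (embed f pd v)
  acts⇒product v v′ (acts first second) = trans (cong₂ coordinates first second) (sym (product v))

  product⇒acts : ∀ v v′ → embed f pd v′ ≡ R._⊗_ ⟨ P , Q ⟩ (embed f pd v) → Acts f ω-rat ω-irr v v′
  product⇒acts v v′ eq = acts (proj₁ coords) (proj₂ coords)
    where
    coords : fromℤ (proj₁ v′) ≡ image₁ v × fromℤ (proj₂ v′) ≡ image₂ v
    coords = coordinates-injective (trans eq (product v))

-- The two factors differ by 2j and so have the same parity.
even-sum : ∀ {i j k} → (i - j) · (i + j) ≡ + 4 · k → + 2 ∣ i - j × + 2 ∣ i + j
even-sum {i} {j} {k} product≡ = [ left , right ]′ (prime∣product prime[2] (i - j) (i + j)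
  (divides (+ 2 · k) (trans product≡ (identity k))))
  where
  identity : ∀ k → + 4 · k ≡ + 2 · k · + 2
  identity = ℤ-RingSolver.solve-∀
  left : + 2 ∣ i - j → + 2 ∣ i - j × + 2 ∣ i + j
  left 2∣i-j = 2∣i-j , subst (+ 2 ∣_) (shift i j) (∣.∣m∣n⇒∣m+n 2∣i-j (∣.∣m⇒∣m*n j ∣.∣-refl))
    where
    shift : ∀ i j → i - j + + 2 · j ≡ i + j
    shift = ℤ-RingSolver.solve-∀
  right : + 2 ∣ i + j → + 2 ∣ i - j × + 2 ∣ i + j
  right 2∣i+j = subst (+ 2 ∣_) (shift i j) (∣.∣m∣n⇒∣m-n 2∣i+j (∣.∣m⇒∣m*n j ∣.∣-refl)) , 2∣i+j
    where
    shift : ∀ i j → i + j - + 2 · j ≡ i - j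
    shift = ℤ-RingSolver.solve-∀

-- Multiplication by ω = aγ in the coordinates x + yγ.
ω·_ : Form → ℤ² → ℤ²
ω·_ (form a b c) (x , y) = - (c · y) , a · x + b · y

-- The scalar in front of (A , B , A) is the signed determinant d rather than ℓ, because norms on M
-- are compared with determinants such as det (v , ωv), all divisible by d. The sign goes into A and
-- B.
module SameCoefficientRing
  (a b : ℤ) (pd : PositiveDefinite (form a b a))
  {i₀ j₀ : ℤ} (bézout-f : i₀ · a + j₀ · b ≡ + 1)
  {M : Pred ℤ² 0ℓ} (M-sublattice : IsSublattice M)
  (p r q s : ℤ) (v∈M : (p , r) ∈ M) (w∈M : (q , s) ∈ M) (d≢0 : det (p , r) (q , s) ≢ + 0)
  (d∣det : ∀ {v w} → v ∈ M → w ∈ M → det (p , r) (q , s) ∣ det v w)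
  (A B : ℤ) (pullback≡ : pullback (form a b a) (p , r) (q , s)
    ≡ form (det (p , r) (q , s) · A) (det (p , r) (q , s) · B) (det (p , r) (q , s) · A))
  {i₁ j₁ : ℤ} (bézout-g : i₁ · A + j₁ · B ≡ + 1)
  (disc≡ : disc (form A B A) ≡ disc (form a b a))
  where

  open Sublattice M-sublattice

  private
    f : Form
    f = form a b a

    v w : ℤ²
    v = p , r
    w = q , s

    d : ℤ
    d = det v w

    instance
      d-nonZero : ℤ.NonZero d
      d-nonZero = ℤ.≢-nonZero d≢0

  cramer : ∀ {z} m n → det z w ≡ m · d → det v z ≡ n · d → z ≡ m ·² v +² n ·² w
  cramer {x , y} m n zw≡ vz≡ = vec-≡
    (ℤ.*-cancelˡ-≡ d _ _ (trans (identity p r q s x y)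
      (trans (cong₂ (λ k l → k · p + l · q) zw≡ vz≡) (regroup m n d p q))))
    (ℤ.*-cancelˡ-≡ d _ _ (trans (identity′ p r q s x y)
      (trans (cong₂ (λ k l → k · r + l · s) zw≡ vz≡) (regroup m n d r s))))
    where
    identity : ∀ p r q s x y → (p · s - q · r) · x ≡ (x · s - q · y) · p + (p · y - x · r) · q
    identity = ℤ-RingSolver.solve-∀
    identity′ : ∀ p r q s x y → (p · s - q · r) · y ≡ (x · s - q · y) · r + (p · y - x · r) · s
    identity′ = ℤ-RingSolver.solve-∀
    regroup : ∀ m n d p q → m · d · p + n · d · q ≡ d · (m · p + n · q)
    regroup = ℤ-RingSolver.solve-∀

  -- By Cramer's rule the two quotients are the coordinates of z in v , w.
  spans : ∀ {z} → d ∣ det z w → d ∣ det v z → z ∈ M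
  spans (divides m zw≡) (divides n vz≡) =
    subst (_∈ M) (sym (cramer m n zw≡ vz≡)) (combination∈ m n v∈M w∈M)

  fv≡ : eval f v ≡ d · A
  fv≡ = proj₁ (form-injective pullback≡)

  fvw≡ : Form.b (pullback f v w) ≡ d · B
  fvw≡ = proj₁ (proj₂ (form-injective pullback≡))

  fw≡ : eval f w ≡ d · A
  fw≡ = proj₂ (proj₂ (form-injective pullback≡))

  -- Equal discriminants give B² - b² = 4(A² - a²).
  parity : + 2 ∣ B - b × + 2 ∣ B + b
  parity = even-sum {B} {b} {A · A - a · a} (trans (identity A B a b)
    (trans (cong (λ k → k + + 4 · (A · A - a · a)) (ℤ.i≡j⇒i-j≡0 disc≡)) (ℤ.+-identityˡ (+ 4 · (A · A - a · a)))))
    where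
    identity : ∀ A B a b → (B - b) · (B + b)
      ≡ (B · B - + 4 · A · A) - (b · b - + 4 · a · a) + + 4 · (A · A - a · a)
    identity = ℤ-RingSolver.solve-∀

  halve : ∀ {k} e → + 2 · k ≡ d · e → + 2 ∣ e → d ∣ k
  halve {k} e 2k≡de (divides e′ e≡) = divides e′ (ℤ.*-cancelˡ-≡ (+ 2) k (e′ · d)
    (trans 2k≡de (trans (cong (d ·_) e≡) (identity d e′))))
    where
    identity : ∀ d e → d · (e · + 2) ≡ + 2 · (e · d)
    identity = ℤ-RingSolver.solve-∀

  -- The determinant of v and ωv is the norm dA, and twice that of ωv and w is d(b - B). Parity
  -- allows this to be halved without losing the factor d.
  ωv∈M : (ω· f) v ∈ M
  ωv∈M = spans (halve (- (B - b)) (trans (identity a b p r q s)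
      (trans (cong (λ k → - (k - b · d)) fvw≡) (regroup d B b))) (∣.∣m⇒∣-m (proj₁ parity)))
    (divides A (trans (identity′ a b p r) (trans fv≡ (ℤ.*-comm d A))))
    where
    identity : ∀ a b p r q s → let f = form a b a ; v = p , r ; w = q , s in
      + 2 · det ((ω· f) v) w ≡ - (Form.b (pullback f v w) - b · det v w)
    identity = solve 6 (λ a b p r q s → let f = a , b , a ; v = p , r ; w = q , s in
      Κ (+ 2) :* detᵉ (:- (a :* r) , a :* p :+ b :* r) w := :- (polarᵉ f v w :- b :* detᵉ v w)) refl
    identity′ : ∀ a b p r → let f = form a b a ; v = p , r in det v ((ω· f) v) ≡ eval f v
    identity′ = solve 4 (λ a b p r → let f = a , b , a ; v = p , r in
      detᵉ v (:- (a :* r) , a :* p :+ b :* r) := evalᵉ f v) refl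
    regroup : ∀ d B b → - (d · B - b · d) ≡ d · - (B - b)
    regroup = ℤ-RingSolver.solve-∀

  ωw∈M : (ω· f) w ∈ M
  ωw∈M = spans (divides (- A) (trans (identity′ a b q s) (trans (cong -_ fw≡) (swap d A))))
    (halve (B + b) (trans (identity a b p r q s)
      (trans (cong (λ k → k + b · d) fvw≡) (regroup d B b))) (proj₂ parity))
    where
    identity : ∀ a b p r q s → let f = form a b a ; v = p , r ; w = q , s in
      + 2 · det v ((ω· f) w) ≡ Form.b (pullback f v w) + b · det v w
    identity = solve 6 (λ a b p r q s → let f = a , b , a ; v = p , r ; w = q , s in
      Κ (+ 2) :* detᵉ v (:- (a :* s) , a :* q :+ b :* s) := polarᵉ f v w :+ b :* detᵉ v w) refl
    identity′ : ∀ a b q s → let f = form a b a ; w = q , s in det ((ω· f) w) w ≡ - eval f w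
    identity′ = solve 4 (λ a b q s → let f = a , b , a ; w = q , s in
      detᵉ (:- (a :* s) , a :* q :+ b :* s) w := :- evalᵉ f w) refl
    regroup : ∀ d B b → d · B + b · d ≡ d · (B + b)
    regroup = ℤ-RingSolver.solve-∀
    swap : ∀ d A → - (d · A) ≡ - A · d
    swap = ℤ-RingSolver.solve-∀

  ω∈M : ∀ {z} → z ∈ M → (ω· f) z ∈ M
  ω∈M {z} z∈M with d∣det z∈M w∈M | d∣det v∈M z∈M
  ... | divides m zw≡ | divides n vz≡ =
    subst (_∈ M) (sym (trans (cong (ω· f) (cramer m n zw≡ vz≡)) (linear a b p r q s m n)))
      (combination∈ m n ωv∈M ωw∈M)
    where
    linear : ∀ a b p r q s m n → let f = form a b a ; v = p , r ; w = q , s in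
      (ω· f) (m ·² v +² n ·² w) ≡ m ·² (ω· f) v +² n ·² (ω· f) w
    linear a b p r q s m n = vec-≡ (first a b p r q s m n) (second a b p r q s m n)
      where
      first : ∀ a b p r q s m n → - (a · (m · r + n · s)) ≡ m · - (a · r) + n · - (a · s)
      first = ℤ-RingSolver.solve-∀
      second : ∀ a b p r q s m n → a · (m · p + n · q) + b · (m · r + n · s)
        ≡ m · (a · p + b · r) + n · (a · q + b · s)
      second = ℤ-RingSolver.solve-∀

  module _ (P Q : ℚ) where

    open Action a b a pd P Q

    IntegralCoordinates : Set
    IntegralCoordinates = ∃[ m ] ∃[ n ] (ω-rat ≡ fromℤ m × ω-irr ≡ fromℤ n)

    integral-action : ∀ {m n} → ω-rat ≡ fromℤ m → ω-irr ≡ fromℤ n → ∀ z →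
      Acts f ω-rat ω-irr z (m ·² z +² n ·² (ω· f) z)
    integral-action {m} {n} rat≡ irr≡ (x , y) = acts
      (trans (homo m x n (- (a · y)))
        (trans (cong (λ k → fromℤ m ℚ.* X ℚ.+ fromℤ n ℚ.* k) (trans (fromℤ-neg (a · y)) (cong ℚ.-_ (fromℤ-· a y))))
        (trans (identity₁ (fromℤ m) (fromℤ n) α X Y)
          (cong₂ (λ k l → k ℚ.* X ℚ.- α ℚ.* l ℚ.* Y) (sym rat≡) (sym irr≡)))))
      (trans (homo m y n (a · x + b · y))
        (trans (cong (λ k → fromℤ m ℚ.* Y ℚ.+ fromℤ n ℚ.* k) (homo a x b y))
        (trans (identity₂ (fromℤ m) (fromℤ n) α β X Y)
          (cong₂ (λ k l → α ℚ.* l ℚ.* X ℚ.+ (k ℚ.+ β ℚ.* l) ℚ.* Y) (sym rat≡) (sym irr≡)))))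
      where
      X Y α β : ℚ
      X = fromℤ x
      Y = fromℤ y
      α = fromℤ a
      β = fromℤ b
      homo : ∀ m x n y → fromℤ (m · x + n · y) ≡ fromℤ m ℚ.* fromℤ x ℚ.+ fromℤ n ℚ.* fromℤ y
      homo m x n y = trans (fromℤ-+ (m · x) (n · y)) (cong₂ ℚ._+_ (fromℤ-· m x) (fromℤ-· n y))
      identity₁ : ∀ m n a X Y → m ℚ.* X ℚ.+ n ℚ.* ℚ.- (a ℚ.* Y) ≡ m ℚ.* X ℚ.- a ℚ.* n ℚ.* Y
      identity₁ = ℚ-Polynomial.solve 5 (λ m n a X Y → m :* X :+ n :* :- (a :* Y) := m :* X :- a :* n :* Y) refl
      identity₂ : ∀ m n a b X Y → m ℚ.* Y ℚ.+ n ℚ.* (a ℚ.* X ℚ.+ b ℚ.* Y)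
        ≡ a ℚ.* n ℚ.* X ℚ.+ (m ℚ.+ b ℚ.* n) ℚ.* Y
      identity₂ = ℚ-Polynomial.solve 6 (λ m n a b X Y → m :* Y :+ n :* (a :* X :+ b :* Y)
        := a :* n :* X :+ (m :+ b :* n) :* Y) refl

    integral⇒L₀ : IntegralCoordinates → ⟨ P , Q ⟩ ∈ coefficientRing (image f pd L₀)
    integral⇒L₀ (m , n , rat≡ , irr≡) (z , _ , refl) = m ·² z +² n ·² (ω· f) z , _ ,
      acts⇒product z _ (integral-action rat≡ irr≡ z)

    integral⇒M : IntegralCoordinates → ⟨ P , Q ⟩ ∈ coefficientRing (image f pd M)
    integral⇒M (m , n , rat≡ , irr≡) (z , z∈M , refl) = m ·² z +² n ·² (ω· f) z ,
      combination∈ m n z∈M (ω∈M z∈M) , acts⇒product z _ (integral-action rat≡ irr≡ z)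

    action : ∀ {N : Pred ℤ² 0ℓ} → ⟨ P , Q ⟩ ∈ coefficientRing (image f pd N) →
      ∀ {z} → z ∈ N → ∃[ z′ ] (z′ ∈ N × Acts f ω-rat ω-irr z z′)
    action α∈ {z} z∈N with α∈ (z , z∈N , refl)
    ... | z′ , z′∈N , eq = z′ , z′∈N , product⇒acts z z′ eq

    -- The image of 1 has coordinates `ω-rat` and a times `ω-irr`. The second coordinate of the
    -- image of γ, less `ω-rat`, is b times `ω-irr`. All three numbers are integers, and a and b are
    -- coprime.
    L₀⇒integral : ⟨ P , Q ⟩ ∈ coefficientRing (image f pd L₀) → IntegralCoordinates
    L₀⇒integral α∈ = basis-images (action α∈ {+ 1 , + 0} _) (action α∈ {+ 0 , + 1} _)
      where
      basis-images : ∃[ z ] (z ∈ L₀ × Acts f ω-rat ω-irr (+ 1 , + 0) z) →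
        ∃[ z ] (z ∈ L₀ × Acts f ω-rat ω-irr (+ 0 , + 1) z) → IntegralCoordinates
      basis-images ((x₁ , y₁) , _ , acts first₁ second₁) ((x₂ , y₂) , _ , acts first₂ second₂) =
        x₁ , i₀ · y₁ + j₀ · (y₂ - x₁) , rat≡ , unit-multiple i₀ j₀ a b bézout-f irr-a irr-b
        where
        rat≡ : ω-rat ≡ fromℤ x₁
        rat≡ = sym (trans first₁ (identity ω-rat ω-irr (fromℤ a)))
          where
          identity : ∀ p q a → p ℚ.* 1ℚ ℚ.- a ℚ.* q ℚ.* 0ℚ ≡ p
          identity = ℚ-Polynomial.solve 3 (λ p q a → p :* Κ 1ℚ :- a :* q :* Κ 0ℚ := p) refl
        irr-a : ω-irr ℚ.* fromℤ a ≡ fromℤ y₁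
        irr-a = sym (trans second₁ (identity ω-rat ω-irr (fromℤ a) (fromℤ b)))
          where
          identity : ∀ p q a b → a ℚ.* q ℚ.* 1ℚ ℚ.+ (p ℚ.+ b ℚ.* q) ℚ.* 0ℚ ≡ q ℚ.* a
          identity = ℚ-Polynomial.solve 4 (λ p q a b → a :* q :* Κ 1ℚ :+ (p :+ b :* q) :* Κ 0ℚ := q :* a) refl
        irr-b : ω-irr ℚ.* fromℤ b ≡ fromℤ (y₂ - x₁)
        irr-b = sym (trans (fromℤ-- y₂ x₁) (trans (cong₂ ℚ._-_ second₂ (sym rat≡))
          (identity ω-rat ω-irr (fromℤ a) (fromℤ b))))
          where
          identity : ∀ p q a b → a ℚ.* q ℚ.* 0ℚ ℚ.+ (p ℚ.+ b ℚ.* q) ℚ.* 1ℚ ℚ.- p ≡ q ℚ.* b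
          identity = ℚ-Polynomial.solve 4 (λ p q a b → a :* q :* Κ 0ℚ :+ (p :+ b :* q) :* Κ 1ℚ :- p := q :* b) refl

    fromℤ-det : ∀ x y x′ y′ → fromℤ (det (x , y) (x′ , y′)) ≡ fromℤ x ℚ.* fromℤ y′ ℚ.- fromℤ x′ ℚ.* fromℤ y
    fromℤ-det x y x′ y′ = trans (fromℤ-- (x · y′) (x′ · y)) (cong₂ ℚ._-_ (fromℤ-· x y′) (fromℤ-· x′ y))

    det-action : ∀ z {t t′} → Acts f ω-rat ω-irr t t′ →
      fromℤ (det z t′) ≡ ω-rat ℚ.* fromℤ (det z t) ℚ.+ ω-irr ℚ.* fromℤ (det z ((ω· f) t))
    det-action (x , y) {x₁ , y₁} {x₂ , y₂} (acts first second) =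
      trans (fromℤ-det x y x₂ y₂)
        (trans (cong₂ (λ k l → fromℤ x ℚ.* l ℚ.- k ℚ.* fromℤ y) first second)
        (trans (identity (fromℤ x) (fromℤ y) (fromℤ x₁) (fromℤ y₁) ω-rat ω-irr (fromℤ a) (fromℤ b))
          (cong₂ (λ k l → ω-rat ℚ.* k ℚ.+ ω-irr ℚ.* l) (sym (fromℤ-det x y x₁ y₁))
            (sym (trans (fromℤ-det x y (- (a · y₁)) (a · x₁ + b · y₁))
              (cong₂ (λ k l → fromℤ x ℚ.* k ℚ.- l ℚ.* fromℤ y)
                (trans (fromℤ-+ (a · x₁) (b · y₁)) (cong₂ ℚ._+_ (fromℤ-· a x₁) (fromℤ-· b y₁)))
                (trans (fromℤ-neg (a · y₁)) (cong ℚ.-_ (fromℤ-· a y₁)))))))))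
      where
      identity : ∀ x y X Y p q a b →
        x ℚ.* (a ℚ.* q ℚ.* X ℚ.+ (p ℚ.+ b ℚ.* q) ℚ.* Y) ℚ.- (p ℚ.* X ℚ.- a ℚ.* q ℚ.* Y) ℚ.* y
          ≡ p ℚ.* (x ℚ.* Y ℚ.- X ℚ.* y) ℚ.+ q ℚ.* (x ℚ.* (a ℚ.* X ℚ.+ b ℚ.* Y) ℚ.- ℚ.- (a ℚ.* Y) ℚ.* y)
      identity = ℚ-Polynomial.solve 8 (λ x y X Y p q a b →
        x :* (a :* q :* X :+ (p :+ b :* q) :* Y) :- (p :* X :- a :* q :* Y) :* y
          := p :* (x :* Y :- X :* y) :+ q :* (x :* (a :* X :+ b :* Y) :- :- (a :* Y) :* y)) refl

    cancel-d : ∀ ρ k l → ρ ℚ.* fromℤ (d · k) ≡ fromℤ (l · d) → ρ ℚ.* fromℤ k ≡ fromℤ l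
    cancel-d ρ k l eq = begin
      ρ ℚ.* fromℤ k                                   ≡⟨ undo (ρ ℚ.* fromℤ k) ⟨
      ρ ℚ.* fromℤ k ℚ.* fromℤ d ℚ.* ℚ.1/ fromℤ d      ≡⟨ cong (ℚ._* ℚ.1/ fromℤ d) (identity ρ (fromℤ k) (fromℤ d)) ⟩
      ρ ℚ.* (fromℤ d ℚ.* fromℤ k) ℚ.* ℚ.1/ fromℤ d    ≡⟨ cong (λ e → ρ ℚ.* e ℚ.* ℚ.1/ fromℤ d) (fromℤ-· d k) ⟨
      ρ ℚ.* fromℤ (d · k) ℚ.* ℚ.1/ fromℤ d            ≡⟨ cong (ℚ._* ℚ.1/ fromℤ d) (trans eq (fromℤ-· l d)) ⟩
      fromℤ l ℚ.* fromℤ d ℚ.* ℚ.1/ fromℤ d            ≡⟨ undo (fromℤ l) ⟩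
      fromℤ l                                         ∎
      where
      open ≡-Reasoning
      instance
        d-nonZeroℚ : ℚ.NonZero (fromℤ d)
        d-nonZeroℚ = d-nonZero
      undo : ∀ e → e ℚ.* fromℤ d ℚ.* ℚ.1/ fromℤ d ≡ e
      undo e = trans (ℚ.*-assoc e (fromℤ d) (ℚ.1/ fromℤ d))
        (trans (cong (e ℚ.*_) (ℚ.*-inverseʳ (fromℤ d))) (ℚ.*-identityʳ e))
      identity : ∀ ρ k d → ρ ℚ.* k ℚ.* d ≡ ρ ℚ.* (d ℚ.* k)
      identity = ℚ-Polynomial.solve 3 (λ ρ k d → ρ :* k :* d := ρ :* (d :* k)) refl

    -- Since det (v , ωv) is the norm of v, the coordinate of a multiplier along ω is read off
    -- from determinants of vectors of M, all of which are divisible by d.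
    module _ {αv αw : ℤ²} (v-acts : Acts f ω-rat ω-irr v αv) (w-acts : Acts f ω-rat ω-irr w αw) where

      basis-images⇒integral : d ∣ det v αv → d ∣ det v αw → d ∣ det w αv → d ∣ det v ((ω· f) w) →
        IntegralCoordinates
      basis-images⇒integral (divides e₁ e₁≡) (divides e₂ e₂≡) (divides e₃ e₃≡) (divides e₄ e₄≡) =
        e₂ - n · e₄ , n , rat≡ , irr≡
        where
        irr-A : ω-irr ℚ.* fromℤ (d · A) ≡ fromℤ (e₁ · d)
        irr-A = begin
          ω-irr ℚ.* fromℤ (d · A)
            ≡⟨ identity ω-rat (ω-irr ℚ.* fromℤ (d · A)) ⟨
          ω-rat ℚ.* fromℤ (+ 0) ℚ.+ ω-irr ℚ.* fromℤ (d · A)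
            ≡⟨ cong₂ (λ k l → ω-rat ℚ.* fromℤ k ℚ.+ ω-irr ℚ.* fromℤ l) (det-self p r) (trans (det-ω a b p r) fv≡) ⟨
          ω-rat ℚ.* fromℤ (det v v) ℚ.+ ω-irr ℚ.* fromℤ (det v ((ω· f) v))
            ≡⟨ det-action v v-acts ⟨
          fromℤ (det v αv)
            ≡⟨ cong fromℤ e₁≡ ⟩
          fromℤ (e₁ · d) ∎
          where
          open ≡-Reasoning
          identity : ∀ ρ k → ρ ℚ.* 0ℚ ℚ.+ k ≡ k
          identity = ℚ-Polynomial.solve 2 (λ ρ k → ρ :* Κ 0ℚ :+ k := k) refl
          det-self : ∀ p r → p · r - p · r ≡ + 0
          det-self = ℤ-RingSolver.solve-∀
          det-ω : ∀ a b p r → let f = form a b a ; v = p , r in det v ((ω· f) v) ≡ eval f v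
          det-ω = solve 4 (λ a b p r → let f = a , b , a ; v = p , r in
            detᵉ v (:- (a :* r) , a :* p :+ b :* r) := evalᵉ f v) refl
        -- In the sum of det (v , αw) and det (w , αv) the `ω-rat` terms cancel by antisymmetry, and
        -- the `ω-irr` terms add up to the polar form dB.
        irr-B : ω-irr ℚ.* fromℤ (d · B) ≡ fromℤ ((e₂ + e₃) · d)
        irr-B = begin
          ω-irr ℚ.* fromℤ (d · B)
            ≡⟨ cong (λ k → ω-irr ℚ.* fromℤ k) (trans (det-ω a b p r q s) fvw≡) ⟨
          ω-irr ℚ.* fromℤ (det v ((ω· f) w) + det w ((ω· f) v))
            ≡⟨ cong (ω-irr ℚ.*_) (fromℤ-+ (det v ((ω· f) w)) (det w ((ω· f) v))) ⟩
          ω-irr ℚ.* (fromℤ (det v ((ω· f) w)) ℚ.+ fromℤ (det w ((ω· f) v)))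
            ≡⟨ identity ω-rat ω-irr (fromℤ d) (fromℤ (det v ((ω· f) w))) (fromℤ (det w ((ω· f) v))) ⟨
          ω-rat ℚ.* fromℤ d ℚ.+ ω-irr ℚ.* fromℤ (det v ((ω· f) w))
            ℚ.+ (ω-rat ℚ.* ℚ.- fromℤ d ℚ.+ ω-irr ℚ.* fromℤ (det w ((ω· f) v)))
            ≡⟨ cong (λ k → ω-rat ℚ.* fromℤ d ℚ.+ ω-irr ℚ.* fromℤ (det v ((ω· f) w))
                 ℚ.+ (ω-rat ℚ.* k ℚ.+ ω-irr ℚ.* fromℤ (det w ((ω· f) v))))
                 (trans (cong fromℤ (det-swap p r q s)) (fromℤ-neg d)) ⟨
          ω-rat ℚ.* fromℤ d ℚ.+ ω-irr ℚ.* fromℤ (det v ((ω· f) w))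
            ℚ.+ (ω-rat ℚ.* fromℤ (det w v) ℚ.+ ω-irr ℚ.* fromℤ (det w ((ω· f) v)))
            ≡⟨ cong₂ ℚ._+_ (det-action v w-acts) (det-action w v-acts) ⟨
          fromℤ (det v αw) ℚ.+ fromℤ (det w αv)
            ≡⟨ cong₂ (λ k l → fromℤ k ℚ.+ fromℤ l) e₂≡ e₃≡ ⟩
          fromℤ (e₂ · d) ℚ.+ fromℤ (e₃ · d)
            ≡⟨ fromℤ-+ (e₂ · d) (e₃ · d) ⟨
          fromℤ (e₂ · d + e₃ · d)
            ≡⟨ cong fromℤ (ℤ.*-distribʳ-+ d e₂ e₃) ⟨
          fromℤ ((e₂ + e₃) · d) ∎
          where
          open ≡-Reasoning
          identity : ∀ ρ σ d k l → ρ ℚ.* d ℚ.+ σ ℚ.* k ℚ.+ (ρ ℚ.* ℚ.- d ℚ.+ σ ℚ.* l) ≡ σ ℚ.* (k ℚ.+ l)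
          identity = ℚ-Polynomial.solve 5 (λ ρ σ d k l →
            ρ :* d :+ σ :* k :+ (ρ :* :- d :+ σ :* l) := σ :* (k :+ l)) refl
          det-swap : ∀ p r q s → q · r - p · s ≡ - (p · s - q · r)
          det-swap = ℤ-RingSolver.solve-∀
          det-ω : ∀ a b p r q s → let f = form a b a ; v = p , r ; w = q , s in
            det v ((ω· f) w) + det w ((ω· f) v) ≡ Form.b (pullback f v w)
          det-ω = solve 6 (λ a b p r q s → let f = a , b , a ; v = p , r ; w = q , s in
            detᵉ v (:- (a :* s) , a :* q :+ b :* s) :+ detᵉ w (:- (a :* r) , a :* p :+ b :* r)
              := polarᵉ f v w) refl
        n : ℤ
        n = i₁ · e₁ + j₁ · (e₂ + e₃)
        irr≡ : ω-irr ≡ fromℤ n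
        irr≡ = unit-multiple i₁ j₁ A B bézout-g (cancel-d ω-irr A e₁ irr-A) (cancel-d ω-irr B (e₂ + e₃) irr-B)
        -- With `ω-irr` = n known, this solves det (v , αw) = `ω-rat` d + n det (v , ωw) for the
        -- remaining coordinate. The factor d · 1 fits `cancel-d`.
        rat-1 : ω-rat ℚ.* fromℤ (d · + 1) ≡ fromℤ ((e₂ - n · e₄) · d)
        rat-1 = begin
          ω-rat ℚ.* fromℤ (d · + 1)
            ≡⟨ cong (λ k → ω-rat ℚ.* fromℤ k) (ℤ.*-identityʳ d) ⟩
          ω-rat ℚ.* fromℤ d
            ≡⟨ identity (ω-rat ℚ.* fromℤ d) (fromℤ n ℚ.* fromℤ (e₄ · d)) ⟨
          ω-rat ℚ.* fromℤ d ℚ.+ fromℤ n ℚ.* fromℤ (e₄ · d) ℚ.- fromℤ n ℚ.* fromℤ (e₄ · d)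
            ≡⟨ cong₂ (λ k l → ω-rat ℚ.* fromℤ d ℚ.+ k ℚ.* fromℤ l ℚ.- fromℤ n ℚ.* fromℤ (e₄ · d)) irr≡ e₄≡ ⟨
          ω-rat ℚ.* fromℤ d ℚ.+ ω-irr ℚ.* fromℤ (det v ((ω· f) w)) ℚ.- fromℤ n ℚ.* fromℤ (e₄ · d)
            ≡⟨ cong₂ ℚ._-_ (trans (cong fromℤ (sym e₂≡)) (det-action v w-acts)) (fromℤ-· n (e₄ · d)) ⟨
          fromℤ (e₂ · d) ℚ.- fromℤ (n · (e₄ · d))
            ≡⟨ fromℤ-- (e₂ · d) (n · (e₄ · d)) ⟨
          fromℤ (e₂ · d - n · (e₄ · d))
            ≡⟨ cong fromℤ (regroup e₂ n e₄ d) ⟩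
          fromℤ ((e₂ - n · e₄) · d) ∎
          where
          open ≡-Reasoning
          identity : ∀ k l → k ℚ.+ l ℚ.- l ≡ k
          identity = ℚ-Polynomial.solve 2 (λ k l → k :+ l :- l := k) refl
          regroup : ∀ e₂ n e₄ d → e₂ · d - n · (e₄ · d) ≡ (e₂ - n · e₄) · d
          regroup = ℤ-RingSolver.solve-∀
        rat≡ : ω-rat ≡ fromℤ (e₂ - n · e₄)
        rat≡ = trans (sym (ℚ.*-identityʳ ω-rat)) (cancel-d ω-rat (+ 1) (e₂ - n · e₄) rat-1)

    M⇒integral : ⟨ P , Q ⟩ ∈ coefficientRing (image f pd M) → IntegralCoordinates
    M⇒integral α∈ = basis-images (action α∈ v∈M) (action α∈ w∈M)
      where
      basis-images : ∃[ z ] (z ∈ M × Acts f ω-rat ω-irr v z) → ∃[ z ] (z ∈ M × Acts f ω-rat ω-irr w z) →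
        IntegralCoordinates
      basis-images (αv , αv∈M , v-acts) (αw , αw∈M , w-acts) = basis-images⇒integral v-acts w-acts
        (d∣det v∈M αv∈M) (d∣det v∈M αw∈M) (d∣det w∈M αv∈M) (d∣det v∈M ωw∈M)

  same-coefficientRing : coefficientRing (image f pd L₀) ≐ coefficientRing (image f pd M)
  same-coefficientRing =
    (λ {α} α∈ → integral⇒M (ℚ√.rat α) (ℚ√.irr α) (L₀⇒integral (ℚ√.rat α) (ℚ√.irr α) α∈)) ,
    (λ {α} α∈ → integral⇒L₀ (ℚ√.rat α) (ℚ√.irr α) (M⇒integral (ℚ√.rat α) (ℚ√.irr α) α∈))

-- Tempered forms

module Tempering {M : Pred ℤ² 0ℓ} (M-sublattice : IsSublattice M) {f : Form}
  (t : TemperedPerfect (toℝ f) M) where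

  open IsSublattice M-sublattice
  open TemperedPerfect t
  open Tempered tempered

  private
    A : Formℝ
    A = scale scalar (toℝ f)

    mono : ∀ v w → eval f v < eval f w → A ⟦ v ⟧ R.< A ⟦ w ⟧
    mono v w = scaled-mono-< scalar f v w 0<scalar

    below-U : ∀ v w → w ∈ S′ → eval f v < eval f w → A ⟦ v ⟧ R.< U
    below-U v w w∈S′ fv<fw =
      <-respʳ-≈ {A ⟦ v ⟧} {A ⟦ w ⟧} {U} (S′-value w w∈S′) (mono v w fv<fw)

    not-below : ∀ v w → v ∈ S′ → w ∈ S′ → ¬ eval f v < eval f w
    not-below v w v∈S′ w∈S′ fv<fw =
      <-irrefl {A ⟦ v ⟧} {U} (S′-value v v∈S′) (below-U v w w∈S′ fv<fw)

  S′-norm : ∀ {v w} → v ∈ S′ → w ∈ S′ → eval f v ≡ eval f w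
  S′-norm {v} {w} v∈S′ w∈S′ = ℤ.≤-antisym
    (ℤ.≮⇒≥ (not-below w v w∈S′ v∈S′)) (ℤ.≮⇒≥ (not-below v w v∈S′ w∈S′))

  -- A vector v of M shorter than w cannot lie in S′, where norms agree. Condition (iv) then puts
  -- its value above U, although it is shorter than w, whose value is U.
  S′-least : ∀ {v w} → w ∈ S′ → v ∈ M → v ≢ 0² → eval f w ≤ eval f v
  S′-least {v} {w} w∈S′ v∈M v≢0 = ℤ.≮⇒≥ λ fv<fw →
    <-asym {A ⟦ v ⟧} {U} (below-U v w w∈S′ fv<fw)
      (S′-min v v∈M v≢0 λ v∈S′ → not-below v w v∈S′ w∈S′ fv<fw)

  -- As soon as one shortest vector of the whole lattice avoids M, the vectors scaled to norm 1 are
  -- shortest: otherwise e would have value below 1, which condition (i) excludes inside S and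
  -- condition (ii) outside it.
  S-norm : ∀ {e} → e ∉ M → (∀ v → v ≢ 0² → eval f e ≤ eval f v) → ∃[ v ] (v ∈ S × eval f v ≡ eval f e)
  S-norm {e} e∉M e-least = v , v∈S , ℤ.≤-antisym (ℤ.≮⇒≥ λ fe<fv → absurd (above fe<fv)) (e-least v v≢0)
    where
    v : ℤ²
    v = proj₁ S-nonEmpty
    v∈S : v ∈ S
    v∈S = proj₂ S-nonEmpty
    v≢0 : v ≢ 0²
    v≢0 v≡0 = S⊂L₀-M v∈S (subst (_∈ M) (sym v≡0) 0∈)
    above : eval f e < eval f v → A ⟦ e ⟧ R.< 1ℝ
    above fe<fv = <-respʳ-≈ {A ⟦ e ⟧} {A ⟦ v ⟧} {1ℝ} (S-value v v∈S) (mono e v fe<fv)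
    absurd : ¬ (A ⟦ e ⟧ R.< 1ℝ)
    absurd e<1 = <-asym {A ⟦ e ⟧} {1ℝ} e<1
      (S-min e e∉M λ e∈S → <-irrefl {A ⟦ e ⟧} {1ℝ} (S-value e e∈S) e<1)

  temperament² : ∀ {v w} → v ∈ S → w ∈ S′ → (a≢0 : ℤ.NonZero (eval f v)) →
    ∀ τ → IsTemperament τ → τ * τ ≈ ℚ⇒ℝ (quotient (eval f w) (eval f v) {{a≢0}})
  temperament² {v} {w} v∈S w∈S′ a≢0 τ (_ , τ²≈U) =
    ≈-trans {τ * τ} {U} {ℚ⇒ℝ ratio} τ²≈U
      (≈-trans {U} {A ⟦ w ⟧} {ℚ⇒ℝ ratio} (≈-sym {A ⟦ w ⟧} {U} (S′-value w w∈S′))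
        (≈1⇒multiple≈ {A ⟦ v ⟧} {A ⟦ w ⟧} ratio (S-value v v∈S) λ n →
          trans (scaled-value scalar f w n) (trans (rescale (seq scalar n))
            (cong (ℚ._* ratio) (sym (scaled-value scalar f v n))))))
    where
    instance
      fv-nonZero : ℚ.NonZero (fromℤ (eval f v))
      fv-nonZero = a≢0
    ratio : ℚ
    ratio = fromℤ (eval f w) ℚ.* ℚ.1/ fromℤ (eval f v)
    rescale : ∀ s → s ℚ.* fromℤ (eval f w) ≡ s ℚ.* fromℤ (eval f v) ℚ.* ratio
    rescale s = sym (trans (identity s (fromℤ (eval f v)) (fromℤ (eval f w)) (ℚ.1/ fromℤ (eval f v)))
      (trans (cong (s ℚ.* fromℤ (eval f w) ℚ.*_) (ℚ.*-inverseʳ (fromℤ (eval f v)))) (ℚ.*-identityʳ (s ℚ.* fromℤ (eval f w)))))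
      where
      identity : ∀ s k l h → s ℚ.* k ℚ.* (l ℚ.* h) ≡ s ℚ.* l ℚ.* (k ℚ.* h)
      identity = ℚ-Polynomial.solve 4 (λ s k l h → s :* k :* (l :* h) := s :* l :* (k :* h)) refl

-- The form on M₀

pullback-scale : ∀ k a b c p r q s → let g = pullback (form a b c) (p , r) (q , s) in
  pullback (form (k · a) (k · b) (k · c)) (p , r) (q , s) ≡ form (k · Form.a g) (k · Form.b g) (k · Form.c g)
pullback-scale k a b c p r q s = form-≡ (norm k a b c p r) (middle k a b c p r q s) (norm k a b c q s)
  where
  norm : ∀ k a b c x y → eval (form (k · a) (k · b) (k · c)) (x , y) ≡ k · eval (form a b c) (x , y)
  norm = solve 6 (λ k a b c x y → evalᵉ (k :* a , k :* b , k :* c) (x , y) := k :* evalᵉ (a , b , c) (x , y)) refl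
  middle : ∀ k a b c p r q s →
    Form.b (pullback (form (k · a) (k · b) (k · c)) (p , r) (q , s)) ≡ k · Form.b (pullback (form a b c) (p , r) (q , s))
  middle = solve 8 (λ k a b c p r q s →
    polarᵉ (k :* a , k :* b , k :* c) (p , r) (q , s) := k :* polarᵉ (a , b , c) (p , r) (q , s)) refl

disc-scale : ∀ k a b c → disc (form (k · a) (k · b) (k · c)) ≡ k · k · disc (form a b c)
disc-scale = solve 4 (λ k a b c → discᵉ (k :* a , k :* b , k :* c) := k :* k :* discᵉ (a , b , c)) refl

weaklyReduced-unscale : ∀ k {a b c} → + 0 < k → WeaklyReduced (form (k · a) (k · b) (k · c)) →
  WeaklyReduced (form a b c)
weaklyReduced-unscale k {a} {b} {c} 0<k wr = record
  { 0<a  = cancel-pos k (ℤ.<⇒≤ 0<k) 0<a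
  ; b≤a  = ℤ.*-cancelˡ-≤-pos b a k b≤a
  ; -b≤a = ℤ.*-cancelˡ-≤-pos (- b) a k (subst (_≤ k · a) (ℤ.neg-distribʳ-* k b) -b≤a)
  ; a≤c  = ℤ.*-cancelˡ-≤-pos a c k a≤c
  }
  where
  open WeaklyReduced wr
  instance
    k-positive : ℤ.Positive k
    k-positive = ℤ.positive 0<k

weaklyReduced⇒positiveDefinite : ∀ {f} → WeaklyReduced f → PositiveDefinite f
weaklyReduced⇒positiveDefinite wr v v≢0 = ℤ.<-≤-trans (WeaklyReduced.0<a wr) (minimum≤ wr v≢0)

primitive⇒bézout : ∀ a b → Primitive (form a b a) → ∃[ i ] ∃[ j ] (i · a + j · b ≡ + 1)
primitive⇒bézout a b prim with bézout a b | bézout (gcd a b) a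
... | i , j , ia+jb≡ | x , y , xg+ya≡ = x · i + y , x · j ,
  trans (identity i j x y a b) (trans (cong (λ g → x · g + y · a) ia+jb≡) (trans xg+ya≡ prim))
  where
  identity : ∀ i j x y a b → (x · i + y) · a + x · j · b ≡ x · (i · a + j · b) + y · a
  identity = ℤ-RingSolver.solve-∀

-- If u ≤ a, then 4u² - v² ≤ 4a², whereas k²(4a² - b²) ≥ 12a² because k ≥ 2 and b² ≤ a². The gap 8a²
-- is the last term of the identity.
minimum-grows : ∀ k {a b u v} → + 2 ≤ k → WeaklyReduced (form a b a) → + 0 < u →
  disc (form u v u) ≡ k · k · disc (form a b a) → a < u
minimum-grows k {a} {b} {u} {v} 2≤k wr 0<u disc≡ = ℤ.≰⇒> λ u≤a →
  ℤ.<-irrefl (sym (trans (identity k a b u v) (ℤ.i≡j⇒i-j≡0 disc≡))) (ℤ.+-mono-≤-<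
    (+-nonNeg (+-nonNeg (+-nonNeg
      (·-nonNeg (·-nonNeg 0≤4 (0≤difference u≤a)) (+-nonNeg (ℤ.<⇒≤ 0<a) (ℤ.<⇒≤ 0<u)))
      (square-nonNeg v))
      (·-nonNeg (·-nonNeg (0≤difference 2≤k) (+-nonNeg (ℤ.≤-trans 0≤2 2≤k) 0≤2))
        (+-nonNeg (·-nonNeg {+ 3} (ℤ.+≤+ ℕ.z≤n) (square-nonNeg a)) 0≤a²-b²)))
      (·-nonNeg 0≤4 0≤a²-b²))
    (·-pos {+ 8} (ℤ.+<+ (ℕ.s≤s ℕ.z≤n)) (·-pos 0<a 0<a)))
  where
  open WeaklyReduced wr
  0≤a²-b² : + 0 ≤ (a - b) · (a - - b)
  0≤a²-b² = ·-nonNeg (0≤difference b≤a) (0≤difference -b≤a)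
  identity : ∀ k a b u v →
    + 4 · (a - u) · (a + u) + v · v + (k - + 2) · (k + + 2) · (+ 3 · (a · a) + (a - b) · (a - - b))
      + + 4 · ((a - b) · (a - - b)) + + 8 · (a · a)
    ≡ (v · v - + 4 · u · u) - k · k · (b · b - + 4 · a · a)
  identity = ℤ-RingSolver.solve-∀

module ReducedBasis {ℓ : ℕ} (ℓ-prime : Prime ℓ)
  {a b : ℤ} (pd : PositiveDefinite (form a b a)) (f-reduced : WeaklyReduced (form a b a))
  {i j : ℤ} (bézout-f : i · a + j · b ≡ + 1)
  {M : Pred ℤ² 0ℓ} (M-sublattice : IsSublattice M)
  {p r q s : ℤ} (v∈M : (p , r) ∈ M) (w∈M : (q , s) ∈ M)
  (d∣det : ∀ {v w} → v ∈ M → w ∈ M → det (p , r) (q , s) ∣ det v w)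
  (∣d∣≡ℓ : ℤ.∣ det (p , r) (q , s) ∣ ≡ ℓ)
  {u₁ v₁ : ℤ} (pullback≡ : pullback (form a b a) (p , r) (q , s) ≡ form (+ ℓ · u₁) (+ ℓ · v₁) (+ ℓ · u₁))
  (g-reduced : WeaklyReduced (form (+ ℓ · u₁) (+ ℓ · v₁) (+ ℓ · u₁)))
  where

  private
    f : Form
    f = form a b a

    v w : ℤ²
    v = p , r
    w = q , s

    d : ℤ
    d = det v w

    instance
      ℓ-nonZero : ℤ.NonZero (+ ℓ)
      ℓ-nonZero = prime⇒nonZero ℓ-prime

    0<ℓ : + 0 < + ℓ
    0<ℓ = ℤ.+<+ (ℕ.>-nonZero⁻¹ ℓ)

  det²≡ : d · d ≡ + ℓ · + ℓ
  det²≡ = trans (abs-square d) (cong (λ k → + k · + k) ∣d∣≡ℓ)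

  g₁-reduced : WeaklyReduced (form u₁ v₁ u₁)
  g₁-reduced = weaklyReduced-unscale (+ ℓ) 0<ℓ g-reduced

  disc≡ : disc (form u₁ v₁ u₁) ≡ disc f
  disc≡ = ℤ.*-cancelˡ-≡ (+ ℓ · + ℓ) (disc (form u₁ v₁ u₁)) (disc f) {{ℤ.i*j≢0 (+ ℓ) (+ ℓ)}}
    (trans (sym (disc-scale (+ ℓ) u₁ v₁ u₁)) (trans (cong disc (sym pullback≡))
      (trans (disc-pullback f v w) (cong (_· disc f) det²≡))))

  module CommonDivisor (D : ℕ) (u′ v′ : ℤ) (u₁≡ : u₁ ≡ u′ · + D) (v₁≡ : v₁ ≡ v′ · + D) where

    h h∘adjugate : Form
    h          = form u′ v′ u′
    h∘adjugate = pullback h (s , - r) (- q , p)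

    -- The form on M is ℓD times h. Pulling it back along the adjugate gives d²f = ℓ²f, and one
    -- factor ℓ cancels.
    D·adjugate : form (+ D · Form.a h∘adjugate) (+ D · Form.b h∘adjugate) (+ D · Form.c h∘adjugate)
      ≡ form (+ ℓ · a) (+ ℓ · b) (+ ℓ · a)
    D·adjugate = form-≡ (cancel _ a (cong Form.a scaled)) (cancel _ b (cong Form.b scaled)) (cancel _ a (cong Form.c scaled))
      where
      cancel : ∀ x y → + ℓ · + D · x ≡ d · d · y → + D · x ≡ + ℓ · y
      cancel x y eq = ℤ.*-cancelˡ-≡ (+ ℓ) (+ D · x) (+ ℓ · y)
        (trans (sym (ℤ.*-assoc (+ ℓ) (+ D) x)) (trans eq (trans (cong (_· y) det²≡) (ℤ.*-assoc (+ ℓ) (+ ℓ) y))))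
      regroup : ∀ {k k′} → k ≡ k′ · + D → + ℓ · k ≡ + ℓ · + D · k′
      regroup {k} {k′} k≡ = trans (cong (+ ℓ ·_) (trans k≡ (ℤ.*-comm k′ (+ D)))) (sym (ℤ.*-assoc (+ ℓ) (+ D) k′))
      scaled : form (+ ℓ · + D · Form.a h∘adjugate) (+ ℓ · + D · Form.b h∘adjugate) (+ ℓ · + D · Form.c h∘adjugate)
        ≡ form (d · d · a) (d · d · b) (d · d · a)
      scaled = trans (sym (pullback-scale (+ ℓ · + D) u′ v′ u′ s (- r) (- q) p))
        (trans (cong (λ k → pullback k (s , - r) (- q , p))
          (trans (form-≡ (sym (regroup u₁≡)) (sym (regroup v₁≡)) (sym (regroup u₁≡))) (sym pullback≡)))
          (pullback-adjugate a b a p r q s))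

    D∣ℓ : D ℕ.∣ ℓ
    D∣ℓ = ∣.∣⇒∣ᵤ (subst (+ D ∣_) (trans (identity i j (+ ℓ) a b) (trans (cong (+ ℓ ·_) bézout-f) (ℤ.*-identityʳ (+ ℓ))))
      (∣.∣m∣n⇒∣m+n (∣.∣n⇒∣m*n i (∣-multiple (cong Form.a D·adjugate)))
        (∣.∣n⇒∣m*n j (∣-multiple (cong Form.b D·adjugate)))))
      where
      ∣-multiple : ∀ {x y} → + D · x ≡ y → + D ∣ y
      ∣-multiple {x} eq = divides x (trans (sym eq) (ℤ.*-comm (+ D) x))
      identity : ∀ i j L a b → i · (L · a) + j · (L · b) ≡ L · (i · a + j · b)
      identity = ℤ-RingSolver.solve-∀

    -- Otherwise h would be a form on (1/ℓ)M, of which L₀ is a sublattice of index ℓ.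
    D≢ℓ : D ≢ ℓ
    D≢ℓ D≡ℓ = ¬prime[1] (subst Prime (ℕ.∣1⇒≡1 (∣.∣⇒∣ᵤ ℓ∣1)) ℓ-prime)
      where
      adjugate≡ : h∘adjugate ≡ f
      adjugate≡ = form-≡ (cancel (cong Form.a D·adjugate)) (cancel (cong Form.b D·adjugate)) (cancel (cong Form.c D·adjugate))
        where
        cancel : ∀ {x y} → + D · x ≡ + ℓ · y → x ≡ y
        cancel {x} {y} eq = ℤ.*-cancelˡ-≡ (+ ℓ) x y (trans (cong (λ k → + k · x) (sym D≡ℓ)) eq)
      h-reduced : WeaklyReduced h
      h-reduced = weaklyReduced-unscale (+ ℓ) 0<ℓ (subst WeaklyReduced
        (form-≡ (multiple u₁≡) (multiple v₁≡) (multiple u₁≡)) g₁-reduced)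
        where
        multiple : ∀ {k k′} → k ≡ k′ · + D → k ≡ + ℓ · k′
        multiple {k} {k′} k≡ = trans k≡ (trans (cong (λ e → k′ · + e) D≡ℓ) (ℤ.*-comm k′ (+ ℓ)))
      ℓ∣ab : + ℓ ∣ a × + ℓ ∣ b
      ℓ∣ab = prime∣equal-minima ℓ-prime s (- r) (- q) p h-reduced f-reduced adjugate≡
        (trans (cong₂ _·_ (det-adjugate p r q s) (det-adjugate p r q s)) det²≡)
      ℓ∣1 : + ℓ ∣ + 1
      ℓ∣1 = subst (+ ℓ ∣_) bézout-f (∣.∣m∣n⇒∣m+n (∣.∣n⇒∣m*n i (proj₁ ℓ∣ab)) (∣.∣n⇒∣m*n j (proj₂ ℓ∣ab)))

    D≡1 : D ≡ 1
    D≡1 = [ id , (λ D≡ℓ → contradiction D≡ℓ D≢ℓ) ]′ (prime⇒irreducible ℓ-prime D∣ℓ)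

  coprime : gcd u₁ v₁ ≡ + 1
  coprime = divisors (gcd∣ˡ u₁ v₁) (gcd∣ʳ u₁ v₁)
    where
    divisors : gcd u₁ v₁ ∣ u₁ → gcd u₁ v₁ ∣ v₁ → gcd u₁ v₁ ≡ + 1
    divisors (divides u′ u₁≡) (divides v′ v₁≡) =
      cong +_ (CommonDivisor.D≡1 (ℕ.gcd ℤ.∣ u₁ ∣ ℤ.∣ v₁ ∣) u′ v′ u₁≡ v₁≡)

  g₁-primitive : Primitive (form u₁ v₁ u₁)
  g₁-primitive = trans (cong (λ k → gcd k u₁) coprime) (cong +_ (ℕ.gcd-zeroˡ ℤ.∣ u₁ ∣))

  gcd≡ℓ : gcd (+ ℓ · u₁) (+ ℓ · v₁) ≡ + ℓ
  gcd≡ℓ = cong +_ (trans (cong₂ ℕ.gcd (ℤ.abs-* (+ ℓ) u₁) (ℤ.abs-* (+ ℓ) v₁))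
    (trans (sym (ℕ.c*gcd[m,n]≡gcd[cm,cn] ℓ ℤ.∣ u₁ ∣ ℤ.∣ v₁ ∣))
      (trans (cong (ℓ ℕ.*_) (ℤ.+-injective coprime)) (ℕ.*-identityʳ ℓ))))

  same-ring : coefficientRing (image f pd L₀) ≐ coefficientRing (image f pd M)
  same-ring = signed (∣.m∣∣m∣ {d}) (bézout u₁ v₁)
    where
    d≢0 : d ≢ + 0
    d≢0 d≡0 = ℕ.≢-nonZero⁻¹ ℓ {{prime⇒nonZero ℓ-prime}} (trans (sym ∣d∣≡ℓ) (cong ℤ.∣_∣ d≡0))
    signed : d ∣ + ℤ.∣ d ∣ → ∃[ x ] ∃[ y ] (x · u₁ + y · v₁ ≡ gcd u₁ v₁) →
      coefficientRing (image f pd L₀) ≐ coefficientRing (image f pd M)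
    -- Here σ is the sign of d. Multiplying u₁ and v₁ by it turns the factor ℓ into d and leaves the
    -- discriminant unchanged, since σ² = 1.
    signed (divides σ ∣d∣≡σd) (x , y , bézout-g) = SameCoefficientRing.same-coefficientRing a b pd {i} {j} bézout-f
      M-sublattice p r q s v∈M w∈M d≢0 d∣det (σ · u₁) (σ · v₁)
      (trans pullback≡ (form-≡ (regroup u₁) (regroup v₁) (regroup u₁)))
      {x · σ} {y · σ}
      (trans (identity x y σ u₁ v₁) (trans (cong (_· (x · u₁ + y · v₁)) σ²≡1)
        (trans (ℤ.*-identityˡ (x · u₁ + y · v₁)) (trans bézout-g coprime))))
      (trans (disc-scale σ u₁ v₁ u₁) (trans (cong (_· disc (form u₁ v₁ u₁)) σ²≡1)
        (trans (ℤ.*-identityˡ (disc (form u₁ v₁ u₁))) disc≡)))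
      where
      ℓ≡σd : + ℓ ≡ σ · d
      ℓ≡σd = trans (cong +_ (sym ∣d∣≡ℓ)) ∣d∣≡σd
      regroup : ∀ k → + ℓ · k ≡ d · (σ · k)
      regroup k = trans (cong (_· k) (trans ℓ≡σd (ℤ.*-comm σ d))) (ℤ.*-assoc d σ k)
      σ²≡1 : σ · σ ≡ + 1
      σ²≡1 = ℤ.*-cancelʳ-≡ (σ · σ) (+ 1) (d · d) {{ℤ.i*j≢0 d d {{ℤ.≢-nonZero d≢0}} {{ℤ.≢-nonZero d≢0}}}}
        (trans (regroup′ σ d) (trans (cong₂ _·_ (sym ℓ≡σd) (sym ℓ≡σd)) (trans (sym det²≡) (sym (ℤ.*-identityˡ (d · d))))))
        where
        regroup′ : ∀ σ d → σ · σ · (d · d) ≡ σ · d · (σ · d)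
        regroup′ = ℤ-RingSolver.solve-∀
      identity : ∀ x y σ u v → x · σ · (σ · u) + y · σ · (σ · v) ≡ σ · σ · (x · u + y · v)
      identity = ℤ-RingSolver.solve-∀

proposition5 : (ℓ : ℕ) → Prime ℓ →
  (M₀ : Pred ℤ² 0ℓ) → IsSublattice M₀ → HasIndex M₀ ℓ →
  (a b : ℤ) → let f = form a b a in
  (pd : PositiveDefinite f) → Primitive f → Reduced f →
  (t : TemperedPerfect (toℝ f) M₀) → TemperedPerfect.DoublyWellRounded t →
  (w₁ w₂ : ℤ²) → IsBasis M₀ w₁ w₂ →
  ∃[ u ] ∃[ v ]
    ( ReducesTo (pullback f w₁ w₂) (form u v u)
    × gcd u v ≡ + ℓ
    × ∃[ u₁ ] ∃[ v₁ ]
        ( u ≡ + ℓ ℤ.* u₁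
        × v ≡ + ℓ ℤ.* v₁
        × PositiveDefinite (form u₁ v₁ u₁)
        × Primitive (form u₁ v₁ u₁)
        × Reduced (form u₁ v₁ u₁)
        × disc (form u₁ v₁ u₁) ≡ disc f
        × coefficientRing (image f pd L₀) ≐ coefficientRing (image f pd M₀)
        × (∀ τ → TemperedPerfect.IsTemperament t τ →
             τ * τ ≈ ℚ⇒ℝ (quotient (+ ℓ ℤ.* u₁) a {{posDef⇒a≢0 f pd}}))))
proposition5 ℓ ℓ-prime M₀ M₀-sublattice M₀-index a b pd f-primitive f-reduced t
  (_ , m , m₂ , m∈S′ , _ , m₂∈S′ , _ , m₂≢m , m₂≢-m) w₁@(p , r) w₂@(q , s) M₀-basis =
  in-coordinates (spanning (proj₁ (S′⊂M-0 m∈S′))) (spanning (proj₁ (S′⊂M-0 m₂∈S′)))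
  where
  open TemperedPerfect t using (S; S′; S′⊂M-0)
  open Sublattice M₀-sublattice using (combination∈)
  open IsBasis M₀-basis
  open Basis M₀-sublattice p r q s M₀-basis using (∣det∣≡index; det∣det)
  open Tempering M₀-sublattice t

  f g : Form
  f = form a b a
  g = pullback f w₁ w₂

  eval-e₁ : eval f (+ 1 , + 0) ≡ a
  eval-e₁ = identity a b
    where
    identity : ∀ a b → a · + 1 + b · + 0 + a · + 0 ≡ a
    identity = ℤ-RingSolver.solve-∀

  f-weaklyReduced : WeaklyReduced f
  f-weaklyReduced = reduced⇒weaklyReduced (subst (+ 0 <_) eval-e₁ (pd (+ 1 , + 0) λ ())) f-reduced

  ∣d∣≡ℓ : ℤ.∣ det w₁ w₂ ∣ ≡ ℓ
  ∣d∣≡ℓ = ∣det∣≡index M₀-index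

  vector : ℤ² → ℤ²
  vector (x , y) = x ·² w₁ +² y ·² w₂

  Conclusion : Set
  Conclusion = ∃[ u ] ∃[ v ]
    ( ReducesTo g (form u v u)
    × gcd u v ≡ + ℓ
    × ∃[ u₁ ] ∃[ v₁ ]
    ( u ≡ + ℓ · u₁
    × v ≡ + ℓ · v₁
    × PositiveDefinite (form u₁ v₁ u₁)
    × Primitive (form u₁ v₁ u₁)
    × Reduced (form u₁ v₁ u₁)
    × disc (form u₁ v₁ u₁) ≡ disc f
    × coefficientRing (image f pd L₀) ≐ coefficientRing (image f pd M₀)
    × (∀ τ → TemperedPerfect.IsTemperament t τ →
    τ * τ ≈ ℚ⇒ℝ (quotient (+ ℓ · u₁) a {{posDef⇒a≢0 f pd}}))))

  module Minimal (z : ℤ²) (vz∈S′ : vector z ∈ S′) where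

    u : ℤ
    u = eval g z

    u≡ : u ≡ eval f (vector z)
    u≡ = eval-pullback f w₁ w₂ (proj₁ z) (proj₂ z)

    u-minimal : ∀ {v} → v ∈ M₀ → v ≢ 0² → u ≤ eval f v
    u-minimal v∈M v≢0 = subst (_≤ _) (sym u≡) (S′-least vz∈S′ v∈M v≢0)

    0<u : + 0 < u
    0<u = subst (+ 0 <_) (sym u≡) (pd (vector z) (proj₂ (S′⊂M-0 vz∈S′)))

    module Reduction (v : ℤ) (g-reduced : WeaklyReduced (form u v u)) (v≤0 : v ≤ + 0)
      (x₁ x₂ y₁ y₂ : ℤ) (x₁y₂-x₂y₁≡1 : x₁ · y₂ - x₂ · y₁ ≡ + 1)
      (g~ : form u v u ≡ pullback g (x₁ , y₁) (x₂ , y₂)) where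

      n₁ n₂ : ℤ²
      n₁ = vector (x₁ , y₁)
      n₂ = vector (x₂ , y₂)

      pullback≡ : pullback f n₁ n₂ ≡ form u v u
      pullback≡ = trans (sym (pullback-pullback f w₁ w₂ x₁ y₁ x₂ y₂)) (sym g~)

      det≡ : det n₁ n₂ ≡ det w₁ w₂
      det≡ = trans (det-combination w₁ w₂ x₁ y₁ x₂ y₂)
        (trans (cong (_· det w₁ w₂) x₁y₂-x₂y₁≡1) (ℤ.*-identityˡ (det w₁ w₂)))

      ∣det∣≡ℓ : ℤ.∣ det n₁ n₂ ∣ ≡ ℓ
      ∣det∣≡ℓ = trans (cong ℤ.∣_∣ det≡) ∣d∣≡ℓ

      det²≡ : det n₁ n₂ · det n₁ n₂ ≡ + ℓ · + ℓ
      det²≡ = trans (abs-square (det n₁ n₂)) (cong (λ k → + k · + k) ∣det∣≡ℓ)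

      a<u : a < u
      a<u = minimum-grows (+ ℓ) {v = v} (ℤ.+≤+ (ℕ.nonTrivial⇒n>1 ℓ {{prime⇒nonTrivial ℓ-prime}})) f-weaklyReduced 0<u
        (trans (cong disc (sym pullback≡)) (trans (disc-pullback f n₁ n₂) (cong (_· disc f) det²≡)))

      e₁∉M : (+ 1 , + 0) ∉ M₀
      e₁∉M e₁∈M = ℤ.<-irrefl refl (ℤ.<-≤-trans a<u (subst (u ≤_) eval-e₁ (u-minimal e₁∈M λ ())))

      unit : ∃[ e ] (e ∈ S × eval f e ≡ a)
      unit = let e , e∈S , fe≡ = S-norm e₁∉M (λ v v≢0 → subst (_≤ eval f v) (sym eval-e₁) (minimum≤ f-weaklyReduced v≢0))
             in e , e∈S , trans fe≡ eval-e₁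

      temperament : ∀ {k} → u ≡ k → ∀ τ → TemperedPerfect.IsTemperament t τ →
        τ * τ ≈ ℚ⇒ℝ (quotient k a {{posDef⇒a≢0 f pd}})
      temperament u≡k τ τ-temperament = ratio {a≢0 = posDef⇒a≢0 f pd} unit (trans (sym u≡) u≡k)
        where
        -- Generalising k and a to variables lets both equations be matched with `refl`, which
        -- carries the nonzero proof inside `quotient` along.
        ratio : ∀ {k a} {a≢0 : ℤ.NonZero a} → ∃[ e ] (e ∈ S × eval f e ≡ a) → eval f (vector z) ≡ k →
          τ * τ ≈ ℚ⇒ℝ (quotient k a {{a≢0}})
        ratio {a≢0 = a≢0} (e , e∈S , refl) refl = temperament² e∈S vz∈S′ a≢0 τ τ-temperament

      conclusion : + ℓ ∣ u × + ℓ ∣ v → ∃[ i ] ∃[ j ] (i · a + j · b ≡ + 1) → Conclusion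
      conclusion (divides u₁ u≡u₁ℓ , divides v₁ v≡v₁ℓ) (i , j , bézout-f) =
        u , v ,
        record
          { equivalent = g~form
          ; reduced    = weaklyReduced⇒reduced g-reduced v≤0
          ; unique     = λ {h} g~h h-reduced → reduced-unique g-reduced v≤0
              (~-trans {form u v u} {g} {h} (~-sym {g} {form u v u} g~form) g~h) h-reduced
          } ,
        trans (cong₂ gcd u≡ℓu₁ v≡ℓv₁) gcd≡ℓ ,
        u₁ , v₁ , u≡ℓu₁ , v≡ℓv₁ ,
        weaklyReduced⇒positiveDefinite g₁-reduced , g₁-primitive ,
        weaklyReduced⇒reduced g₁-reduced v₁≤0 , disc≡ , same-ring , temperament u≡ℓu₁
        where
        g~form : g ~ form u v u
        g~form = x₁ , x₂ , y₁ , y₂ , x₁y₂-x₂y₁≡1 , g~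
        u≡ℓu₁ : u ≡ + ℓ · u₁
        u≡ℓu₁ = trans u≡u₁ℓ (ℤ.*-comm u₁ (+ ℓ))
        v≡ℓv₁ : v ≡ + ℓ · v₁
        v≡ℓv₁ = trans v≡v₁ℓ (ℤ.*-comm v₁ (+ ℓ))
        form≡ : form u v u ≡ form (+ ℓ · u₁) (+ ℓ · v₁) (+ ℓ · u₁)
        form≡ = form-≡ u≡ℓu₁ v≡ℓv₁ u≡ℓu₁
        v₁≤0 : v₁ ≤ + 0
        v₁≤0 = ℤ.*-cancelˡ-≤-pos v₁ (+ 0) (+ ℓ) {{ℤ.positive (ℤ.+<+ (ℕ.>-nonZero⁻¹ ℓ {{prime⇒nonZero ℓ-prime}}))}}
          (subst (+ ℓ · v₁ ≤_) (sym (ℤ.*-zeroʳ (+ ℓ))) (subst (_≤ + 0) v≡ℓv₁ v≤0))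
        det-n∣det : ∀ {v w} → v ∈ M₀ → w ∈ M₀ → det n₁ n₂ ∣ det v w
        det-n∣det {v} {w} v∈M w∈M = subst (_∣ det v w) (sym det≡) (det∣det v∈M w∈M)
        open ReducedBasis ℓ-prime {a} {b} pd f-weaklyReduced {i} {j} bézout-f M₀-sublattice
          {proj₁ n₁} {proj₂ n₁} {proj₁ n₂} {proj₂ n₂}
          (combination∈ x₁ y₁ w₁∈ w₂∈) (combination∈ x₂ y₂ w₁∈ w₂∈)
          det-n∣det
          ∣det∣≡ℓ (trans pullback≡ form≡) (subst WeaklyReduced form≡ g-reduced)

      result : Conclusion
      result = conclusion
        (prime∣equal-minima ℓ-prime (proj₁ n₁) (proj₂ n₁) (proj₁ n₂) (proj₂ n₂) f-weaklyReduced g-reduced pullback≡ det²≡)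
        (primitive⇒bézout a b f-primitive)

  in-coordinates : ∃[ x ] ∃[ y ] (m ≡ vector (x , y)) → ∃[ x ] ∃[ y ] (m₂ ≡ vector (x , y)) → Conclusion
  in-coordinates (x , y , m≡) (x′ , y′ , m₂≡) = reduce (EqualMinima.reduction g x y x′ y′ 0<u
    (λ { (i , j) z≢0 → subst (u ≤_) (sym (eval-pullback f w₁ w₂ i j))
      (u-minimal (combination∈ i j w₁∈ w₂∈) λ vz≡0 → z≢0 (cong₂ _,_ (proj₁ (independent i j vz≡0)) (proj₂ (independent i j vz≡0)))) })
    (trans (eval-pullback f w₁ w₂ x′ y′) (trans (S′-norm (subst (_∈ S′) m₂≡ m₂∈S′) vz∈S′) (sym u≡)))
    (λ z′≡z → m₂≢m (trans m₂≡ (trans (cong vector z′≡z) (sym m≡))))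
    (λ z′≡-z → m₂≢-m (trans m₂≡ (trans (cong vector z′≡-z) (trans (negate p r q s x y) (cong -²_ (sym m≡)))))))
    where
    vz∈S′ : vector (x , y) ∈ S′
    vz∈S′ = subst (_∈ S′) m≡ m∈S′
    open Minimal (x , y) vz∈S′
    negate : ∀ p r q s x y → - x ·² (p , r) +² - y ·² (q , s) ≡ -² (x ·² (p , r) +² y ·² (q , s))
    negate p r q s x y = cong₂ _,_ (identity x y p q) (identity x y r s)
      where
      identity : ∀ x y p q → - x · p + - y · q ≡ - (x · p + y · q)
      identity = ℤ-RingSolver.solve-∀
    reduce : ∃[ v ] (g ~ form u v u × WeaklyReduced (form u v u) × v ≤ + 0) → Conclusion
    reduce (v , (x₁ , x₂ , y₁ , y₂ , det≡1 , g~) , g-reduced , v≤0) =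
      Reduction.result v g-reduced v≤0 x₁ x₂ y₁ y₂ det≡1 g~
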